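{- Let $d\ge 1$ be real. Given an $n$-vertex bipartite graph $G$ of average degree at most $d$, one can count the number of perfect matchings in $G$ in $\mathcal{O}^\star\bigl(2^{(1-1/(3.55\, d))\,n/2}\bigr)$ time and exponential space.
   Context: Graphs are finite. The average degree of an $n$-vertex graph $G=(V,E)$ is $\frac1n\sum_{v\in V}\deg(v) = 2|E|/n$. The notation $\mathcal{O}^\star(\cdot)$ suppresses factors polynomial in the input size. "Exponential space" means that the space used is not restricted to be polynomial. -}

module Defs where

import Algebra.Properties.Group as Group
open import Data.Bool.Base using (Bool; T; if_then_else_)
open import Data.Bool.Properties using (T?)
open import Data.Empty using (⊥-elim)
open import Data.Fin.Base as Fin using (Fin)
import Data.Fin.Properties as Fin
open import Data.Integer.Base as ℤ using (+_; -[1+_])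
open import Data.List.Base
  using (List; []; _∷_; _++_; map; concatMap; filter; length; allFin; cartesianProduct)
open import Data.Nat.Base as ℕ using (ℕ; zero; suc)
import Data.Nat.Properties as ℕ
open import Data.Nat.ListAction using (sum)
open import Data.Nat.Logarithm using (⌊log₂_⌋)
open import Data.Product.Base using (Σ-syntax; ∃; ∃-syntax; _×_; _,_)
open import Data.Rational.Base
open import Data.Rational.Properties
open import Data.Sum.Base using (_⊎_; inj₁; inj₂; swap)
open import Level using (0ℓ)
open import Relation.Binary.Definitions using (tri<; tri≈; tri>)
open import Relation.Binary.PropositionalEquality
open import Relation.Nullary using (¬_; yes; no; does; _×-dec_; _⊎-dec_)
open import Relation.Unary using (Pred; Decidable)

------------------------------------------------------------------------
-- Finite simple graphs on the vertex set Fin n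

record Graph (n : ℕ) : Set where
  field
    adj         : Fin n → Fin n → Bool
    symmetric   : ∀ u v → T (adj u v) → T (adj v u)
    irreflexive : ∀ u → ¬ T (adj u u)

open Graph public using (adj)

module _ {n : ℕ} (G : Graph n) where

  Bipartite : Set
  Bipartite = Σ[ side ∈ (Fin n → Bool) ] ∀ u v → T (adj G u v) → side u ≢ side v

  degree : Fin n → ℕ
  degree v = length (filter (λ u → T? (adj G v u)) (allFin n))

  averageDegree : .{{_ : ℕ.NonZero n}} → ℚ
  averageDegree = + sum (map degree (allFin n)) / n

  -- Each edge is listed once, with its smaller endpoint first.
  edges : List (Fin n × Fin n)
  edges = filter (λ (u , v) → (u Fin.<? v) ×-dec T? (adj G u v))
                 (cartesianProduct (allFin n) (allFin n))

module _ {n : ℕ} where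

  Incident : Fin n → Fin n × Fin n → Set
  Incident w (u , v) = w ≡ u ⊎ w ≡ v

  incident? : ∀ w → Decidable (Incident w)
  incident? w (u , v) = (w Fin.≟ u) ⊎-dec (w Fin.≟ v)

  CoversEachVertexOnce : List (Fin n × Fin n) → Set
  CoversEachVertexOnce M = ∀ w → length (filter (incident? w) M) ≡ 1

  coversEachVertexOnce? : Decidable CoversEachVertexOnce
  coversEachVertexOnce? M = Fin.all? λ w → length (filter (incident? w) M) ℕ.≟ 1

sublists : ∀ {A : Set} → List A → List (List A)
sublists []       = [] ∷ []
sublists (x ∷ xs) = map (x ∷_) (sublists xs) ++ sublists xs

-- The list of edges has no repetitions, so its sublists are exactly the
-- sets of edges, each occurring once.
perfectMatchings : ∀ {n} → Graph n → List (List (Fin n × Fin n))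
perfectMatchings G = filter coversEachVertexOnce? (sublists (edges G))

------------------------------------------------------------------------
-- Real numbers, as two-sided Dedekind cuts

record ℝ : Set₁ where
  field
    L U           : Pred ℚ 0ℓ
    L-inhabited   : ∃ L
    U-inhabited   : ∃ U
    L-down        : ∀ {q r} → q < r → L r → L q
    U-up          : ∀ {q r} → q < r → U q → U r
    L-open        : ∀ {q} → L q → ∃[ r ] q < r × L r
    U-open        : ∀ {r} → U r → ∃[ q ] q < r × U q
    disjoint      : ∀ {q} → L q → ¬ U q
    located       : ∀ {q r} → q < r → L q ⊎ U r

infix 4 _<ᴿ_ _ᴿ<_ _≤ᴿ_

_<ᴿ_ : ℚ → ℝ → Set
q <ᴿ x = ℝ.L x q

_ᴿ<_ : ℝ → ℚ → Set
x ᴿ< q = ℝ.U x q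

_≤ᴿ_ : ℚ → ℝ → Set
q ≤ᴿ x = ¬ (x ᴿ< q)

L<U : ∀ (x : ℝ) {l u} → l <ᴿ x → x ᴿ< u → l < u
L<U x {l} {u} l<x x<u with <-cmp l u
... | tri< l<u _ _  = l<u
... | tri≈ _ refl _ = ⊥-elim (ℝ.disjoint x l<x x<u)
... | tri> _ _ u<l  = ⊥-elim (ℝ.disjoint x l<x (ℝ.U-up x u<l x<u))

1≤⇒0< : ∀ x → 1ℚ ≤ᴿ x → 0ℚ <ᴿ x
1≤⇒0< x 1≤x with ℝ.located x {0ℚ} {1ℚ} (positive⁻¹ 1ℚ)
... | inj₁ 0<x = 0<x
... | inj₂ x<1 = ⊥-elim (1≤x x<1)

private
  cancelˡ : ∀ c .{{_ : NonZero c}} q → c * ((1/ c) * q) ≡ q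
  cancelˡ c q = trans (sym (*-assoc c (1/ c) q))
                  (trans (cong (_* q) (*-inverseʳ c)) (*-identityˡ q))

  cancelʳ : ∀ c .{{_ : NonZero c}} q → (q * (1/ c)) * c ≡ q
  cancelʳ c q = trans (*-assoc q (1/ c) c)
                  (trans (cong (q *_) (*-inverseˡ c)) (*-identityʳ q))

  1-<1- : ∀ {q r} → q < r → 1ℚ - r < 1ℚ - q
  1-<1- q<r = +-monoʳ-< 1ℚ (neg-antimono-< q<r)

  1-1- : ∀ q → 1ℚ - (1ℚ - q) ≡ q
  1-1- q = begin
    1ℚ + - (1ℚ + - q)    ≡⟨ cong (λ r → 1ℚ + r) (neg-distrib-+ 1ℚ (- q)) ⟩
    1ℚ + (- 1ℚ + - - q)  ≡⟨ sym (+-assoc 1ℚ (- 1ℚ) (- - q)) ⟩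
    0ℚ + - - q           ≡⟨ +-identityˡ (- - q) ⟩
    - - q                ≡⟨ Group.⁻¹-involutive +-0-group q ⟩
    q                    ∎
    where open ≡-Reasoning


-- c · x
scale : (c : ℚ) → .{{Positive c}} → ℝ → ℝ
scale c x = record
  { L = λ q → ∃[ l ] l <ᴿ x × q < c * l
  ; U = λ q → ∃[ u ] x ᴿ< u × c * u < q
  ; L-inhabited = let l , l<x = X.L-inhabited ; l′ , l<l′ , l′<x = X.L-open l<x
                  in c * l , l′ , l′<x , *-monoʳ-<-pos c l<l′
  ; U-inhabited = let u , x<u = X.U-inhabited ; u′ , u′<u , x<u′ = X.U-open x<u
                  in c * u , u′ , x<u′ , *-monoʳ-<-pos c u′<u
  ; L-down = λ { q<r (l , l<x , r<cl) → l , l<x , <-trans q<r r<cl }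
  ; U-up   = λ { q<r (u , x<u , cu<q) → u , x<u , <-trans cu<q q<r }
  ; L-open = λ { (l , l<x , q<cl) → let m , q<m , m<cl = <-dense q<cl
                                    in m , q<m , l , l<x , m<cl }
  ; U-open = λ { (u , x<u , cu<q) → let m , cu<m , m<q = <-dense cu<q
                                    in m , m<q , u , x<u , cu<m }
  ; disjoint = λ { (l , l<x , q<cl) (u , x<u , cu<q) →
      <-irrefl refl (<-trans (<-trans q<cl (*-monoʳ-<-pos c (L<U x l<x x<u))) cu<q) }
  ; located = loc
  }
  where
  module X = ℝ x
  instance
    c≢0 : NonZero c
    c≢0 = pos⇒nonZero c
    1/c>0 : Positive (1/ c)
    1/c>0 = 1/pos⇒pos c

  loc : ∀ {q r} → q < r → (∃[ l ] l <ᴿ x × q < c * l) ⊎ (∃[ u ] x ᴿ< u × c * u < r)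
  loc {q} {r} q<r with <-dense q<r
  ... | m , q<m , m<r with <-dense m<r
  ... | k , m<k , k<r with X.located (*-monoʳ-<-pos (1/ c) m<k)
  ... | inj₁ m/c<x = inj₁ (1/ c * m , m/c<x , subst (q <_) (sym (cancelˡ c m)) q<m)
  ... | inj₂ x<k/c = inj₂ (1/ c * k , x<k/c , subst (_< r) (sym (cancelˡ c k)) k<r)

-- 1 - x
1-ᴿ_ : ℝ → ℝ
1-ᴿ x = record
  { L = λ q → x ᴿ< 1ℚ - q
  ; U = λ q → 1ℚ - q <ᴿ x
  ; L-inhabited = let u , x<u = X.U-inhabited
                  in 1ℚ - u , subst X.U (sym (1-1- u)) x<u
  ; U-inhabited = let l , l<x = X.L-inhabited
                  in 1ℚ - l , subst X.L (sym (1-1- l)) l<x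
  ; L-down = λ q<r → X.U-up (1-<1- q<r)
  ; U-up   = λ q<r → X.L-down (1-<1- q<r)
  ; L-open = λ {q} x<1-q → let u , u<1-q , x<u = X.U-open x<1-q
                           in 1ℚ - u , subst (_< 1ℚ - u) (1-1- q) (1-<1- u<1-q)
                                     , subst X.U (sym (1-1- u)) x<u
  ; U-open = λ {q} 1-q<x → let l , 1-q<l , l<x = X.L-open 1-q<x
                           in 1ℚ - l , subst (1ℚ - l <_) (1-1- q) (1-<1- 1-q<l)
                                     , subst X.L (sym (1-1- l)) l<x
  ; disjoint = λ x<1-q 1-q<x → X.disjoint 1-q<x x<1-q
  ; located = λ q<r → swap (X.located (1-<1- q<r))
  }
  where module X = ℝ x

-- 1 / x, for x > 0
recip : (x : ℝ) → 0ℚ <ᴿ x → ℝ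
recip x 0<x = record
  { L = λ q → ∃[ u ] x ᴿ< u × q * u < 1ℚ
  ; U = λ q → ∃[ l ] 0ℚ < l × l <ᴿ x × 1ℚ < q * l
  ; L-inhabited = let u , x<u = X.U-inhabited
                  in 0ℚ , u , x<u , subst (_< 1ℚ) (sym (*-zeroˡ u)) (positive⁻¹ 1ℚ)
  ; U-inhabited = let l , 0<l , l<x = X.L-open 0<x
                      q , ql≡2 = divide 0<l 2ℚ
                  in q , l , 0<l , l<x , subst (1ℚ <_) (sym ql≡2) 1<2
  ; L-down = λ { q<r (u , x<u , ru<1) →
      u , x<u , <-trans (*-monoˡ-<-pos u {{positive (0<U x<u)}} q<r) ru<1 }
  ; U-up   = λ { q<r (l , 0<l , l<x , 1<ql) →
      l , 0<l , l<x , <-trans 1<ql (*-monoˡ-<-pos l {{positive 0<l}} q<r) }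
  ; L-open = λ { {q} (u , x<u , qu<1) →
      let m , qu<m , m<1 = <-dense qu<1
          r , ru≡m = divide (0<U x<u) m
      in r , *-cancelʳ-<-nonNeg u {{pos⇒nonNeg u {{positive (0<U x<u)}}}}
               (subst (q * u <_) (sym ru≡m) qu<m)
           , u , x<u , subst (_< 1ℚ) (sym ru≡m) m<1 }
  ; U-open = λ { {q} (l , 0<l , l<x , 1<ql) →
      let m , 1<m , m<ql = <-dense 1<ql
          r , rl≡m = divide 0<l m
      in r , *-cancelʳ-<-nonNeg l {{pos⇒nonNeg l {{positive 0<l}}}}
               (subst (_< q * l) (sym rl≡m) m<ql)
           , l , 0<l , l<x , subst (1ℚ <_) (sym rl≡m) 1<m }
  ; disjoint = λ { {q} (u , x<u , qu<1) (l , 0<l , l<x , 1<ql) →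
      let instance
            l>0 : Positive l
            l>0 = positive 0<l
          0<q : 0ℚ < q
          0<q = *-cancelʳ-<-nonNeg l {{pos⇒nonNeg l}}
                  (subst (_< q * l) (sym (*-zeroˡ l)) (<-trans (positive⁻¹ 1ℚ) 1<ql))
      in <-irrefl refl (<-trans 1<ql
           (<-trans (*-monoʳ-<-pos q {{positive 0<q}} (L<U x l<x x<u)) qu<1)) }
  ; located = loc
  }
  where
  module X = ℝ x

  2ℚ = + 2 / 1

  1<2 : 1ℚ < 2ℚ
  1<2 = *<* (ℤ.+<+ (ℕ.s≤s (ℕ.s≤s ℕ.z≤n)))

  0<U : ∀ {u} → x ᴿ< u → 0ℚ < u
  0<U = L<U x 0<x

  divide : ∀ {v} → 0ℚ < v → ∀ m → ∃[ q ] q * v ≡ m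
  divide {v} 0<v m = m * (1/ v) , cancelʳ v m
    where instance
      v≢0 : NonZero v
      v≢0 = >-nonZero 0<v

  loc : ∀ {q r} → q < r →
        (∃[ u ] x ᴿ< u × q * u < 1ℚ) ⊎ (∃[ l ] 0ℚ < l × l <ᴿ x × 1ℚ < r * l)
  loc {q} {r} q<r with 0ℚ <? q
  ... | no 0≮q = let u , x<u = X.U-inhabited in
    inj₁ (u , x<u , ≤-<-trans
      (subst (q * u ≤_) (*-zeroˡ u)
        (*-monoʳ-≤-nonNeg u {{pos⇒nonNeg u {{positive (0<U x<u)}}}} (≮⇒≥ 0≮q)))
      (positive⁻¹ 1ℚ))
  ... | yes 0<q = cases
    where
    instance
      q>0 : Positive q
      q>0 = positive 0<q
      r>0 : Positive r
      r>0 = positive (<-trans 0<q q<r)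
      q≢0 : NonZero q
      q≢0 = pos⇒nonZero q
      r≢0 : NonZero r
      r≢0 = pos⇒nonZero r

    1/r<1/q : 1/ r < 1/ q
    1/r<1/q = *-cancelʳ-<-nonNeg q {{pos⇒nonNeg q}}
      (subst ((1/ r) * q <_) (trans (*-inverseˡ r) (sym (*-inverseˡ q)))
        (*-monoʳ-<-pos (1/ r) {{1/pos⇒pos r}} q<r))

    cases : _
    cases with <-dense 1/r<1/q
    ... | m , 1/r<m , m<1/q with <-dense m<1/q
    ... | k , m<k , k<1/q with X.located m<k
    ... | inj₁ m<x = inj₂ (m , <-trans (positive⁻¹ (1/ r) {{1/pos⇒pos r}}) 1/r<m , m<x
                             , subst (_< r * m) (*-inverseʳ r) (*-monoʳ-<-pos r 1/r<m))
    ... | inj₂ x<k = inj₁ (k , x<k , subst (q * k <_) (*-inverseʳ q) (*-monoʳ-<-pos q k<1/q))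

scale-positive : ∀ c .{{_ : Positive c}} x → 0ℚ <ᴿ x → 0ℚ <ᴿ scale c x
scale-positive c x 0<x = let l , 0<l , l<x = ℝ.L-open x 0<x in
  l , l<x , subst (_< c * l) (*-zeroʳ c) (*-monoʳ-<-pos c 0<l)

-- (1 - 1/(3.55 d)) · n/2
exponent : (d : ℝ) → 1ℚ ≤ᴿ d → (n : ℕ) → .{{ℕ.NonZero n}} → ℝ
exponent d 1≤d n =
  scale (+ n / 2) {{n/2>0}} (1-ᴿ recip (scale 3·55 d) (scale-positive 3·55 d (1≤⇒0< d 1≤d)))
  where
  3·55 = + 355 / 100

  n/2>0 : Positive (+ n / 2)
  n/2>0 = normalize-pos n 2

-- t ≤ p · 2 ^ (a / b), raised to the power b
infix 4 _≤_·2^ℚ_ _≤_·2^_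

_≤_·2^ℚ_ : ℕ → ℕ → ℚ → Set
t ≤ p ·2^ℚ mkℚ (+ a)    b-1 _ = t ℕ.^ suc b-1 ℕ.≤ p ℕ.^ suc b-1 ℕ.* 2 ℕ.^ a
t ≤ p ·2^ℚ mkℚ -[1+ a ] b-1 _ = t ℕ.^ suc b-1 ℕ.* 2 ℕ.^ suc a ℕ.≤ p ℕ.^ suc b-1

-- 2 ^ x is the infimum of 2 ^ s over the rationals s > x.
_≤_·2^_ : ℕ → ℕ → ℝ → Set
t ≤ p ·2^ x = ∀ s → x ᴿ< s → t ≤ p ·2^ℚ s

------------------------------------------------------------------------
-- Random access machines, with the logarithmic cost measure (as in Aho,
-- Hopcroft and Ullman, The Design and Analysis of Computer Algorithms):
-- every instruction is charged the total bit length of the numbers and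
-- addresses it handles.  Control flow is structured rather than by jumps,
-- and the number of memory cells in use is not restricted.

Memory : Set
Memory = ℕ → ℕ

infix 9 _[_↦_]

_[_↦_] : Memory → ℕ → ℕ → Memory
(μ [ i ↦ v ]) j = if does (j ℕ.≟ i) then v else μ j

data Operand : Set where
  lit : ℕ → Operand
  reg : ℕ → Operand
  ind : ℕ → Operand    -- the cell whose address is stored in the given cell

data Target : Set where
  reg : ℕ → Target
  ind : ℕ → Target

data Op : Set where
  add sub mul div : Op

infix  6 _≔_⟨_⟩_
infixr 5 _⨾_

data Program : Set where
  _≔_⟨_⟩_            : Target → Operand → Op → Operand → Program
  _⨾_                : Program → Program → Program
  ifnz_then_else_    : Operand → Program → Program → Program
  whilenz_repeat_    : Operand → Program → Program

bits : ℕ → ℕ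
bits k = suc ⌊log₂ k ⌋

value : Memory → Operand → ℕ
value μ (lit k) = k
value μ (reg i) = μ i
value μ (ind i) = μ (μ i)

cost : Memory → Operand → ℕ
cost μ (lit k) = bits k
cost μ (reg i) = bits i ℕ.+ bits (μ i)
cost μ (ind i) = bits i ℕ.+ bits (μ i) ℕ.+ bits (μ (μ i))

address : Memory → Target → ℕ
address μ (reg i) = i
address μ (ind i) = μ i

addressCost : Memory → Target → ℕ
addressCost μ (reg i) = bits i
addressCost μ (ind i) = bits i ℕ.+ bits (μ i)

-- Subtraction is truncated and the quotient by zero is zero.
apply : Op → ℕ → ℕ → ℕ
apply add a b       = a ℕ.+ b
apply sub a b       = a ℕ.∸ b
apply mul a b       = a ℕ.* b
apply div a zero    = 0
apply div a (suc b) = a ℕ./ suc b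

-- ⟨ P , μ ⟩⇓⟨ μ′ , t ⟩: started in memory μ, P halts in memory μ′ at cost t.
data ⟨_,_⟩⇓⟨_,_⟩ : Program → Memory → Memory → ℕ → Set where
  assign : ∀ {μ} x a o b → let v = apply o (value μ a) (value μ b) in
           ⟨ x ≔ a ⟨ o ⟩ b , μ ⟩⇓⟨ μ [ address μ x ↦ v ] ,
             cost μ a ℕ.+ cost μ b ℕ.+ addressCost μ x ℕ.+ bits v ⟩
  seq    : ∀ {P Q μ μ′ μ″ s t} →
           ⟨ P , μ ⟩⇓⟨ μ′ , s ⟩ → ⟨ Q , μ′ ⟩⇓⟨ μ″ , t ⟩ →
           ⟨ P ⨾ Q , μ ⟩⇓⟨ μ″ , s ℕ.+ t ⟩
  then′  : ∀ {a P Q μ μ′ t} → value μ a ≢ 0 → ⟨ P , μ ⟩⇓⟨ μ′ , t ⟩ →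
           ⟨ ifnz a then P else Q , μ ⟩⇓⟨ μ′ , cost μ a ℕ.+ t ⟩
  else′  : ∀ {a P Q μ μ′ t} → value μ a ≡ 0 → ⟨ Q , μ ⟩⇓⟨ μ′ , t ⟩ →
           ⟨ ifnz a then P else Q , μ ⟩⇓⟨ μ′ , cost μ a ℕ.+ t ⟩
  stop   : ∀ {a P μ} → value μ a ≡ 0 →
           ⟨ whilenz a repeat P , μ ⟩⇓⟨ μ , cost μ a ⟩
  loop   : ∀ {a P μ μ′ μ″ s t} → value μ a ≢ 0 →
           ⟨ P , μ ⟩⇓⟨ μ′ , s ⟩ → ⟨ whilenz a repeat P , μ′ ⟩⇓⟨ μ″ , t ⟩ →
           ⟨ whilenz a repeat P , μ ⟩⇓⟨ μ″ , cost μ a ℕ.+ s ℕ.+ t ⟩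

load : List ℕ → Memory
load []       _       = 0
load (x ∷ xs) zero    = x
load (x ∷ xs) (suc i) = load xs i

-- The number of vertices, followed by the adjacency matrix row by row.
encode : ∀ {n} → Graph n → List ℕ
encode {n} G =
  n ∷ concatMap (λ u → map (λ v → if adj G u v then 1 else 0) (allFin n)) (allFin n)

-- The output is the contents of cell 0 on halting.
_On_Outputs_InTime_ : Program → List ℕ → ℕ → ℕ → Set
P On input Outputs k InTime t = ∃[ μ ] ⟨ P , load input ⟩⇓⟨ μ , t ⟩ × μ 0 ≡ k

module Submission where

-- Let the two sides of G have m vertices each and let B be one of them.  The
-- vertices of the other side A are matched one after the other; a table
-- counts, for each reachable set of matched vertices, the ways to reach it.
-- Everything depends on the order of A.  Rank the vertices of B by
-- decreasing degree, and match the vertices of A in the order of the highest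
-- rank among their neighbours.  As long as j vertices of A are left, the k
-- vertices of lowest degree in B are unmatched provided that their degrees
-- add up to at most j, which allows k of about j / d.  Hence a reachable set
-- meets B in a subset of size m - j of a set of size m - k: there are at most
-- 2 ^ (m - k) such sets, and at most 3 ^ (m - k) / 2 ^ (m - j).  The former
-- bound suffices for j ≥ m / 3.55, the latter for j ≤ m / 3.55.

open import Data.Bool.Base using (Bool; true; false; T; if_then_else_; not; _xor_; _∧_; _∨_)
open import Data.Bool.Properties as Bool using (T?)
open import Data.Empty using (⊥; ⊥-elim)
open import Data.Fin using (#_)
open import Data.Fin.Base using (Fin; zero; suc; toℕ)
open import Data.Fin.Properties as Fin using (toℕ-injective; toℕ<n; toℕ-fromℕ<)
open import Data.Integer.Base as ℤ using (ℤ)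
import Data.Integer.Properties as ℤ
open import Data.List.Base
  using (List; []; _∷_; _++_; map; filter; length; allFin; cartesianProduct; tabulate; concatMap)
open import Data.List.Membership.Propositional using (_∈_; _∉_)
open import Data.List.Properties
  using (length-++; length-map; length-tabulate; filter-accept; filter-reject; filter-++; filter-≐)
open import Data.List.Relation.Unary.All as All using (All; []; _∷_)
open import Data.List.Relation.Unary.All.Properties as All using (all-filter)
open import Data.List.Relation.Unary.AllPairs using ([]; _∷_)
open import Data.List.Relation.Unary.Any using (here; there)
open import Data.List.Relation.Unary.Unique.Propositional using (Unique)
open import Data.Nat.Base
open import Data.Nat.DivMod
  using (m/n≤m; m/n*n≤m; m*n/n≡m; m/n/o≡m/[n*o]; n/1≡n; /-monoˡ-≤; +-distrib-/-∣ʳ; m<n⇒m%n≡m; [m+kn]%n≡m%n)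
open import Data.Nat.Divisibility using (n∣m*n)
open import Data.Nat.ListAction using (sum)
open import Data.Nat.Logarithm using (⌊log₂⌋-mono-≤; ⌊log₂[2^n]⌋≡n)
open import Data.Nat.Properties
open import Data.Nat.Tactic.RingSolver using (solve-∀)
open import Data.Product.Base using (Σ-syntax; _×_; _,_; proj₁; proj₂)
open import Data.Rational.Base as ℚ using (ℚ; mkℚ; 1ℚ; 0ℚ)
import Data.Rational.Properties as ℚ
import Data.Rational.Solver as ℚSolver
open import Data.Rational.Unnormalised.Base as ℚᵘ using (ℚᵘ; mkℚᵘ)
import Data.Rational.Unnormalised.Properties as ℚᵘ
open import Data.Sum.Base using (_⊎_; inj₁; inj₂)
open import Data.Unit.Base using (⊤; tt)
open import Data.Vec.Base as Vec using (Vec; []; _∷_; lookup; _[_]≔_; replicate)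
open import Data.Vec.Properties as Vec
  using (lookup∘update; lookup∘update′; lookup-map; lookup-replicate; map-[]≔; []≔-commutes)
open import Function.Base using (_∘_; id; case_of_)
open import Relation.Binary.Definitions using (tri<; tri≈; tri>)
open import Relation.Binary.PropositionalEquality
open import Relation.Nullary using (¬_; Dec; yes; no; does; _×-dec_)
open import Relation.Nullary.Decidable using (dec-true; dec-false)
open import Relation.Unary using (Decidable)
open import Defs
open import Algebra.Properties.Semiring.Sum +-*-semiring
  using (sum-cong-≗; ∑-distrib-+; ∑-comm; *-distribˡ-sum; *-distribʳ-sum) renaming (sum to ∑)

-- A language of loops over tables, compiled to random access machines

-- The program is not told the sides, and a disconnected graph has several 2-colourings. The one it
-- finds may have sides of different sizes; every edge covers one vertex of each side, so the answer
-- is then 0 and all levels stay empty. The states have to be bounded for a colouring known only at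
-- run time, which is why the work of the second half of the program is chosen after the first half
-- has run. The 3 comes from weights: over the subsets X of a set of size f, the powers 2^|X| sum to
-- 3^f, so at most 3^f / 2^s of them have size s. Its binary logarithm is replaced by 8/5, since 3^5
-- = 243 and 2^8 = 256. In the exponent both estimates are then linear in j; with k = j / d the
-- first meets the target at j = m / 3.55, and the second stays below it for all smaller j because d
-- is at least 1. The program does not depend on d. For each j the degrees themselves determine k,
-- and d enters only when averages are compared. As a real exponent is known only through the
-- rationals above it, one bound on the number of states is fixed first and then compared with each
-- of them.

data Exp (K : ℕ) : Set where
  lit : ℕ → Exp K
  rd  : Fin K → Exp K → Exp K
  bin : Op → Exp K → Exp K → Exp K

infixr 5 _▸_

data Cmd (K : ℕ) : Set where
  wr   : Fin K → Exp K → Exp K → Cmd K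
  _▸_  : Cmd K → Cmd K → Cmd K
  when : Exp K → Cmd K → Cmd K
  for  : Fin K → Exp K → Cmd K → Cmd K

State : ℕ → Set
State K = Fin K → ℕ → ℕ

module _ {K : ℕ} where

  -- The Boolean comparison of column numbers computes for concrete columns, so that reading one
  -- column after a write to another reduces definitionally. Invariants about untouched columns
  -- carry over without proof.
  upd : State K → Fin K → ℕ → ℕ → State K
  upd σ a i v b j = if toℕ a ≡ᵇ toℕ b then (if i ≡ᵇ j then v else σ b j) else σ b j

  eval : State K → Exp K → ℕ
  eval σ (lit k)     = k
  eval σ (rd a e)    = σ a (eval σ e)
  eval σ (bin o e f) = apply o (eval σ e) (eval σ f)

  -- Enough consecutive registers, from `r` on, for the code compiled at `r`. The second operand is
  -- evaluated one register higher, and the body of a loop two registers higher.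
  heightE : Exp K → ℕ
  heightE (lit k)     = 1
  heightE (rd a e)    = heightE e
  heightE (bin o e f) = heightE e ⊔ suc (heightE f)

  height : Cmd K → ℕ
  height (wr a e f)  = heightE e ⊔ suc (heightE f)
  height (c ▸ d)     = height c ⊔ height d
  height (when e c)  = heightE e ⊔ height c
  height (for x e c) = heightE e ⊔ (3 + height c)

  sizeE : Exp K → ℕ
  sizeE (lit k)     = 1
  sizeE (rd a e)    = sizeE e + 4
  sizeE (bin o e f) = sizeE e + (sizeE f + 1)

  -- The value of an expression is left in register r; higher registers are
  -- scratch.  Cell i of column a lives at address i * K + a + base, where the
  -- base is kept in register 1.
  compileE : Exp K → ℕ → Program
  compileE (lit k)     r = reg r ≔ lit k ⟨ add ⟩ lit 0
  compileE (rd a e)    r = compileE e r ⨾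
                           reg r ≔ reg r ⟨ mul ⟩ lit K ⨾
                           reg r ≔ reg r ⟨ add ⟩ lit (toℕ a) ⨾
                           reg r ≔ reg r ⟨ add ⟩ reg 1 ⨾
                           reg r ≔ ind r ⟨ add ⟩ lit 0
  compileE (bin o e f) r = compileE e r ⨾ compileE f (suc r) ⨾
                           reg r ≔ reg r ⟨ o ⟩ reg (suc r)

  -- In a loop, register r holds the number of rounds, and register r + 1 the
  -- number of those still to come.
  compile : Cmd K → ℕ → Program
  compile (wr a e f)  r = compileE e r ⨾ compileE f (suc r) ⨾
                          reg r ≔ reg r ⟨ mul ⟩ lit K ⨾
                          reg r ≔ reg r ⟨ add ⟩ lit (toℕ a) ⨾
                          reg r ≔ reg r ⟨ add ⟩ reg 1 ⨾
                          ind r ≔ reg (suc r) ⟨ add ⟩ lit 0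
  compile (c ▸ d)     r = compile c r ⨾ compile d r
  compile (when e c)  r = compileE e r ⨾
                          ifnz reg r then compile c r else (reg r ≔ lit 0 ⟨ add ⟩ lit 0)
  compile (for x e c) r = compileE e r ⨾
                          reg (suc r) ≔ reg r ⟨ add ⟩ lit 0 ⨾
                          whilenz reg (suc r) repeat
                            (reg (2 + r) ≔ reg 1 ⟨ add ⟩ lit (toℕ x) ⨾
                             ind (2 + r) ≔ reg r ⟨ sub ⟩ reg (suc r) ⨾
                             compile c (2 + r) ⨾
                             reg (suc r) ≔ reg (suc r) ⟨ sub ⟩ lit 1)

-- Correctness and cost of the compiled code

≡ᵇ-refl : ∀ i → (i ≡ᵇ i) ≡ true
≡ᵇ-refl zero    = refl
≡ᵇ-refl (suc i) = ≡ᵇ-refl i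

≢⇒≡ᵇ-false : ∀ {i j} → i ≢ j → (i ≡ᵇ j) ≡ false
≢⇒≡ᵇ-false {zero}  {zero}  i≢j = ⊥-elim (i≢j refl)
≢⇒≡ᵇ-false {zero}  {suc j} i≢j = refl
≢⇒≡ᵇ-false {suc i} {zero}  i≢j = refl
≢⇒≡ᵇ-false {suc i} {suc j} i≢j = ≢⇒≡ᵇ-false (i≢j ∘ cong suc)

module _ (μ : Memory) {i : ℕ} (v : ℕ) where

  store-same : ∀ {j} → j ≡ i → (μ [ i ↦ v ]) j ≡ v
  store-same {j} j≡i rewrite dec-true (j ≟ i) j≡i = refl

  store-other : ∀ {j} → j ≢ i → (μ [ i ↦ v ]) j ≡ μ j
  store-other {j} j≢i rewrite dec-false (j ≟ i) j≢i = refl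

module Machine (K : ℕ) .{{_ : NonZero K}} (base V : ℕ) (0<base : 0 < base) (base≤V : base ≤ V) (8≤V : 8 ≤ V) where

  -- U bounds all numbers and addresses that occur, so that an instruction
  -- costs at most B.
  abstract
    U B : ℕ
    U = V * K + K + V
    B = 9 * bits U

    U≡ : U ≡ V * K + K + V
    U≡ = refl

    B≡ : B ≡ 9 * bits U
    B≡ = refl

  V≤U : V ≤ U
  V≤U = subst (V ≤_) (sym U≡) (m≤n+m V (V * K + K))

  base≤U : base ≤ U
  base≤U = ≤-trans base≤V V≤U

  K≤U : K ≤ U
  K≤U = subst (K ≤_) (sym U≡) (≤-trans (m≤n+m K (V * K)) (m≤m+n (V * K + K) V))

  addr : Fin K → ℕ → ℕ
  addr a i = i * K + toℕ a + base

  -- The columns are interleaved, so none of them needs a length fixed in advance. Column and index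
  -- come back as remainder and quotient modulo `K`.
  addr-injective : ∀ {a b i j} → addr a i ≡ addr b j → a ≡ b × i ≡ j
  addr-injective {a} {b} {i} {j} eq = toℕ-injective a≡b , i≡j
    where
    eq′ : i * K + toℕ a ≡ j * K + toℕ b
    eq′ = +-cancelʳ-≡ base _ _ eq
    mod : ∀ (c : Fin K) k → (k * K + toℕ c) % K ≡ toℕ c
    mod c k = trans (cong (_% K) (+-comm (k * K) (toℕ c)))
                (trans ([m+kn]%n≡m%n (toℕ c) k K) (m<n⇒m%n≡m (toℕ<n c)))
    a≡b : toℕ a ≡ toℕ b
    a≡b = trans (sym (mod a i)) (trans (cong (_% K) eq′) (mod b j))
    i≡j : i ≡ j
    i≡j = *-cancelʳ-≡ i j K
            (+-cancelʳ-≡ (toℕ b) _ _ (trans (cong (i * K +_) (sym a≡b)) eq′))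

  base≤addr : ∀ a i → base ≤ addr a i
  base≤addr a i = m≤n+m base (i * K + toℕ a)

  Bounded : State K → Set
  Bounded σ = ∀ a i → σ a i ≤ V

  upd-bounded : ∀ {σ a i v} → v ≤ V → Bounded σ → Bounded (upd σ a i v)
  upd-bounded {a = a} {i} v≤V σ≤V b j with toℕ a ≡ᵇ toℕ b | i ≡ᵇ j
  ... | true  | true  = v≤V
  ... | true  | false = σ≤V b j
  ... | false | _     = σ≤V b j

  record Cells (μ : Memory) (σ : State K) : Set where
    constructor mkCells
    field cell : ∀ a i → μ (addr a i) ≡ σ a i

  open Cells

  record Rep (μ : Memory) (σ : State K) : Set where
    constructor _,ᴿ_
    field
      baseReg : μ 1 ≡ base
      cells   : Cells μ σ

  open Rep

  store-cells : ∀ {μ σ} a i v {z} → z ≡ addr a i → Cells μ σ → Cells (μ [ z ↦ v ]) (upd σ a i v)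
  store-cells {μ} {σ} a i v refl (mkCells ρ) .cell b j with a Fin.≟ b | i ≟ j
  ... | yes refl | yes refl rewrite ≡ᵇ-refl (toℕ a) | ≡ᵇ-refl i = store-same μ v refl
  ... | yes refl | no q rewrite ≡ᵇ-refl (toℕ a) | ≢⇒≡ᵇ-false q =
    trans (store-other μ v (λ eq → q (sym (proj₂ (addr-injective {a} {a} {j} {i} eq))))) (ρ a j)
  ... | no p | _ rewrite ≢⇒≡ᵇ-false (p ∘ toℕ-injective) =
    trans (store-other μ v (λ eq → p (sym (proj₁ (addr-injective {b} {a} {j} {i} eq))))) (ρ b j)

  -- Here `w` counts instructions and tests. The bit lengths are charged once and for all through
  -- the factor `B`, so that programs can be analysed by counting steps.
  record Runs (P : Program) (μ : Memory) (w : ℕ) (Q : Memory → Set) : Set where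
    constructor ran
    field
      {final} : Memory
      {time}  : ℕ
      run     : ⟨ P , μ ⟩⇓⟨ final , time ⟩
      time≤   : time ≤ w * B
      holds   : Q final

  runs-seq : ∀ {P P′ μ w w′ Q Q′} → Runs P μ w Q → (∀ μ′ → Q μ′ → Runs P′ μ′ w′ Q′) →
             Runs (P ⨾ P′) μ (w + w′) Q′
  runs-seq {w = w} {w′} (ran p s≤ q) k with k _ q
  ... | ran p′ t≤ q′ =
    ran (seq p p′) (≤-trans (+-mono-≤ s≤ t≤) (≤-reflexive (sym (*-distribʳ-+ B w w′)))) q′

  runs-weaken : ∀ {P μ w w′ Q} → w ≤ w′ → Runs P μ w Q → Runs P μ w′ Q
  runs-weaken w≤ (ran p t≤ q) = ran p (≤-trans t≤ (*-monoˡ-≤ B w≤)) q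

  runs-map : ∀ {P μ w Q Q′} → (∀ {μ′} → Q μ′ → Q′ μ′) → Runs P μ w Q → Runs P μ w Q′
  runs-map f (ran p t≤ q) = ran p t≤ (f q)

  bits≤ : ∀ {k} → k ≤ U → bits k ≤ bits U
  bits≤ k≤U = s≤s (⌊log₂⌋-mono-≤ k≤U)

  Small : Memory → Operand → Set
  Small μ (lit k) = k ≤ U
  Small μ (reg i) = i ≤ U × μ i ≤ U
  Small μ (ind i) = i ≤ U × μ i ≤ U × μ (μ i) ≤ U

  SmallTarget : Memory → Target → Set
  SmallTarget μ (reg i) = i ≤ U
  SmallTarget μ (ind i) = i ≤ U × μ i ≤ U

  cost≤ : ∀ {μ} a → Small μ a → cost μ a ≤ 3 * bits U
  cost≤ (lit k) p           = ≤-trans (bits≤ p) (m≤m+n _ _)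
  cost≤ (reg i) (p , q)     = +-mono-≤ (bits≤ p) (≤-trans (bits≤ q) (m≤m+n _ _))
  cost≤ (ind i) (p , q , r) =
    ≤-trans (+-mono-≤ (+-mono-≤ (bits≤ p) (bits≤ q)) (bits≤ r))
      (≤-reflexive (lemma (bits U)))
    where
    lemma : ∀ x → x + x + x ≡ 3 * x
    lemma = solve-∀

  addressCost≤ : ∀ {μ} x → SmallTarget μ x → addressCost μ x ≤ 2 * bits U
  addressCost≤ (reg i) p       = ≤-trans (bits≤ p) (m≤m+n _ _)
  addressCost≤ (ind i) (p , q) = +-mono-≤ (bits≤ p) (≤-trans (bits≤ q) (m≤m+n _ _))

  runs-assign : ∀ {μ} x a o b {Q : Memory → Set} → Small μ a → Small μ b → SmallTarget μ x →
                apply o (value μ a) (value μ b) ≤ U →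
                Q (μ [ address μ x ↦ apply o (value μ a) (value μ b) ]) →
                Runs (x ≔ a ⟨ o ⟩ b) μ 1 Q
  runs-assign {μ} x a o b sa sb sx v≤U q =
    ran (assign x a o b)
    (≤-trans (+-mono-≤ (+-mono-≤ (+-mono-≤ (cost≤ a sa) (cost≤ b sb)) (addressCost≤ x sx)) (bits≤ v≤U))
      (≤-reflexive (trans (lemma (bits U)) (cong (1 *_) (sym B≡))))) q
    where
    lemma : ∀ x → 3 * x + 3 * x + 2 * x + x ≡ 1 * (9 * x)
    lemma = solve-∀

  test≤ : ∀ {μ} a → Small μ a → cost μ a ≤ 1 * B
  test≤ a p = ≤-trans (cost≤ a p) (≤-trans (*-monoˡ-≤ (bits U) (s≤s (s≤s (s≤s (z≤n {6})))))
                (≤-reflexive (trans (sym B≡) (sym (*-identityˡ B)))))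

  apply-sub≤ : ∀ {m} n → m ≤ V → m ∸ n ≤ V
  apply-sub≤ {m} n m≤V = ≤-trans (m∸n≤m m n) m≤V

  apply-div≤ : ∀ {m} n → m ≤ V → apply div m n ≤ V
  apply-div≤ {m} zero    m≤V = z≤n
  apply-div≤ {m} (suc n) m≤V = ≤-trans (m/n≤m m (suc n)) m≤V

  -- The values of all subexpressions stay below `V`. Cells do by `Bounded`, subtraction and
  -- division do not increase, and a literal is compared with 8 by computation; conditions remain
  -- only for sums and products.
  Fine : State K → Exp K → Set
  Fine σ (lit k)       = T (k ≤ᵇ 8)
  Fine σ (rd a e)      = Fine σ e
  Fine σ (bin add e f) = Fine σ e × Fine σ f × eval σ e + eval σ f ≤ V
  Fine σ (bin mul e f) = Fine σ e × Fine σ f × eval σ e * eval σ f ≤ V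
  Fine σ (bin sub e f) = Fine σ e × Fine σ f
  Fine σ (bin div e f) = Fine σ e × Fine σ f

  fine⇒≤ : ∀ {σ} → Bounded σ → ∀ e → Fine σ e → eval σ e ≤ V
  fine⇒≤ σ≤V (lit k)       p           = ≤-trans (≤ᵇ⇒≤ k 8 p) 8≤V
  fine⇒≤ σ≤V (rd a e)      p           = σ≤V a _
  fine⇒≤ σ≤V (bin add e f) (_ , _ , p) = p
  fine⇒≤ σ≤V (bin mul e f) (_ , _ , p) = p
  fine⇒≤ {σ} σ≤V (bin sub e f) (p , _)     = apply-sub≤ (eval σ f) (fine⇒≤ σ≤V e p)
  fine⇒≤ {σ} σ≤V (bin div e f) (p , _) = apply-div≤ (eval σ f) (fine⇒≤ σ≤V e p)

  fineˡ : ∀ {σ} o e f → Fine σ (bin o e f) → Fine σ e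
  fineˡ add e f p = proj₁ p
  fineˡ sub e f p = proj₁ p
  fineˡ mul e f p = proj₁ p
  fineˡ div e f p = proj₁ p

  fineʳ : ∀ {σ} o e f → Fine σ (bin o e f) → Fine σ f
  fineʳ add e f p = proj₁ (proj₂ p)
  fineʳ sub e f p = proj₂ p
  fineʳ mul e f p = proj₁ (proj₂ p)
  fineʳ div e f p = proj₂ p

  -- Below `r` lie the intermediate results and loop counters still in use, from `base` on the
  -- columns. Evaluating an expression may disturb only what lies between.
  Same : ℕ → Memory → Memory → Set
  Same r μ μ′ = ∀ j → j < r ⊎ base ≤ j → μ′ j ≡ μ j

  same-rep : ∀ {r μ μ′ σ} → 2 ≤ r → Same r μ μ′ → Rep μ σ → Rep μ′ σ
  same-rep 2≤r s (b ,ᴿ mkCells c) = trans (s 1 (inj₁ 2≤r)) b ,ᴿ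
    mkCells λ a i → trans (s (addr a i) (inj₂ (base≤addr a i))) (c a i)

  same-trans : ∀ {r r′ μ μ′ μ″} → r ≤ r′ → Same r μ μ′ → Same r′ μ′ μ″ → Same r μ μ″
  same-trans r≤r′ s s′ j (inj₁ p) = trans (s′ j (inj₁ (<-≤-trans p r≤r′))) (s j (inj₁ p))
  same-trans r≤r′ s s′ j (inj₂ p) = trans (s′ j (inj₂ p)) (s j (inj₂ p))

  store-same-outside : ∀ {r μ i v} → r ≤ i → i < base → Same r μ (μ [ i ↦ v ])
  store-same-outside {μ = μ} {v = v} r≤i i<b j (inj₁ p) = store-other μ v (<⇒≢ (<-≤-trans p r≤i))
  store-same-outside {μ = μ} {v = v} r≤i i<b j (inj₂ p) = store-other μ v (≢-sym (<⇒≢ (<-≤-trans i<b p)))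

  <base⇒≤U : ∀ {r} → r < base → r ≤ U
  <base⇒≤U p = ≤-trans (<⇒≤ p) base≤U

  1≤U : 1 ≤ U
  1≤U = ≤-trans (≤-trans 0<base base≤V) V≤U

  iK≤ : ∀ {i} → i ≤ V → i * K ≤ U
  iK≤ p = subst (_ ≤_) (sym U≡) (≤-trans (*-monoˡ-≤ K p) (≤-trans (m≤m+n (V * K) K) (m≤m+n (V * K + K) V)))

  iK+a≤ : ∀ {i} (a : Fin K) → i ≤ V → i * K + toℕ a ≤ U
  iK+a≤ a p = subst (_ ≤_) (sym U≡)
    (≤-trans (+-mono-≤ (*-monoˡ-≤ K p) (<⇒≤ (toℕ<n a))) (m≤m+n (V * K + K) V))

  addr≤ : ∀ {i} a → i ≤ V → addr a i ≤ U
  addr≤ a p = subst (_ ≤_) (sym U≡) (+-mono-≤ (+-mono-≤ (*-monoˡ-≤ K p) (<⇒≤ (toℕ<n a))) base≤V)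

  a≤U : ∀ (a : Fin K) → toℕ a ≤ U
  a≤U a = ≤-trans (<⇒≤ (toℕ<n a)) K≤U

  runs-address : ∀ {μ σ r i P w Q} a → Rep μ σ → 2 ≤ r → r < base → μ r ≡ i → i ≤ V →
                 (∀ μ′ → μ′ r ≡ addr a i → (∀ j → j ≢ r → μ′ j ≡ μ j) → Runs P μ′ w Q) →
                 Runs (reg r ≔ reg r ⟨ mul ⟩ lit K ⨾
                       reg r ≔ reg r ⟨ add ⟩ lit (toℕ a) ⨾
                       reg r ≔ reg r ⟨ add ⟩ reg 1 ⨾ P) μ (3 + w) Q
  runs-address {μ} {σ} {r} {i} a (μ1≡ ,ᴿ _) 2≤r r<b refl i≤V k =
    runs-seq (runs-assign (reg r) (reg r) mul (lit K) {Q = λ μ′ → μ′ r ≡ i * K × Keep μ′}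
               (r≤U , ≤-trans i≤V V≤U) K≤U r≤U (iK≤ i≤V)
               (store-same μ _ refl , λ j j≢ → store-other μ _ j≢))
    λ μ₁ (e₁ , k₁) →
    runs-seq (runs-assign (reg r) (reg r) add (lit (toℕ a)) {Q = λ μ′ → μ′ r ≡ i * K + toℕ a × Keep μ′}
               (r≤U , subst (_≤ U) (sym e₁) (iK≤ i≤V)) (a≤U a) r≤U
               (subst (λ x → x + toℕ a ≤ U) (sym e₁) (iK+a≤ a i≤V))
               (trans (store-same μ₁ _ refl) (cong (_+ toℕ a) e₁) ,
                λ j j≢ → trans (store-other μ₁ _ j≢) (k₁ j j≢)))
    λ μ₂ (e₂ , k₂) →
      let b₂ = trans (k₂ 1 1≢r) μ1≡ in
    runs-seq (runs-assign (reg r) (reg r) add (reg 1) {Q = λ μ′ → μ′ r ≡ addr a i × Keep μ′}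
               (r≤U , subst (_≤ U) (sym e₂) (iK+a≤ a i≤V)) (1≤U , subst (_≤ U) (sym b₂) base≤U) r≤U
               (subst₂ (λ x y → x + y ≤ U) (sym e₂) (sym b₂) (addr≤ a i≤V))
               (trans (store-same μ₂ _ refl) (cong₂ _+_ e₂ b₂) ,
                λ j j≢ → trans (store-other μ₂ _ j≢) (k₂ j j≢)))
    λ μ₃ (e₃ , k₃) → k μ₃ e₃ k₃
    where
    Keep : Memory → Set
    Keep μ′ = ∀ j → j ≢ r → μ′ j ≡ μ j
    r≤U = <base⇒≤U r<b
    1≢r : 1 ≢ r
    1≢r = <⇒≢ 2≤r

  runs-compileE : ∀ e {μ σ r} → Rep μ σ → Bounded σ → Fine σ e → 2 ≤ r → r + heightE e ≤ base →
                  Runs (compileE e r) μ (sizeE e) (λ μ′ → μ′ r ≡ eval σ e × Same r μ μ′)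
  runs-compileE (lit k) {μ} {σ} {r} ρ σ≤V p 2≤r h =
    runs-assign (reg r) (lit k) add (lit 0) k≤U z≤n (<base⇒≤U r<b)
      (subst (_≤ U) (sym (+-identityʳ k)) k≤U)
      (trans (store-same μ _ refl) (+-identityʳ k) , store-same-outside ≤-refl r<b)
    where
    r<b : r < base
    r<b = subst (_≤ base) (+-comm r 1) h
    k≤U : k ≤ U
    k≤U = ≤-trans (fine⇒≤ σ≤V (lit k) p) V≤U
  runs-compileE (rd a e) {μ} {σ} {r} ρ σ≤V p 2≤r h =
    runs-seq (runs-compileE e ρ σ≤V p 2≤r h) λ μ₁ (e₁ , s₁) →
    let ρ₁ = same-rep 2≤r s₁ ρ in
    runs-address a ρ₁ 2≤r r<b e₁ i≤V λ μ₂ e₂ k₂ →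
    let ee = trans (cong μ₂ e₂) (trans (k₂ _ (≢-sym (<⇒≢ (<-≤-trans r<b (base≤addr a (eval σ e))))))
                                       (ρ₁ .cells .cell a (eval σ e)))
        v≤U = ≤-trans (σ≤V a (eval σ e)) V≤U in
    runs-assign (reg r) (ind r) add (lit 0)
      (r≤U , subst (_≤ U) (sym e₂) (addr≤ a i≤V) , subst (_≤ U) (sym ee) v≤U)
      z≤n r≤U (subst (_≤ U) (sym (trans (+-identityʳ _) ee)) v≤U)
      (trans (store-same μ₂ _ refl) (trans (+-identityʳ _) ee) ,
       λ { j j∈ → trans (store-other μ₂ _ (j≢r j∈)) (trans (k₂ j (j≢r j∈)) (s₁ j j∈)) })
    where
    r<b : r < base
    r<b = <-≤-trans (lemma e) h
      where
      lemma : ∀ e → r < r + heightE e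
      lemma e = m<m+n r (0<h e)
        where
        0<h : ∀ e → 0 < heightE e
        0<h (lit k)     = s≤s z≤n
        0<h (rd a e)    = 0<h e
        0<h (bin o e f) = ≤-trans (0<h e) (m≤m⊔n _ _)
    r≤U = <base⇒≤U r<b
    i≤V = fine⇒≤ σ≤V e p
    j≢r : ∀ {j} → j < r ⊎ base ≤ j → j ≢ r
    j≢r (inj₁ q) = <⇒≢ q
    j≢r (inj₂ q) = ≢-sym (<⇒≢ (<-≤-trans r<b q))
  runs-compileE (bin o e f) {μ} {σ} {r} ρ σ≤V p 2≤r h =
    runs-seq (runs-compileE e ρ σ≤V (fineˡ o e f p) 2≤r he) λ μ₁ (e₁ , s₁) →
    runs-seq (runs-compileE f (same-rep 2≤r s₁ ρ) σ≤V (fineʳ o e f p) (m≤n⇒m≤1+n 2≤r) hf) λ μ₂ (e₂ , s₂) →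
    let e₁′ = trans (s₂ r (inj₁ ≤-refl)) e₁
        x≤ = ≤-trans (fine⇒≤ σ≤V e (fineˡ o e f p)) V≤U
        y≤ = ≤-trans (fine⇒≤ σ≤V f (fineʳ o e f p)) V≤U
        z≤ = ≤-trans (fine⇒≤ σ≤V (bin o e f) p) V≤U in
    runs-assign (reg r) (reg r) o (reg (suc r))
      (<base⇒≤U r<b , subst (_≤ U) (sym e₁′) x≤) (<base⇒≤U r+1<b , subst (_≤ U) (sym e₂) y≤) (<base⇒≤U r<b)
      (subst₂ (λ x y → apply o x y ≤ U) (sym e₁′) (sym e₂) z≤)
      (trans (store-same μ₂ _ refl) (cong₂ (apply o) e₁′ e₂) ,
       same-trans ≤-refl s₁ (same-trans ≤-refl (λ { j (inj₁ q) → s₂ j (inj₁ (m≤n⇒m≤1+n q)) ; j (inj₂ q) → s₂ j (inj₂ q) })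
         (store-same-outside ≤-refl r<b)))
    where
    he : r + heightE e ≤ base
    he = ≤-trans (+-monoʳ-≤ r (m≤m⊔n _ _)) h
    hf : suc r + heightE f ≤ base
    hf = ≤-trans (≤-reflexive (sym (+-suc r _))) (≤-trans (+-monoʳ-≤ r (m≤n⊔m (heightE e) _)) h)
    0<h : ∀ e → 0 < heightE e
    0<h (lit k)     = s≤s z≤n
    0<h (rd a e)    = 0<h e
    0<h (bin o e f) = ≤-trans (0<h e) (m≤m⊔n _ _)
    r+1<b : suc r < base
    r+1<b = <-≤-trans (m<m+n (suc r) (0<h f)) hf
    r<b : r < base
    r<b = <-trans (n<1+n r) r+1<b

  0<heightE : ∀ (e : Exp K) → 0 < heightE e
  0<heightE (lit k)     = s≤s z≤n
  0<heightE (rd a e)    = 0<heightE e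
  0<heightE (bin o e f) = ≤-trans (0<heightE e) (m≤m⊔n _ _)

  Low : ℕ → Memory → Memory → Set
  Low r μ μ′ = ∀ j → j < r → μ′ j ≡ μ j

  record Outcome (r : ℕ) (μ : Memory) (Q : State K → Set) (μ′ : Memory) : Set where
    constructor outcome
    field
      {result} : State K
      rep      : Rep μ′ result
      bounded  : Bounded result
      low      : Low r μ μ′
      post     : Q result

  record Triple (c : Cmd K) (σ : State K) (w : ℕ) (Q : State K → Set) : Set where
    constructor triple
    field
      exec : ∀ {r μ} → 2 ≤ r → r + height c ≤ base → Rep μ σ → Bounded σ →
             Runs (compile c r) μ w (Outcome r μ Q)

  open Triple

  outcome-trans : ∀ {r μ μ′ Q} → Low r μ μ′ → ∀ {μ″} → Outcome r μ′ Q μ″ → Outcome r μ Q μ″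
  outcome-trans l (outcome ρ b l′ q) = outcome ρ b (λ j j<r → trans (l′ j j<r) (l j j<r)) q

  t-wr : ∀ {a e f σ Q} → Fine σ e → Fine σ f → Q (upd σ a (eval σ e) (eval σ f)) →
         Triple (wr a e f) σ (sizeE e + (sizeE f + 4)) Q
  t-wr {a} {e} {f} {σ} {Q} pe pf q .exec {r} {μ} 2≤r h ρ σ≤V =
    runs-seq (runs-compileE e ρ σ≤V pe 2≤r he) λ μ₁ (e₁ , s₁) →
    runs-seq (runs-compileE f (same-rep 2≤r s₁ ρ) σ≤V pf (m≤n⇒m≤1+n 2≤r) hf) λ μ₂ (e₂ , s₂) →
    let s₁₂ = same-trans (≤-reflexive refl) s₁ (same-trans (n≤1+n r) (λ _ _ → refl) s₂)
        i≤V = fine⇒≤ σ≤V e pe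
        v≤V = fine⇒≤ σ≤V f pf
        e₁′ = trans (s₂ r (inj₁ ≤-refl)) e₁
        s₂′ = λ j j∈ → trans (s₂ j (weaken j∈)) (s₁ j j∈)
        ρ₂ = same-rep 2≤r s₂′ ρ in
    runs-address a ρ₂ 2≤r r<b e₁′ i≤V λ μ₃ e₃ k₃ →
    let v≡ = trans (k₃ (suc r) (≢-sym (<⇒≢ ≤-refl))) e₂
        v₀≡ = trans (+-identityʳ (μ₃ (suc r))) v≡
        ρ₃ = mkCells {μ₃} {σ} λ b j → trans (k₃ (addr b j) (≢-sym (<⇒≢ (<-≤-trans r<b (base≤addr b j))))) (ρ₂ .cells .cell b j)
        r≤U = <base⇒≤U r<b
        a≤ = subst (_≤ U) (sym e₃) (addr≤ a i≤V) in
    runs-assign (ind r) (reg (suc r)) add (lit 0)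
      (<base⇒≤U r+1<b , subst (_≤ U) (sym v≡) (≤-trans v≤V V≤U)) z≤n (r≤U , a≤)
      (subst (_≤ U) (sym v₀≡) (≤-trans v≤V V≤U))
      (subst (λ v → Outcome r μ Q (μ₃ [ μ₃ r ↦ v ])) (sym v₀≡)
        (outcome
          (trans (store-other μ₃ _ (λ 1≡ → <⇒≱ (<-trans 2≤r r<b)
                   (≤-trans (base≤addr a (eval σ e)) (≤-reflexive (sym (trans 1≡ e₃))))))
             (trans (k₃ 1 (<⇒≢ 2≤r)) (ρ₂ .baseReg)) ,ᴿ
           store-cells a (eval σ e) (eval σ f) e₃ ρ₃)
          (upd-bounded {σ} {a} {eval σ e} v≤V σ≤V)
          (λ j j<r → trans (store-other μ₃ _ (λ j≡ → <⇒≱ (<-trans j<r r<b)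
                       (≤-trans (base≤addr a (eval σ e)) (≤-reflexive (sym (trans j≡ e₃))))))
                       (trans (k₃ j (<⇒≢ j<r)) (s₂′ j (inj₁ j<r))))
          q))
    where
    weaken : ∀ {j} → j < r ⊎ base ≤ j → j < suc r ⊎ base ≤ j
    weaken (inj₁ p) = inj₁ (m≤n⇒m≤1+n p)
    weaken (inj₂ p) = inj₂ p
    he : r + heightE e ≤ base
    he = ≤-trans (+-monoʳ-≤ r (m≤m⊔n _ _)) h
    hf : suc r + heightE f ≤ base
    hf = ≤-trans (≤-reflexive (sym (+-suc r _))) (≤-trans (+-monoʳ-≤ r (m≤n⊔m (heightE e) _)) h)
    r+1<b : suc r < base
    r+1<b = <-≤-trans (m<m+n (suc r) (0<heightE f)) hf
    r<b : r < base
    r<b = <-trans (n<1+n r) r+1<b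

  t-map : ∀ {c σ w Q Q′} → (∀ {σ′} → Q σ′ → Q′ σ′) → Triple c σ w Q → Triple c σ w Q′
  t-map f t .exec 2≤r h ρ σ≤V =
    runs-map (λ { (outcome ρ b l q) → outcome ρ b l (f q) }) (t .exec 2≤r h ρ σ≤V)

  t-weaken : ∀ {c σ w w′ Q} → w ≤ w′ → Triple c σ w Q → Triple c σ w′ Q
  t-weaken w≤ t .exec 2≤r h ρ σ≤V = runs-weaken w≤ (t .exec 2≤r h ρ σ≤V)

  -- The postcondition of the first command is the triple of the second, so correctness proofs nest
  -- as the programs do and no intermediate assertion has to be named.
  t-seq : ∀ {c d σ w w′ Q} → Triple c σ w (λ σ′ → Triple d σ′ w′ Q) → Triple (c ▸ d) σ (w + w′) Q
  t-seq {c} {d} t .exec {r} {μ} 2≤r h ρ σ≤V =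
    runs-seq (t .exec 2≤r (≤-trans (+-monoʳ-≤ r (m≤m⊔n _ _)) h) ρ σ≤V) λ { μ′ (outcome ρ b l t′) →
      runs-map (outcome-trans l) (t′ .exec 2≤r (≤-trans (+-monoʳ-≤ r (m≤n⊔m (height c) _)) h) ρ b) }

  runs-then : ∀ {a P P′ μ w Q} → cost μ a ≤ 1 * B → value μ a ≢ 0 → Runs P μ w Q →
              Runs (ifnz a then P else P′) μ (w + 2) Q
  runs-then {w = w} c≤B a≢0 (ran p t≤ q) = ran (then′ a≢0 p)
    (≤-trans (+-mono-≤ c≤B t≤) (≤-trans (≤-reflexive (sym (*-distribʳ-+ B 1 w)))
      (*-monoˡ-≤ B (≤-trans (≤-reflexive (+-comm 1 w)) (+-monoʳ-≤ w (s≤s z≤n)))))) q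

  runs-else : ∀ {a P P′ μ Q} w → cost μ a ≤ 1 * B → value μ a ≡ 0 → Runs P′ μ 1 Q →
              Runs (ifnz a then P else P′) μ (w + 2) Q
  runs-else w c≤B a≡0 (ran p t≤ q) = ran (else′ a≡0 p)
    (≤-trans (+-mono-≤ c≤B t≤) (≤-trans (≤-reflexive (sym (*-distribʳ-+ B 1 1)))
      (*-monoˡ-≤ B (m≤n+m 2 w)))) q

  -- The 4 in the cost of a round is one test and three instructions of the loop itself: two that
  -- store the index and one that decrements the counter.
  runs-loop : ∀ {a P μ w w′ Q Q′} → cost μ a ≤ 1 * B → value μ a ≢ 0 → Runs P μ (w + 3) Q →
              (∀ {μ′} → Q μ′ → Runs (whilenz a repeat P) μ′ (1 + w′) Q′) →
              Runs (whilenz a repeat P) μ (1 + (w + 4 + w′)) Q′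
  runs-loop {w = w} {w′} c≤B a≢0 (ran p s≤ q) k with k q
  ... | ran p′ t≤ q′ = ran (loop a≢0 p p′)
    (≤-trans (+-mono-≤ (+-mono-≤ c≤B s≤) t≤) (≤-reflexive (lemma B w w′))) q′
    where
    lemma : ∀ B w z → 1 * B + (w + 3) * B + (1 + z) * B ≡ (1 + (w + 4 + z)) * B
    lemma = solve-∀

  t-when : ∀ {e c σ w Q} → Fine σ e → (eval σ e ≢ 0 → Triple c σ w Q) → (eval σ e ≡ 0 → Q σ) →
           Triple (when e c) σ (sizeE e + (w + 2)) Q
  t-when {e} {c} {σ} {w} {Q} pe t q .exec {r} {μ} 2≤r h ρ σ≤V =
    runs-seq (runs-compileE e ρ σ≤V pe 2≤r (≤-trans (+-monoʳ-≤ r (m≤m⊔n _ _)) h)) λ μ₁ (e₁ , s₁) →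
    let ρ₁ = same-rep 2≤r s₁ ρ
        c≤B = test≤ {μ₁} (reg r) (<base⇒≤U r<b , subst (_≤ U) (sym e₁) (≤-trans (fine⇒≤ σ≤V e pe) V≤U))
        l₁ = λ j j<r → s₁ j (inj₁ j<r) in
    branch μ₁ e₁ ρ₁ c≤B l₁ (eval σ e ≟ 0)
    where
    r<b : r < base
    r<b = <-≤-trans (m<m+n r (0<heightE e)) (≤-trans (+-monoʳ-≤ r (m≤m⊔n _ _)) h)
    branch : ∀ μ₁ → μ₁ r ≡ eval σ e → Rep μ₁ σ → cost μ₁ (reg r) ≤ 1 * B → Low r μ μ₁ → Dec (eval σ e ≡ 0) →
             Runs (ifnz reg r then compile c r else (reg r ≔ lit 0 ⟨ add ⟩ lit 0)) μ₁ (w + 2) (Outcome r μ Q)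
    branch μ₁ e₁ ρ₁ c≤B l₁ (no e≢0) =
      runs-then c≤B (λ eq → e≢0 (trans (sym e₁) eq))
        (runs-map (outcome-trans l₁)
          (t e≢0 .exec 2≤r (≤-trans (+-monoʳ-≤ r (m≤n⊔m (heightE e) _)) h) ρ₁ σ≤V))
    branch μ₁ e₁ ρ₁ c≤B l₁ (yes e≡0) =
      runs-else w c≤B (trans e₁ e≡0)
        (runs-assign {μ₁} (reg r) (lit 0) add (lit 0) z≤n z≤n (<base⇒≤U r<b) z≤n
          (let s = store-same-outside {r} {μ₁} {r} {0} ≤-refl r<b in
           outcome (same-rep 2≤r s ρ₁) σ≤V (λ j j<r → trans (s j (inj₁ j<r)) (l₁ j j<r)) (q e≡0)))

  t-for : ∀ {x e c σ w N} → eval σ e ≡ N → Fine σ e → (I : ℕ → State K → Set) → I 0 σ →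
          (∀ {k σ′} → k < N → I k σ′ → Triple c (upd σ′ x 0 k) w (I (suc k))) →
          Triple (for x e c) σ (sizeE e + (2 + N * (w + 4))) (I N)
  t-for {x} {e} {c} {σ} {w} {N} refl pe I i₀ step .exec {r} {μ} 2≤r h ρ σ≤V =
    runs-seq (runs-compileE e ρ σ≤V pe 2≤r (≤-trans (+-monoʳ-≤ r (m≤m⊔n _ _)) h)) λ μ₁ (e₁ , s₁) →
    let e₁′ = trans (+-identityʳ (μ₁ r)) e₁ in
    runs-seq (runs-assign {μ₁} (reg (suc r)) (reg r) add (lit 0)
                {Q = λ μ′ → μ′ r ≡ N × μ′ (suc r) ≡ N × Same r μ μ′}
                (<base⇒≤U r<b , subst (_≤ U) (sym e₁) N≤U) z≤n (<base⇒≤U r+1<b)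
                (subst (_≤ U) (sym e₁′) N≤U)
                (trans (store-other μ₁ _ (<⇒≢ ≤-refl)) e₁ ,
                 trans (store-same μ₁ _ refl) e₁′ ,
                 same-trans (n≤1+n r) s₁ (store-same-outside ≤-refl r+1<b)))
    λ μ₂ (a , b , s₂) → while N 0 refl a b (same-rep 2≤r s₂ ρ) σ≤V (λ j p → s₂ j (inj₁ p)) i₀
    where
    N≤V = fine⇒≤ σ≤V e pe
    N≤U = ≤-trans N≤V V≤U
    hc : suc (suc r) + suc (height c) ≤ base
    hc = ≤-trans (≤-reflexive (trans (cong suc (+-suc (suc r) (height c))) (trans (cong (3 +_) (+-comm r (height c)))
           (+-comm (3 + height c) r))))
           (≤-trans (+-monoʳ-≤ r (m≤n⊔m (heightE e) _)) h)
    r+2<b : 2 + r < base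
    r+2<b = ≤-trans (s≤s (s≤s (≤-trans (≤-reflexive (+-comm 1 r)) (+-monoʳ-≤ r (s≤s z≤n))))) hc
    r+1<b : suc r < base
    r+1<b = <-trans (n<1+n _) r+2<b
    r<b : r < base
    r<b = <-trans (n<1+n r) r+1<b

    body : Program
    body = reg (2 + r) ≔ reg 1 ⟨ add ⟩ lit (toℕ x) ⨾
           ind (2 + r) ≔ reg r ⟨ sub ⟩ reg (suc r) ⨾
           compile c (2 + r) ⨾
           reg (suc r) ≔ reg (suc r) ⟨ sub ⟩ lit 1

    round : ∀ {m k μ′ σ′} → k + suc m ≡ N → μ′ r ≡ N → μ′ (suc r) ≡ suc m → Rep μ′ σ′ → Bounded σ′ →
            Low r μ μ′ → I k σ′ →
            Runs body μ′ (w + 3) (λ μ″ → μ″ r ≡ N × μ″ (suc r) ≡ m × Outcome r μ (I (suc k)) μ″)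
    round {m} {k} {μ′} {σ′} k+m≡N a b ρ@(μ1≡ ,ᴿ ρ′) σ′≤V l i =
      runs-weaken (≤-reflexive (+-comm 3 w)) (runs-weaken (≤-reflexive (cong (λ z → suc (suc z)) (+-comm w 1)))
      (runs-seq (runs-assign {μ′} (reg (2 + r)) (reg 1) add (lit (toℕ x))
                  {Q = λ μ₁ → μ₁ (2 + r) ≡ addr x 0 × Same (2 + r) μ′ μ₁}
                  (1≤U , subst (_≤ U) (sym μ1≡) base≤U) (a≤U x) (<base⇒≤U r+2<b)
                  (subst (_≤ U) (sym x≡) (addr≤ x z≤n))
                  (trans (store-same μ′ _ refl) x≡ , store-same-outside ≤-refl r+2<b))
      λ μ₁ (e₁ , s₁) →
      let a₁ = trans (s₁ r (inj₁ (s≤s (n≤1+n r)))) a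
          b₁ = trans (s₁ (suc r) (inj₁ ≤-refl)) b
          v≡ = trans (cong₂ _∸_ a₁ b₁) (trans (cong (_∸ suc m) (sym k+m≡N)) (m+n∸n≡m k (suc m)))
          k≤V = <⇒≤ (<-≤-trans k<N N≤V)
          ρ₁ = same-rep (≤-trans 2≤r (≤-trans (n≤1+n r) (n≤1+n (suc r)))) s₁ ρ
          far = λ {j} (j<b : j < base) → store-other μ₁ {μ₁ (2 + r)} (μ₁ r ∸ μ₁ (suc r)) {j}
                  (λ eq → <⇒≱ j<b (≤-trans (base≤addr x 0) (≤-reflexive (sym (trans eq e₁))))) in
      runs-seq (runs-assign {μ₁} (ind (2 + r)) (reg r) sub (reg (suc r))
                  {Q = λ μ₂ → Rep μ₂ (upd σ′ x 0 k) × (∀ j → j < 2 + r → μ₂ j ≡ μ′ j)}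
                  (<base⇒≤U r<b , subst (_≤ U) (sym a₁) N≤U)
                  (<base⇒≤U r+1<b , subst (_≤ U) (sym b₁) (≤-trans (≤-trans (m≤n+m (suc m) k) (≤-reflexive k+m≡N)) N≤U))
                  (<base⇒≤U r+2<b , subst (_≤ U) (sym e₁) (addr≤ x z≤n))
                  (subst (_≤ U) (sym v≡) (≤-trans k≤V V≤U))
                  ((trans (far (≤-trans (≤-trans 2≤r (≤-trans (n≤1+n r) (n≤1+n (suc r)))) (<⇒≤ r+2<b))) (ρ₁ .baseReg) ,ᴿ
                    subst (λ v → Cells (μ₁ [ μ₁ (2 + r) ↦ v ]) (upd σ′ x 0 k)) (sym v≡)
                      (store-cells x 0 k e₁ (ρ₁ .cells))) ,
                   λ j j< → trans (far (<-trans j< r+2<b)) (s₁ j (inj₁ j<))))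
      λ μ₂ (ρ₂ , l₂) →
      runs-seq (step k<N i .exec (≤-trans 2≤r (≤-trans (n≤1+n r) (n≤1+n (suc r))))
                  (≤-trans (+-monoʳ-≤ (2 + r) (n≤1+n _)) hc)
                  ρ₂ (upd-bounded {σ′} {x} {0} k≤V σ′≤V))
      λ { μ₃ (outcome ρ₃ σ₃≤V l₃ i₃) →
      let l₃′ = λ j j< → trans (l₃ j j<) (l₂ j j<)
          b₃ = trans (l₃′ (suc r) ≤-refl) b
          m≤ = ≤-trans (≤-trans (m≤n+m (suc m) k) (≤-reflexive k+m≡N)) N≤U
          s₃ = store-same-outside {suc r} {μ₃} {suc r} {μ₃ (suc r) ∸ 1} ≤-refl r+1<b in
      runs-assign (reg (suc r)) (reg (suc r)) sub (lit 1)
        (<base⇒≤U r+1<b , subst (_≤ U) (sym b₃) m≤) 1≤U (<base⇒≤U r+1<b)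
        (≤-trans (m∸n≤m _ 1) (subst (_≤ U) (sym b₃) m≤))
        (trans (s₃ r (inj₁ ≤-refl)) (trans (l₃′ r (s≤s (n≤1+n r))) a) ,
         trans (store-same μ₃ _ refl) (cong (_∸ 1) b₃) ,
         outcome (same-rep (m≤n⇒m≤1+n 2≤r) s₃ ρ₃) σ₃≤V
           (λ j j<r → trans (s₃ j (inj₁ (m≤n⇒m≤1+n j<r)))
              (trans (l₃′ j (m≤n⇒m≤1+n (m≤n⇒m≤1+n j<r))) (l j j<r))) i₃) }))
      where
      k<N : k < N
      k<N = ≤-trans (m<m+n k (s≤s (z≤n {m}))) (≤-reflexive k+m≡N)
      x≡ : μ′ 1 + toℕ x ≡ addr x 0
      x≡ = trans (cong (_+ toℕ x) μ1≡) (+-comm base (toℕ x))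

    while : ∀ m k {μ′ σ′} → k + m ≡ N → μ′ r ≡ N → μ′ (suc r) ≡ m → Rep μ′ σ′ → Bounded σ′ →
            Low r μ μ′ → I k σ′ →
            Runs (whilenz reg (suc r) repeat body) μ′ (1 + m * (w + 4)) (Outcome r μ (I N))
    while zero k {μ′} k≡N a b ρ σ′≤V l i =
      ran (stop b) (test≤ {μ′} (reg (suc r)) (<base⇒≤U r+1<b , subst (_≤ U) (sym b) z≤n))
        (outcome ρ σ′≤V l (subst (λ j → I j _) (trans (sym (+-identityʳ k)) k≡N) i))
    while (suc m) k {μ′} k+m≡N a b ρ σ′≤V l i =
      runs-loop (test≤ {μ′} (reg (suc r)) (<base⇒≤U r+1<b , subst (_≤ U) (sym b) m≤U))
        (λ eq → 1+n≢0 (trans (sym b) eq)) (round k+m≡N a b ρ σ′≤V l i)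
        λ { (a′ , b′ , outcome ρ′ σ″≤V l′ i′) →
            while m (suc k) (trans (sym (+-suc k m)) k+m≡N) a′ b′ ρ′ σ″≤V l′ i′ }
      where
      m≤U : suc m ≤ U
      m≤U = ≤-trans (≤-trans (m≤n+m (suc m) k) (≤-reflexive k+m≡N)) N≤U

  t-forFin : ∀ {x e c σ w N} → eval σ e ≡ N → Fine σ e → (I : ℕ → State K → Set) → I 0 σ →
             (∀ {v : Fin N} {σ′} → I (toℕ v) σ′ → Triple c (upd σ′ x 0 (toℕ v)) w (I (suc (toℕ v)))) →
             Triple (for x e c) σ (sizeE e + (2 + N * (w + 4))) (I N)
  t-forFin {x} {e} {c} {σ} {w} {N} eq fine I i₀ step = t-for eq fine I i₀ λ k<N i →
    subst (λ k → I k _ → Triple c (upd _ x 0 k) w (I (suc k))) (toℕ-fromℕ< k<N) step i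

-- Moving the input out of the way of the registers

-- Straight-line code, because a loop would need a source pointer and a counter while the low
-- registers still hold input. Once these cells are copied, their registers serve as pointers and
-- counter in `highCopy`.
lowCopy : (K k j : ℕ) → Program → Program
lowCopy K zero    j P = P
lowCopy K (suc k) j P = ind 1 ≔ reg j ⟨ add ⟩ lit 0 ⨾ reg 1 ≔ reg 1 ⟨ add ⟩ lit K ⨾ lowCopy K k (suc j) P

highCopy : ℕ → Program
highCopy K = whilenz reg 3 repeat
  (ind 4 ≔ ind 2 ⟨ add ⟩ lit 0 ⨾
   reg 4 ≔ reg 4 ⟨ add ⟩ lit K ⨾
   reg 2 ≔ reg 2 ⟨ add ⟩ lit 1 ⨾
   reg 3 ≔ reg 3 ⟨ sub ⟩ lit 1)

-- At first only registers 0 and 1 can be used: the latter held the adjacency of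
-- the first vertex to itself, which is known to be 0.
boot : (K R : ℕ) → Program
boot K R =
  reg 1 ≔ reg 0 ⟨ mul ⟩ reg 0 ⨾
  reg 1 ≔ reg 1 ⟨ add ⟩ lit (5 + R) ⨾
  ind 1 ≔ reg 0 ⟨ add ⟩ lit 0 ⨾
  -- Cell 1 of the column is skipped: the input has a 0 there, and so has the fresh column.
  reg 1 ≔ reg 1 ⟨ add ⟩ lit (2 * K) ⨾
  lowCopy K (3 + R) 2
  (reg 4 ≔ reg 1 ⟨ add ⟩ lit 0 ⨾
   reg 1 ≔ reg 1 ⟨ sub ⟩ lit ((5 + R) * K) ⨾
   -- Register 1 holds `n * n + (5 + R)`. This recovers `n * n`; adding 1 gives the length of the
   -- input, and the `5 + R` cells dealt with are taken off. For a short input truncation leaves 0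
   -- cells to copy.
   reg 3 ≔ reg 1 ⟨ sub ⟩ lit (5 + R) ⨾
   reg 3 ≔ reg 3 ⟨ add ⟩ lit 1 ⨾
   reg 3 ≔ reg 3 ⟨ sub ⟩ lit (5 + R) ⨾
   reg 2 ≔ lit (5 + R) ⟨ add ⟩ lit 0 ⨾
   highCopy K)

bootWork : ℕ → ℕ → ℕ
bootWork R n = 4 + ((3 + R) * 2 + (6 + (1 + (suc (n * n) ∸ (5 + R)) * 5)))

module Boot (K : ℕ) .{{_ : NonZero K}} (R n V : ℕ) (base≤V : n * n + (5 + R) ≤ V) (8≤V : 8 ≤ V)
            (a₀ : Fin K) (a₀≡0 : toℕ a₀ ≡ 0)
            (input : Memory) (input0 : input 0 ≡ n) (input1 : input 1 ≡ 0)
            (input≤V : ∀ i → input i ≤ V) (input-end : ∀ i → n * n < i → input i ≡ 0) where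

  base : ℕ
  base = n * n + (5 + R)

  R′≤base : 5 + R ≤ base
  R′≤base = m≤n+m (5 + R) (n * n)

  5≤base : 5 ≤ base
  5≤base = ≤-trans (m≤m+n 5 R) R′≤base

  0<base : 0 < base
  0<base = ≤-trans (s≤s z≤n) 5≤base

  open Machine K base V 0<base base≤V 8≤V

  copied : ℕ → State K
  copied zero    = λ _ _ → 0
  copied (suc j) = upd (copied j) a₀ j (input j)

  copied-bounded : ∀ j → Bounded (copied j)
  copied-bounded zero    a i = z≤n
  copied-bounded (suc j) = upd-bounded {copied j} {a₀} {j} (input≤V j) (copied-bounded j)

  copied-other : ∀ j a i → toℕ a ≢ 0 → copied j a i ≡ 0
  copied-other zero    a i a≢0 = refl
  copied-other (suc j) a i a≢0 rewrite ≢⇒≡ᵇ-false {toℕ a₀} {toℕ a} (λ eq → a≢0 (trans (sym eq) a₀≡0)) = copied-other j a i a≢0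

  copied-beyond : ∀ j i → j ≤ i → copied j a₀ i ≡ 0
  copied-beyond zero    i j≤i = refl
  copied-beyond (suc j) i j<i rewrite ≡ᵇ-refl (toℕ a₀) | ≢⇒≡ᵇ-false (<⇒≢ j<i) = copied-beyond j i (<⇒≤ j<i)

  copied-below : ∀ j i → i < j → copied j a₀ i ≡ input i
  copied-below (suc j) i i<1+j with j ≟ i
  ... | yes refl rewrite ≡ᵇ-refl (toℕ a₀) | ≡ᵇ-refl j = refl
  ... | no j≢i rewrite ≡ᵇ-refl (toℕ a₀) | ≢⇒≡ᵇ-false j≢i =
    copied-below j i (≤∧≢⇒< (≤-pred i<1+j) (≢-sym j≢i))

  -- From `j` on both sides are 0: the column is fresh and the input ends at cell `n * n`. A copy
  -- that runs past the end of a short input is therefore equally good.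
  copied-all : ∀ {j} → n * n < j → ∀ i → copied j a₀ i ≡ input i
  copied-all {j} n²<j i with i <? j
  ... | yes i<j = copied-below j i i<j
  ... | no i≮j  = trans (copied-beyond j i (≮⇒≥ i≮j)) (sym (input-end i (<-≤-trans n²<j (≮⇒≥ i≮j))))

  record Low-inv (j : ℕ) (μ : Memory) : Set where
    constructor low-inv
    field
      at1    : μ 1 ≡ addr a₀ j
      source : ∀ z → 2 ≤ z → z < base → μ z ≡ input z
      copies : Cells μ (copied j)

  record High-inv (from to m done : ℕ) (μ : Memory) : Set where
    constructor high-inv
    field
      at1    : μ 1 ≡ base
      at2    : μ 2 ≡ from
      at3    : μ 3 ≡ m
      at4    : μ 4 ≡ addr a₀ to
      source : ∀ z → 5 ≤ z → z < base → μ z ≡ input z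
      copies : Cells μ (copied done)

  Booted : Memory → Set
  Booted μ = Σ[ j ∈ ℕ ] n * n < j × Rep μ (copied j)

  <base⇒≢addr : ∀ {z a i} → z < base → z ≢ addr a i
  <base⇒≢addr {a = a} {i} z<b z≡ = <⇒≱ z<b (≤-trans (base≤addr a i) (≤-reflexive (sym z≡)))

  store-cells-outside : ∀ {μ σ i v} → i < base → Cells μ σ → Cells (μ [ i ↦ v ]) σ
  store-cells-outside {μ} {σ} {i} {v} i<b (mkCells c) = mkCells λ a j →
    trans (store-other μ v (≢-sym (<base⇒≢addr {a = a} {j} i<b))) (c a j)

  addr-suc : ∀ j → addr a₀ j + K ≡ addr a₀ (suc j)
  addr-suc j = lemma (j * K) (toℕ a₀) base K
    where
    lemma : ∀ x a b k → x + a + b + k ≡ k + x + a + b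
    lemma = solve-∀

  j≤base⇒j≤V : ∀ {j} → j ≤ base → j ≤ V
  j≤base⇒j≤V p = ≤-trans p base≤V

  1<base : 1 < base
  1<base = ≤-trans (s≤s (s≤s z≤n)) 5≤base
  2<base : 2 < base
  2<base = ≤-trans (s≤s (s≤s (s≤s z≤n))) 5≤base
  3<base : 3 < base
  3<base = ≤-trans (s≤s (s≤s (s≤s (s≤s z≤n)))) 5≤base

  runs-lowCopy : ∀ k {j P w Q} → 2 ≤ j → j + k ≡ 5 + R → ∀ {μ} → Low-inv j μ →
                 (∀ μ′ → Low-inv (5 + R) μ′ → Runs P μ′ w Q) → Runs (lowCopy K k j P) μ (k * 2 + w) Q
  runs-lowCopy zero {j} 2≤j eq {μ} inv k = k μ (subst (λ i → Low-inv i μ) (trans (sym (+-identityʳ j)) eq) inv)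
  runs-lowCopy (suc m) {j} 2≤j eq {μ} (low-inv e₁ src cs) k =
    runs-seq (runs-assign {μ} (ind 1) (reg j) add (lit 0)
      {Q = λ μ′ → μ′ 1 ≡ addr a₀ j × (∀ z → 2 ≤ z → z < base → μ′ z ≡ input z) × Cells μ′ (copied (suc j))}
      (<base⇒≤U j<b , subst (_≤ U) (sym v≡) v≤U) z≤n (1≤U , subst (_≤ U) (sym e₁) (addr≤ a₀ j≤V))
      (subst (_≤ U) (sym v₀≡) v≤U)
      (trans (store-other μ _ (λ 1≡ → <base⇒≢addr {a = a₀} {j} 1<base (trans 1≡ e₁))) e₁ ,
       (λ z 2≤z z<b → trans (store-other μ _ (λ z≡ → <base⇒≢addr {a = a₀} {j} z<b (trans z≡ e₁))) (src z 2≤z z<b)) ,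
       subst (λ v → Cells (μ [ μ 1 ↦ v ]) (copied (suc j))) (sym v₀≡) (store-cells a₀ j (input j) e₁ cs)))
    λ μ₁ (e₁′ , src′ , cs′) →
    runs-seq (runs-assign {μ₁} (reg 1) (reg 1) add (lit K) {Q = Low-inv (suc j)}
      (1≤U , subst (_≤ U) (sym e₁′) (addr≤ a₀ j≤V)) K≤U 1≤U
      (subst (_≤ U) (sym (trans (cong (_+ K) e₁′) (addr-suc j))) (addr≤ a₀ (j≤base⇒j≤V j<b)))
      (low-inv (trans (store-same μ₁ {1} _ refl) (trans (cong (_+ K) e₁′) (addr-suc j)))
        (λ z 2≤z z<b → trans (store-other μ₁ _ (≢-sym (<⇒≢ 2≤z))) (src′ z 2≤z z<b))
        (store-cells-outside 1<base cs′)))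
    λ μ₂ inv → runs-lowCopy m (m≤n⇒m≤1+n 2≤j) (trans (sym (+-suc j m)) eq) inv k
    where
    j<b : j < base
    j<b = <-≤-trans (<-≤-trans (m<m+n j (s≤s (z≤n {m}))) (≤-reflexive eq)) R′≤base
    j≤V : j ≤ V
    j≤V = j≤base⇒j≤V (<⇒≤ j<b)
    v≡ : μ j ≡ input j
    v≡ = src j 2≤j j<b
    v₀≡ : μ j + 0 ≡ input j
    v₀≡ = trans (+-identityʳ (μ j)) v≡
    v≤U : input j ≤ U
    v≤U = ≤-trans (input≤V j) V≤U

  runs-highCopy : ∀ m {j} → 5 ≤ j → j + m ≤ base → n * n < j + m → ∀ {μ} → High-inv j j m j μ →
                  Runs (highCopy K) μ (1 + m * 5) Booted
  runs-highCopy zero {j} 5≤j j≤ n²< {μ} (high-inv e₁ e₂ e₃ e₄ src cs) =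
    ran (stop e₃) (test≤ {μ} (reg 3) (<base⇒≤U 3<base , subst (_≤ U) (sym e₃) z≤n))
      (j , <-≤-trans n²< (≤-reflexive (+-identityʳ j)) , (e₁ ,ᴿ cs))
  runs-highCopy (suc m) {j} 5≤j j≤ n²< {μ} (high-inv e₁ e₂ e₃ e₄ src cs) =
    runs-loop {w = 1} (test≤ {μ} (reg 3) (<base⇒≤U 3<base , subst (_≤ U) (sym e₃) m≤U))
      (λ eq → 1+n≢0 (trans (sym e₃) eq))
      (runs-seq (runs-assign {μ} (ind 4) (ind 2) add (lit 0) {Q = High-inv j j (suc m) (suc j)}
        (<base⇒≤U 2<base , subst (_≤ U) (sym e₂) (<base⇒≤U j<b) , subst (_≤ U) (sym v≡) v≤U) z≤n
        (<base⇒≤U 5≤base , subst (_≤ U) (sym e₄) (addr≤ a₀ j≤V))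
        (subst (_≤ U) (sym v₀≡) v≤U)
        (high-inv (trans (far 1<base) e₁) (trans (far 2<base) e₂) (trans (far 3<base) e₃) (trans (far 5≤base) e₄)
          (λ z 5≤z z<b → trans (far z<b) (src z 5≤z z<b))
          (subst (λ v → Cells (μ [ μ 4 ↦ v ]) (copied (suc j))) (sym v₀≡) (store-cells a₀ j (input j) e₄ cs)) ))
      λ { μ₁ (high-inv e₁ e₂ e₃ e₄ src cs) →
      runs-seq (runs-assign {μ₁} (reg 4) (reg 4) add (lit K) {Q = High-inv j (suc j) (suc m) (suc j)}
        (<base⇒≤U 5≤base , subst (_≤ U) (sym e₄) (addr≤ a₀ j≤V)) K≤U (<base⇒≤U 5≤base)
        (subst (_≤ U) (sym (trans (cong (_+ K) e₄) (addr-suc j))) (addr≤ a₀ (j≤base⇒j≤V j<b)))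
        (high-inv e₁ e₂ e₃ (trans (cong (_+ K) e₄) (addr-suc j))
          (λ z 5≤z z<b → trans (store-other μ₁ _ (≢-sym (<⇒≢ 5≤z))) (src z 5≤z z<b))
          (store-cells-outside 5≤base cs)))
      λ { μ₂ (high-inv e₁ e₂ e₃ e₄ src cs) →
      runs-seq (runs-assign {μ₂} (reg 2) (reg 2) add (lit 1) {Q = High-inv (suc j) (suc j) (suc m) (suc j)}
        (<base⇒≤U 2<base , subst (_≤ U) (sym e₂) (<base⇒≤U j<b)) 1≤U (<base⇒≤U 2<base)
        (subst (_≤ U) (sym (trans (cong (_+ 1) e₂) (+-comm j 1))) (≤-trans j<b base≤U))
        (high-inv e₁ (trans (cong (_+ 1) e₂) (+-comm j 1)) e₃ e₄
          (λ z 5≤z z<b → trans (store-other μ₂ _ (≢-sym (<⇒≢ (<-trans (s≤s (s≤s (s≤s z≤n))) 5≤z)))) (src z 5≤z z<b))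
          (store-cells-outside 2<base cs)))
      λ { μ₃ (high-inv e₁ e₂ e₃ e₄ src cs) →
      runs-assign {μ₃} (reg 3) (reg 3) sub (lit 1)
        (<base⇒≤U 3<base , subst (_≤ U) (sym e₃) m≤U) 1≤U (<base⇒≤U 3<base)
        (≤-trans (m∸n≤m _ 1) (subst (_≤ U) (sym e₃) m≤U))
        (high-inv e₁ e₂ (cong (_∸ 1) e₃) e₄
          (λ z 5≤z z<b → trans (store-other μ₃ _ (≢-sym (<⇒≢ (<-trans (s≤s (s≤s (s≤s (s≤s z≤n)))) 5≤z)))) (src z 5≤z z<b))
          (store-cells-outside 3<base cs)) } } })
      (λ inv → runs-highCopy m (m≤n⇒m≤1+n 5≤j) (≤-trans (≤-reflexive (sym (+-suc j m))) j≤)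
                 (<-≤-trans n²< (≤-reflexive (+-suc j m))) inv)
    where
    j<b : j < base
    j<b = <-≤-trans (m<m+n j (s≤s (z≤n {m}))) j≤
    j≤V : j ≤ V
    j≤V = j≤base⇒j≤V (<⇒≤ j<b)
    m≤U : suc m ≤ U
    m≤U = ≤-trans (≤-trans (m≤n+m (suc m) j) j≤) base≤U
    v≡ : μ (μ 2) ≡ input j
    v≡ = trans (cong μ e₂) (src j 5≤j j<b)
    v₀≡ : μ (μ 2) + 0 ≡ input j
    v₀≡ = trans (+-identityʳ _) v≡
    v≤U : input j ≤ U
    v≤U = ≤-trans (input≤V j) V≤U
    far : ∀ {z} → z < base → (μ [ μ 4 ↦ μ (μ 2) + 0 ]) z ≡ μ z
    far z<b = store-other μ _ (λ z≡ → <base⇒≢addr {a = a₀} {j} z<b (trans z≡ e₄))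

  runs-boot : Runs (boot K R) input (bootWork R n) Booted
  runs-boot =
    runs-seq (runs-assign {input} (reg 1) (reg 0) mul (reg 0) {Q = λ μ → μ 1 ≡ n * n × Kept μ}
      (z≤n , n≤U) (z≤n , n≤U) 1≤U (≤-trans (≤-reflexive n²≡) (≤-trans (m≤m+n _ _) base≤U))
      (n²≡ , λ j j≢ → store-other input _ j≢))
    λ μ₁ (e₁ , k₁) →
    runs-seq (runs-assign {μ₁} (reg 1) (reg 1) add (lit (5 + R)) {Q = λ μ → μ 1 ≡ addr a₀ 0 × Kept μ}
      (1≤U , subst (_≤ U) (sym e₁) (≤-trans (m≤m+n _ _) base≤U)) (≤-trans R′≤base base≤U) 1≤U
      (subst (λ x → x + (5 + R) ≤ U) (sym e₁) base≤U)
      (trans (cong (_+ (5 + R)) e₁) (sym addr0) , λ j j≢ → trans (store-other μ₁ _ j≢) (k₁ j j≢)))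
    λ μ₂ (e₂ , k₂) →
    let v≡ = trans (k₂ 0 (λ ())) input0
        v₀≡ = trans (+-identityʳ (μ₂ 0)) (k₂ 0 (λ ())) in
    runs-seq (runs-assign {μ₂} (ind 1) (reg 0) add (lit 0)
      {Q = λ μ → μ 1 ≡ addr a₀ 0 × (∀ z → 2 ≤ z → z < base → μ z ≡ input z) × Cells μ (copied 1)}
      (z≤n , subst (_≤ U) (sym v≡) n≤U′) z≤n (1≤U , subst (_≤ U) (sym e₂) (addr≤ a₀ z≤n))
      (subst (_≤ U) (sym v₀≡) n≤U)
      (trans (store-other μ₂ _ (λ 1≡ → <base⇒≢addr {a = a₀} {0} 1<base (trans 1≡ e₂))) e₂ ,
       (λ z 2≤z z<b → trans (store-other μ₂ _ (λ z≡ → <base⇒≢addr {a = a₀} {0} z<b (trans z≡ e₂))) (k₂ z (≢-sym (<⇒≢ 2≤z)))) ,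
       subst (λ v → Cells (μ₂ [ μ₂ 1 ↦ v ]) (copied 1)) (sym v₀≡)
         (store-cells a₀ 0 (input 0) e₂ (mkCells λ a i → trans (k₂ (addr a i) (≢-sym (<base⇒≢addr {a = a} {i} 1<base)))
           (input-end _ (≤-trans (m<m+n (n * n) (s≤s z≤n)) (base≤addr a i)))))))
    λ μ₃ (e₃ , src₃ , cs₃) →
    runs-seq (runs-assign {μ₃} (reg 1) (reg 1) add (lit (2 * K)) {Q = Low-inv 2}
      (1≤U , subst (_≤ U) (sym e₃) (addr≤ a₀ z≤n)) (iK≤ (≤-trans (s≤s (s≤s z≤n)) 8≤V)) 1≤U
      (subst (_≤ U) (sym (trans (cong (_+ 2 * K) e₃) addr2)) (addr≤ a₀ (≤-trans (s≤s (s≤s z≤n)) 8≤V)))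
      (low-inv (trans (cong (_+ 2 * K) e₃) addr2)
        (λ z 2≤z z<b → trans (store-other μ₃ _ (≢-sym (<⇒≢ 2≤z))) (src₃ z 2≤z z<b))
        (mkCells λ a i → trans (Cells.cell (store-cells-outside 1<base cs₃) a i) (copied-1 a i))))
    λ μ₄ inv₄ →
    runs-lowCopy (3 + R) (s≤s (s≤s z≤n)) refl inv₄
    λ { μ₅ (low-inv e₅ src₅ cs₅) →
    runs-seq (runs-assign {μ₅} (reg 4) (reg 1) add (lit 0)
      {Q = λ μ → μ 1 ≡ addr a₀ (5 + R) × μ 4 ≡ addr a₀ (5 + R) × Source μ × Cells μ (copied (5 + R))}
      (1≤U , subst (_≤ U) (sym e₅) (addr≤ a₀ R′≤V)) z≤n (<base⇒≤U 5≤base)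
      (subst (_≤ U) (sym (trans (+-identityʳ _) e₅)) (addr≤ a₀ R′≤V))
      (e₅ , trans (+-identityʳ _) e₅ ,
       (λ z 5≤z z<b → trans (store-other μ₅ _ (≢-sym (<⇒≢ 5≤z))) (src₅ z (≤-trans (s≤s (s≤s z≤n)) 5≤z) z<b)) ,
       store-cells-outside 5≤base cs₅))
    λ μ₆ (a₁ , a₄ , src₆ , cs₆) →
    runs-seq (runs-assign {μ₆} (reg 1) (reg 1) sub (lit ((5 + R) * K))
      {Q = λ μ → μ 1 ≡ base × μ 4 ≡ addr a₀ (5 + R) × Source μ × Cells μ (copied (5 + R))}
      (1≤U , subst (_≤ U) (sym a₁) (addr≤ a₀ R′≤V)) (iK≤ R′≤V) 1≤U
      (≤-trans (m∸n≤m _ ((5 + R) * K)) (subst (_≤ U) (sym a₁) (addr≤ a₀ R′≤V)))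
      (trans (cong (_∸ (5 + R) * K) a₁) addrR , a₄ ,
       (λ z 5≤z z<b → trans (store-other μ₆ _ (≢-sym (<⇒≢ (<-trans (s≤s (s≤s z≤n)) 5≤z)))) (src₆ z 5≤z z<b)) ,
       store-cells-outside 1<base cs₆))
    λ μ₇ (b₁ , b₄ , src₇ , cs₇) →
    runs-seq (runs-assign {μ₇} (reg 3) (reg 1) sub (lit (5 + R)) {Q = λ μ → μ 3 ≡ n * n × Stable μ}
      (1≤U , subst (_≤ U) (sym b₁) base≤U) (≤-trans R′≤base base≤U) (<base⇒≤U 3<base)
      (≤-trans (m∸n≤m _ (5 + R)) (subst (_≤ U) (sym b₁) base≤U))
      (trans (cong (_∸ (5 + R)) b₁) (m+n∸n≡m (n * n) (5 + R)) , stable3 (b₁ , b₄ , src₇ , cs₇)))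
    λ μ₈ (c₃ , st₈) →
    runs-seq (runs-assign {μ₈} (reg 3) (reg 3) add (lit 1) {Q = λ μ → μ 3 ≡ suc (n * n) × Stable μ}
      (<base⇒≤U 3<base , subst (_≤ U) (sym c₃) (≤-trans (m≤m+n _ _) base≤U)) 1≤U (<base⇒≤U 3<base)
      (subst (_≤ U) (sym (trans (cong (_+ 1) c₃) (+-comm (n * n) 1))) n²+1≤U)
      (trans (cong (_+ 1) c₃) (+-comm (n * n) 1) , stable3 st₈))
    λ μ₉ (d₃ , st₉) →
    runs-seq (runs-assign {μ₉} (reg 3) (reg 3) sub (lit (5 + R)) {Q = λ μ → μ 3 ≡ suc (n * n) ∸ (5 + R) × Stable μ}
      (<base⇒≤U 3<base , subst (_≤ U) (sym d₃) n²+1≤U) (≤-trans R′≤base base≤U) (<base⇒≤U 3<base)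
      (≤-trans (m∸n≤m _ (5 + R)) (subst (_≤ U) (sym d₃) n²+1≤U))
      (cong (_∸ (5 + R)) d₃ , stable3 st₉))
    λ μ₁₀ (f₃ , (f₁ , f₄ , src₁₀ , cs₁₀)) →
    runs-seq (runs-assign {μ₁₀} (reg 2) (lit (5 + R)) add (lit 0)
      {Q = High-inv (5 + R) (5 + R) (suc (n * n) ∸ (5 + R)) (5 + R)}
      (≤-trans R′≤base base≤U) z≤n (<base⇒≤U 2<base)
      (≤-trans (≤-reflexive (+-identityʳ (5 + R))) (≤-trans R′≤base base≤U))
      (high-inv f₁ (+-identityʳ (5 + R)) f₃ f₄
        (λ z 5≤z z<b → trans (store-other μ₁₀ _ (≢-sym (<⇒≢ (<-trans (s≤s (s≤s (s≤s z≤n))) 5≤z)))) (src₁₀ z 5≤z z<b))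
        (store-cells-outside 2<base cs₁₀)))
    λ μ₁₁ inv → runs-highCopy (suc (n * n) ∸ (5 + R)) (m≤m+n 5 R) high≤ (m≤n+m∸n (suc (n * n)) (5 + R)) inv }
    where
    Kept Source Stable : Memory → Set
    Kept μ = ∀ j → j ≢ 1 → μ j ≡ input j
    Source μ = ∀ z → 5 ≤ z → z < base → μ z ≡ input z
    Stable μ = μ 1 ≡ base × μ 4 ≡ addr a₀ (5 + R) × Source μ × Cells μ (copied (5 + R))
    stable3 : ∀ {μ v} → Stable μ → Stable (μ [ 3 ↦ v ])
    stable3 {μ} {v} (a , b , c , d) = a , b ,
      (λ z 5≤z z<b → trans (store-other μ v (≢-sym (<⇒≢ (<-trans (s≤s (s≤s (s≤s (s≤s z≤n)))) 5≤z)))) (c z 5≤z z<b)) ,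
      store-cells-outside 3<base d
    R′≤V : 5 + R ≤ V
    R′≤V = ≤-trans R′≤base base≤V
    n≤U : input 0 ≤ U
    n≤U = ≤-trans (input≤V 0) V≤U
    n≤U′ : n ≤ U
    n≤U′ = subst (_≤ U) input0 n≤U
    n²≡ : input 0 * input 0 ≡ n * n
    n²≡ = cong₂ _*_ input0 input0
    n²+1≤U : suc (n * n) ≤ U
    n²+1≤U = ≤-trans (≤-trans (≤-reflexive (+-comm 1 (n * n))) (+-monoʳ-≤ (n * n) (s≤s z≤n))) base≤U
    addr0 : addr a₀ 0 ≡ base
    addr0 = cong (_+ base) a₀≡0
    addr2 : addr a₀ 0 + 2 * K ≡ addr a₀ 2
    addr2 = lemma (toℕ a₀) base (2 * K)
      where
      lemma : ∀ a b k → a + b + k ≡ k + a + b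
      lemma = solve-∀
    addrR : addr a₀ (5 + R) ∸ (5 + R) * K ≡ base
    addrR = trans (cong (λ a → (5 + R) * K + a + base ∸ (5 + R) * K) a₀≡0)
              (trans (cong (λ z → z + base ∸ (5 + R) * K) (+-identityʳ ((5 + R) * K))) (m+n∸m≡n ((5 + R) * K) base))
    copied-1 : ∀ a i → copied 1 a i ≡ copied 2 a i
    copied-1 a i with toℕ a₀ ≡ᵇ toℕ a
    ... | false = refl
    ... | true  with i
    ...   | 0 = refl
    ...   | 1 = sym input1
    ...   | suc (suc _) = refl
    high≤ : 5 + R + (suc (n * n) ∸ (5 + R)) ≤ base
    high≤ with suc (n * n) ≤? 5 + R
    ... | yes p = ≤-trans (≤-reflexive (trans (cong (5 + R +_) (m≤n⇒m∸n≡0 p)) (+-identityʳ (5 + R)))) R′≤base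
    ... | no p  = ≤-trans (≤-reflexive (m+[n∸m]≡n (<⇒≤ (≰⇒> p))))
                    (≤-trans (≤-reflexive (+-comm 1 (n * n))) (+-monoʳ-≤ (n * n) (s≤s z≤n)))

  runs-append : ∀ {P P′ μ w w′ Q Q′} {Good : ℕ → Set} → Runs P μ w Q →
                (∀ μ′ → Q μ′ → Σ[ k ∈ ℕ ] Good k × Runs P′ μ′ (w′ + k) Q′) →
                Σ[ k ∈ ℕ ] Good k × Runs (P ⨾ P′) μ (w + w′ + k) Q′
  runs-append {w = w} {w′} (ran {μ′} p s≤ q) cont with cont μ′ q
  ... | k , good , r = k , good , runs-weaken (≤-reflexive (sym (+-assoc w w′ k)))
    -- The assertion in the middle is sharpened to equality with the memory actually reached, for
    -- which `k` was chosen.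
    (runs-seq {w = w} {w′ + k} {Q = μ′ ≡_} (ran p s≤ refl) λ { _ refl → r })

  -- The running time of the second part may depend on what the first part has
  -- found.
  runs-program : ∀ (c d : Cmd K) (out : Exp K) {w ans} {Good : ℕ → Set} →
    2 + (height c ⊔ (height d ⊔ heightE out)) ≤ 5 + R →
    (∀ σ → (∀ i → σ a₀ i ≡ input i) → (∀ a i → toℕ a ≢ 0 → σ a i ≡ 0) →
      Triple c σ w (λ σ′ → Σ[ k ∈ ℕ ] Good k × Triple d σ′ k (λ σ″ → Fine σ″ out × eval σ″ out ≡ ans))) →
    Σ[ k ∈ ℕ ] Good k × Runs (boot K R ⨾ compile c 2 ⨾ compile d 2 ⨾ compileE out 2 ⨾ reg 0 ≔ reg 2 ⟨ add ⟩ lit 0) input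
      (bootWork R n + (w + (sizeE out + 1)) + k) (λ μ → μ 0 ≡ ans)
  runs-program c d out {w} {ans} h t =
    runs-append runs-boot λ { μ₁ (j , n²<j , ρ) →
    runs-append (t (copied j) (copied-all n²<j) (copied-other j) .Triple.exec ≤-refl
               (≤-trans (+-monoʳ-≤ 2 (m≤m⊔n _ _)) (≤-trans h R′≤base)) ρ (copied-bounded j))
    λ { μ₂ (outcome ρ₂ b₂ _ (k , good , t′)) → k , good ,
    runs-weaken (≤-reflexive (+-comm k (sizeE out + 1)))
    (runs-seq (t′ .Triple.exec ≤-refl
               (≤-trans (+-monoʳ-≤ 2 (≤-trans (m≤m⊔n (height d) _) (m≤n⊔m (height c) _))) (≤-trans h R′≤base)) ρ₂ b₂)
    λ { μ₃ (outcome ρ₃ b₃ _ (fine , out≡)) →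
    runs-seq (runs-compileE out ρ₃ b₃ fine ≤-refl
               (≤-trans (+-monoʳ-≤ 2 (≤-trans (m≤n⊔m (height d) _) (m≤n⊔m (height c) _))) (≤-trans h R′≤base)))
    λ { μ₄ (e₄ , _) →
    let v≤U = ≤-trans (fine⇒≤ b₃ out fine) V≤U in
    runs-assign {μ₄} (reg 0) (reg 2) add (lit 0) (<base⇒≤U 2<base , subst (_≤ U) (sym e₄) v≤U) z≤n z≤n
      (subst (_≤ U) (sym (trans (+-identityʳ _) e₄)) v≤U)
      (trans (+-identityʳ _) (trans e₄ out≡)) } }) } }

-- Matchings that cover a given set of vertices

infixr 8 _⊖_

⟦_⟧ : Bool → ℕ
⟦ b ⟧ = if b then 1 else 0

when-true : Bool → ℕ → ℕ
when-true b k = if b then k else 0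

Subset : ℕ → Set
Subset = Vec Bool

_⊖_ : ∀ {n} → Fin n → Subset n → Subset n
u ⊖ W = W [ u ]≔ false

listSum : {A : Set} → (A → ℕ) → List A → ℕ
listSum F []       = 0
listSum F (x ∷ xs) = F x + listSum F xs

isEmpty : ∀ {n} → Subset n → Bool
isEmpty []      = true
isEmpty (b ∷ W) = not b ∧ isEmpty W

-- A function on sets can be read as a polynomial with one variable x_v per vertex, modulo all
-- squares x_v^2. Then `grab u h` is x_u times `h`, `grabEdge` multiplies by x_u x_v, and
-- `matchings es` is the product of the factors 1 + x_u x_v over the edges.
grab : ∀ {n} → Fin n → (Subset n → ℕ) → Subset n → ℕ
grab u h W = when-true (lookup W u) (h (u ⊖ W))

grabEdge : ∀ {n} → Fin n × Fin n → (Subset n → ℕ) → Subset n → ℕ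
grabEdge (u , v) h = grab u (grab v h)

-- the number of sets of edges from the list that cover each vertex in W once
-- and no other vertex
matchings : ∀ {n} → List (Fin n × Fin n) → Subset n → ℕ
matchings []       W = ⟦ isEmpty W ⟧
matchings (e ∷ es) W = matchings es W + grabEdge e (matchings es) W

module _ {n : ℕ} where

  Covers : Subset n → List (Fin n × Fin n) → Set
  Covers W M = ∀ w → length (filter (incident? w) M) ≡ ⟦ lookup W w ⟧

  abstract
    covers? : ∀ W → Decidable (Covers W)
    covers? W M = Fin.all? λ w → length (filter (incident? w) M) ≟ ⟦ lookup W w ⟧

  valency : Fin n → List (Fin n × Fin n) → ℕ
  valency w M = length (filter (incident? w) M)

  valency-yes : ∀ {w e M} → Incident w e → valency w (e ∷ M) ≡ suc (valency w M)
  valency-yes {w} p = cong length (filter-accept (incident? w) p)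

  valency-no : ∀ {w e M} → ¬ Incident w e → valency w (e ∷ M) ≡ valency w M
  valency-no {w} ¬p = cong length (filter-reject (incident? w) ¬p)

module _ {A B : Set} {P : B → Set} {Q : A → Set} (P? : Decidable P) (Q? : Decidable Q) (f : A → B) where

  length-filter-map : (∀ x → P (f x) → Q x) → (∀ x → Q x → P (f x)) →
                      ∀ xs → length (filter P? (map f xs)) ≡ length (filter Q? xs)
  length-filter-map to from []       = refl
  length-filter-map to from (x ∷ xs) with P? (f x) | Q? x
  ... | yes _ | yes _ = cong suc (length-filter-map to from xs)
  ... | no _  | no _  = length-filter-map to from xs
  ... | yes p | no ¬q = ⊥-elim (¬q (to x p))
  ... | no ¬p | yes q = ⊥-elim (¬p (from x q))

length-filter-none : ∀ {A B : Set} {P : B → Set} (P? : Decidable P) (f : A → B) → (∀ x → ¬ P (f x)) →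
                     ∀ xs → length (filter P? (map f xs)) ≡ 0
length-filter-none P? f none []       = refl
length-filter-none P? f none (x ∷ xs) with P? (f x)
... | yes p = ⊥-elim (none x p)
... | no _  = length-filter-none P? f none xs

isEmpty-true : ∀ {n} (W : Subset n) → (∀ w → lookup W w ≡ false) → isEmpty W ≡ true
isEmpty-true []          p = refl
isEmpty-true (false ∷ W) p = isEmpty-true W (p ∘ suc)
isEmpty-true (true ∷ W)  p = ⊥-elim (case p zero of λ ())

isEmpty-false : ∀ {n} (W : Subset n) w → lookup W w ≡ true → isEmpty W ≡ false
isEmpty-false (true ∷ W)  zero    p = refl
isEmpty-false (true ∷ W)  (suc w) p = refl
isEmpty-false (false ∷ W) (suc w) p = isEmpty-false W w p

⟦⟧≡0 : ∀ {b} → 0 ≡ ⟦ b ⟧ → b ≡ false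
⟦⟧≡0 {false} _ = refl

module _ {n : ℕ} where

  covers-cons : ∀ {W : Subset n} {u v} → u ≢ v → lookup W u ≡ true → lookup W v ≡ true → ∀ M →
                Covers W ((u , v) ∷ M) → Covers (v ⊖ u ⊖ W) M
  covers-cons {W} {u} {v} u≢v Wu Wv M c w = go w (w Fin.≟ u) (w Fin.≟ v)
    where
    go : ∀ w → Dec (w ≡ u) → Dec (w ≡ v) → valency w M ≡ ⟦ lookup (v ⊖ u ⊖ W) w ⟧
    go w (yes refl) _ = trans (suc-injective (trans (sym (valency-yes {w = w} {e = u , v} {M = M} (inj₁ refl)))
                                (trans (c w) (cong ⟦_⟧ Wu))))
                         (cong ⟦_⟧ (sym (trans (lookup∘update′ u≢v (u ⊖ W) false) (lookup∘update u W false))))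
    go w (no _) (yes refl) = trans (suc-injective (trans (sym (valency-yes {w = w} {e = u , v} {M = M} (inj₂ refl)))
                                (trans (c w) (cong ⟦_⟧ Wv))))
                         (cong ⟦_⟧ (sym (lookup∘update v (u ⊖ W) false)))
    go w (no w≢u) (no w≢v) = trans (sym (valency-no {w = w} {e = u , v} {M = M} λ { (inj₁ p) → w≢u p ; (inj₂ p) → w≢v p }))
                         (trans (c w) (cong ⟦_⟧ (sym (trans (lookup∘update′ w≢v (u ⊖ W) false) (lookup∘update′ w≢u W false)))))

  covers-uncons : ∀ {W : Subset n} {u v} → u ≢ v → lookup W u ≡ true → lookup W v ≡ true → ∀ M →
                  Covers (v ⊖ u ⊖ W) M → Covers W ((u , v) ∷ M)
  covers-uncons {W} {u} {v} u≢v Wu Wv M c w = go w (w Fin.≟ u) (w Fin.≟ v)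
    where
    go : ∀ w → Dec (w ≡ u) → Dec (w ≡ v) → valency w ((u , v) ∷ M) ≡ ⟦ lookup W w ⟧
    go w (yes refl) _ = trans (valency-yes {w = w} {e = u , v} {M = M} (inj₁ refl)) (trans (cong suc (trans (c w)
                         (cong ⟦_⟧ (trans (lookup∘update′ u≢v (u ⊖ W) false) (lookup∘update u W false)))))
                         (cong ⟦_⟧ (sym Wu)))
    go w (no _) (yes refl) = trans (valency-yes {w = w} {e = u , v} {M = M} (inj₂ refl)) (trans (cong suc (trans (c w)
                         (cong ⟦_⟧ (lookup∘update v (u ⊖ W) false)))) (cong ⟦_⟧ (sym Wv)))
    go w (no w≢u) (no w≢v) = trans (valency-no {w = w} {e = u , v} {M = M} λ { (inj₁ p) → w≢u p ; (inj₂ p) → w≢v p })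
                         (trans (c w) (cong ⟦_⟧ (trans (lookup∘update′ w≢v (u ⊖ W) false) (lookup∘update′ w≢u W false))))

  covers-member : ∀ {W : Subset n} {w e} M → Incident w e → Covers W (e ∷ M) → lookup W w ≢ false
  covers-member {w = w} {e} M p c eq = 1+n≢0 (trans (sym (valency-yes {w = w} {e = e} {M = M} p)) (trans (c w) (cong ⟦_⟧ eq)))

  length-covers : ∀ (es : List (Fin n × Fin n)) → All (λ (u , v) → u ≢ v) es → ∀ W →
                  length (filter (covers? W) (sublists es)) ≡ matchings es W
  length-covers [] [] W with covers? W []
  ... | yes c = cong ⟦_⟧ (sym (isEmpty-true W λ w → ⟦⟧≡0 (c w)))
  ... | no ¬c = lemma (isEmpty W) refl
    where
    lemma : ∀ b → isEmpty W ≡ b → 0 ≡ ⟦ isEmpty W ⟧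
    lemma false eq = cong ⟦_⟧ (sym eq)
    lemma true eq  = ⊥-elim (¬c λ w → cong ⟦_⟧ (empty w (lookup W w) refl))
      where
      empty : ∀ w b → lookup W w ≡ b → false ≡ lookup W w
      empty w false p = sym p
      empty w true p  = trans (sym (isEmpty-false W w p)) (trans eq (sym p))
  length-covers ((u , v) ∷ es) (u≢v ∷ es≢) W = begin
    length (filter (covers? W) (map ((u , v) ∷_) (sublists es) ++ sublists es))
      ≡⟨ cong length (filter-++ (covers? W) (map ((u , v) ∷_) (sublists es)) (sublists es)) ⟩
    length (filter (covers? W) (map ((u , v) ∷_) (sublists es)) ++ filter (covers? W) (sublists es))
      ≡⟨ length-++ (filter (covers? W) (map ((u , v) ∷_) (sublists es))) ⟩
    length (filter (covers? W) (map ((u , v) ∷_) (sublists es))) + length (filter (covers? W) (sublists es))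
      ≡⟨ cong₂ _+_ (with-edge (lookup W u) (lookup W v) refl refl) (length-covers es es≢ W) ⟩
    grabEdge (u , v) (matchings es) W + matchings es W
      ≡⟨ +-comm (grabEdge (u , v) (matchings es) W) (matchings es W) ⟩
    matchings es W + grabEdge (u , v) (matchings es) W ∎
    where
    open ≡-Reasoning
    with-edge : ∀ b c → lookup W u ≡ b → lookup W v ≡ c →
                length (filter (covers? W) (map ((u , v) ∷_) (sublists es))) ≡ grabEdge (u , v) (matchings es) W
    with-edge false c Wu Wv rewrite Wu =
      length-filter-none (covers? W) _ (λ M cv → covers-member {W = W} {u} {u , v} M (inj₁ refl) cv Wu) (sublists es)
    with-edge true false Wu Wv rewrite Wu | lookup∘update′ (≢-sym u≢v) W false | Wv =
      length-filter-none (covers? W) _ (λ M cv → covers-member {W = W} {v} {u , v} M (inj₂ refl) cv Wv) (sublists es)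
    with-edge true true Wu Wv rewrite Wu | lookup∘update′ (≢-sym u≢v) W false | Wv =
      trans (length-filter-map (covers? W) (covers? (v ⊖ u ⊖ W)) _
               (covers-cons {W} u≢v Wu Wv) (covers-uncons {W} u≢v Wu Wv) (sublists es))
            (length-covers es es≢ (v ⊖ u ⊖ W))

  grab-cong : ∀ u {g h : Subset n → ℕ} → (∀ W → g W ≡ h W) → ∀ W → grab u g W ≡ grab u h W
  grab-cong u g≗h W = cong (when-true (lookup W u)) (g≗h (u ⊖ W))

  grab-true : ∀ {u h} {W : Subset n} → lookup W u ≡ true → grab u h W ≡ h (u ⊖ W)
  grab-true eq rewrite eq = refl

  grab-false : ∀ {u h} {W : Subset n} → lookup W u ≡ false → grab u h W ≡ 0
  grab-false eq rewrite eq = refl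

  grab-comm : ∀ u v (h : Subset n → ℕ) W → grab u (grab v h) W ≡ grab v (grab u h) W
  grab-comm u v h W with u Fin.≟ v
  ... | yes refl = refl
  ... | no u≢v rewrite lookup∘update′ (≢-sym u≢v) W false | lookup∘update′ u≢v W false
                     | []≔-commutes {x = false} {y = false} W u v u≢v with lookup W u | lookup W v
  ...   | true  | true  = refl
  ...   | true  | false = refl
  ...   | false | true  = refl
  ...   | false | false = refl

  grab-zero : ∀ u (W : Subset n) → grab u (λ _ → 0) W ≡ 0
  grab-zero u W with lookup W u
  ... | true  = refl
  ... | false = refl

  -- The relation x_u^2 = 0: a vertex taken out of the set cannot be taken out again.
  grab-twice : ∀ u (h : Subset n → ℕ) W → grab u (grab u h) W ≡ 0
  grab-twice u h W rewrite lookup∘update u W false with lookup W u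
  ... | true  = refl
  ... | false = refl

  grab-+ : ∀ u (g h : Subset n → ℕ) W → grab u (λ X → g X + h X) W ≡ grab u g W + grab u h W
  grab-+ u g h W with lookup W u
  ... | true  = refl
  ... | false = refl

  grabEdge-zero : ∀ e (W : Subset n) → grabEdge e (λ _ → 0) W ≡ 0
  grabEdge-zero (u , v) W = trans (grab-cong u (grab-zero v) W) (grab-zero u W)

  grabEdge-+ : ∀ e (g h : Subset n → ℕ) W → grabEdge e (λ X → g X + h X) W ≡ grabEdge e g W + grabEdge e h W
  grabEdge-+ (u , v) g h W = trans (grab-cong u (grab-+ v g h) W) (grab-+ u (grab v g) (grab v h) W)

  grab-grabEdge : ∀ u e (h : Subset n → ℕ) W → grab u (grabEdge e h) W ≡ grabEdge e (grab u h) W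
  grab-grabEdge u (x , y) h W = trans (grab-comm u x (grab y h) W) (grab-cong x (grab-comm u y h) W)

  grabEdge-comm : ∀ e f (h : Subset n → ℕ) W → grabEdge e (grabEdge f h) W ≡ grabEdge f (grabEdge e h) W
  grabEdge-comm (u , v) f h W = trans (grab-cong u (grab-grabEdge v f h) W) (grab-grabEdge u f (grab v h) W)

  grab-incident : ∀ {a e} → Incident a e → ∀ (h : Subset n → ℕ) W → grab a (grabEdge e h) W ≡ 0
  grab-incident {a} {u , v} (inj₁ refl) h W = grab-twice a (grab v h) W
  grab-incident {a} {u , v} (inj₂ refl) h W =
    trans (grab-comm a u (grab a h) W) (trans (grab-cong u (grab-twice a h) W) (grab-zero u W))

  grabEdge-incident : ∀ {a e f} → Incident a e → Incident a f → ∀ (h : Subset n → ℕ) W →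
                      grabEdge f (grabEdge e h) W ≡ 0
  grabEdge-incident {a} {e} {u , v} i (inj₁ refl) h W =
    trans (grab-comm a v (grabEdge e h) W) (trans (grab-cong v (grab-incident i h) W) (grab-zero v W))
  grabEdge-incident {a} {e} {u , v} i (inj₂ refl) h W = trans (grab-cong u (grab-incident i h) W) (grab-zero u W)

  at : Fin n → (Subset n → ℕ) → Subset n → Fin n × Fin n → ℕ
  at a h W e = when-true (does (incident? a e)) (grabEdge e h W)

  at-yes : ∀ {a e} → Incident a e → ∀ h W → at a h W e ≡ grabEdge e h W
  at-yes {a} {e} i h W = cong (λ b → when-true b (grabEdge e h W)) (dec-true (incident? a e) i)

  at-no : ∀ {a e} → ¬ Incident a e → ∀ h W → at a h W e ≡ 0
  at-no {a} {e} ¬i h W = cong (λ b → when-true b (grabEdge e h W)) (dec-false (incident? a e) ¬i)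

  at-+ : ∀ a g h W es → listSum (at a (λ X → g X + h X) W) es ≡ listSum (at a g W) es + listSum (at a h W) es
  at-+ a g h W []       = refl
  at-+ a g h W (e ∷ es) = trans (cong₂ _+_ (lemma (does (incident? a e))) (at-+ a g h W es))
    (interchange (at a g W e) (at a h W e) (listSum (at a g W) es) (listSum (at a h W) es))
    where
    interchange : ∀ w x y z → (w + x) + (y + z) ≡ (w + y) + (x + z)
    interchange = solve-∀
    lemma : ∀ b → when-true b (grabEdge e (λ X → g X + h X) W) ≡ when-true b (grabEdge e g W) + when-true b (grabEdge e h W)
    lemma true  = grabEdge-+ e g h W
    lemma false = refl

  at-incident : ∀ {a e} → Incident a e → ∀ h W es → listSum (at a (grabEdge e h) W) es ≡ 0
  at-incident i h W []       = refl
  at-incident {a} {e} i h W (f ∷ es) = cong₂ _+_ (case incident? a f of λ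
    { (yes j) → trans (at-yes j (grabEdge e h) W) (grabEdge-incident i j h W)
    ; (no ¬j) → at-no ¬j (grabEdge e h) W }) (at-incident i h W es)

  at-grabEdge : ∀ a e h W es → grabEdge e (λ X → listSum (at a h X) es) W ≡ listSum (at a (grabEdge e h) W) es
  at-grabEdge a e h W []       = grabEdge-zero e W
  at-grabEdge a e h W (f ∷ es) = trans (grabEdge-+ e (λ X → at a h X f) (λ X → listSum (at a h X) es) W)
    (cong₂ _+_ (lemma (does (incident? a f))) (at-grabEdge a e h W es))
    where
    lemma : ∀ b → grabEdge e (λ X → when-true b (grabEdge f h X)) W ≡ when-true b (grabEdge f (grabEdge e h) W)
    lemma true  = grabEdge-comm e f h W
    lemma false = grabEdge-zero e W

  -- An edge that avoids `a` leaves `a` in the set, so agreement on the sets that contain `a` is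
  -- enough.
  grabEdge-cong-at : ∀ {a e} {g h : Subset n → ℕ} → ¬ Incident a e → (∀ W → lookup W a ≡ true → g W ≡ h W) →
                     ∀ W → lookup W a ≡ true → grabEdge e g W ≡ grabEdge e h W
  grabEdge-cong-at {a} {u , v} ¬i g≗h W Wa with lookup W u
  ... | false = refl
  ... | true with lookup (u ⊖ W) v
  ...   | false = refl
  ...   | true  = g≗h _ (trans (lookup∘update′ (¬i ∘ inj₂) (u ⊖ W) false) (trans (lookup∘update′ (¬i ∘ inj₁) W false) Wa))

  -- Exactly one edge of a matching covers `a`. In each summand the monomial of an edge at `a`
  -- multiplies the full product, including its own factor and those of the other edges at `a`; this
  -- adds nothing, because the monomials of two edges that share a vertex multiply to 0.
  matchings-at : ∀ a es W → lookup W a ≡ true → matchings es W ≡ listSum (at a (matchings es) W) es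
  matchings-at a [] W Wa = cong ⟦_⟧ (isEmpty-false W a Wa)
  matchings-at a (e ∷ es) W Wa with incident? a e
  ... | yes i = begin
    m W + grabEdge e m W
      ≡⟨ +-comm (m W) _ ⟩
    grabEdge e m W + m W
      ≡⟨ cong₂ _+_ (sym (trans (grabEdge-+ e m (grabEdge e m) W)
           (trans (cong (grabEdge e m W +_) (grabEdge-incident i i m W)) (+-identityʳ _))))
         (trans (matchings-at a es W Wa) (sym (trans (cong (listSum (at a m W) es +_) (at-incident i m W es)) (+-identityʳ _)))) ⟩
    grabEdge e (matchings (e ∷ es)) W + (listSum (at a m W) es + listSum (at a (grabEdge e m) W) es)
      ≡⟨ cong₂ _+_ (sym (at-yes i (matchings (e ∷ es)) W)) (sym (at-+ a m (grabEdge e m) W es)) ⟩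
    at a (matchings (e ∷ es)) W e + listSum (at a (matchings (e ∷ es)) W) es ∎
    where
    open ≡-Reasoning
    m = matchings es
  ... | no ¬i = begin
    m W + grabEdge e m W
      ≡⟨ cong₂ _+_ (matchings-at a es W Wa) (trans (grabEdge-cong-at ¬i (matchings-at a es) W Wa) (at-grabEdge a e m W es)) ⟩
    listSum (at a m W) es + listSum (at a (grabEdge e m) W) es
      ≡⟨ cong₂ _+_ (sym (at-no ¬i (matchings (e ∷ es)) W)) (sym (at-+ a m (grabEdge e m) W es)) ⟩
    at a (matchings (e ∷ es)) W e + listSum (at a (matchings (e ∷ es)) W) es ∎
    where
    open ≡-Reasoning
    m = matchings es

-- Expansion of the matching count along a vertex

listSum-++ : ∀ {A : Set} (F : A → ℕ) xs ys → listSum F (xs ++ ys) ≡ listSum F xs + listSum F ys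
listSum-++ F []       ys = refl
listSum-++ F (x ∷ xs) ys = trans (cong (F x +_) (listSum-++ F xs ys)) (sym (+-assoc (F x) _ _))

listSum-map : ∀ {A B : Set} (F : B → ℕ) (f : A → B) xs → listSum F (map f xs) ≡ listSum (F ∘ f) xs
listSum-map F f []       = refl
listSum-map F f (x ∷ xs) = cong (F (f x) +_) (listSum-map F f xs)

listSum-filter : ∀ {A : Set} {P : A → Set} (P? : Decidable P) (F : A → ℕ) xs →
                 listSum F (filter P? xs) ≡ listSum (λ x → when-true (does (P? x)) (F x)) xs
listSum-filter P? F []       = refl
listSum-filter P? F (x ∷ xs) with does (P? x)
... | true  = cong (F x +_) (listSum-filter P? F xs)
... | false = listSum-filter P? F xs

listSum-tabulate : ∀ {A : Set} {n} (F : A → ℕ) (f : Fin n → A) → listSum F (tabulate f) ≡ ∑ (F ∘ f)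
listSum-tabulate {n = zero}  F f = refl
listSum-tabulate {n = suc n} F f = cong (F (f zero) +_) (listSum-tabulate F (f ∘ suc))

listSum-product : ∀ {A B : Set} (F : A × B → ℕ) xs ys →
                  listSum F (cartesianProduct xs ys) ≡ listSum (λ x → listSum (λ y → F (x , y)) ys) xs
listSum-product F []       ys = refl
listSum-product F (x ∷ xs) ys = trans (listSum-++ F (map (x ,_) ys) (cartesianProduct xs ys))
  (cong₂ _+_ (listSum-map F (x ,_) ys) (listSum-product F xs ys))

∑-zero : ∀ n → ∑ {n} (λ _ → 0) ≡ 0
∑-zero zero    = refl
∑-zero (suc n) = ∑-zero n

∑-δ : ∀ {n} (a : Fin n) (f : Fin n → ℕ) → ∑ (λ u → when-true (does (a Fin.≟ u)) (f u)) ≡ f a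
∑-δ {suc n} zero    f = trans (cong (f zero +_) (∑-zero n)) (+-identityʳ (f zero))
∑-δ {suc n} (suc a) f = trans (sum-cong-≗ λ u → cong (λ b → when-true b (f (suc u))) (does-suc u)) (∑-δ a (f ∘ suc))
  where
  does-suc : ∀ u → does (suc a Fin.≟ suc u) ≡ does (a Fin.≟ u)
  does-suc u with a Fin.≟ u
  ... | yes _ = refl
  ... | no _  = refl

∑-when : ∀ {n} b (f : Fin n → ℕ) → ∑ (λ u → when-true b (f u)) ≡ when-true b (∑ f)
∑-when true  f = refl
∑-when {n} false f = ∑-zero n

module _ {n : ℕ} (G : Graph n) where

  private
    adj-false : ∀ {u v} → adj G u v ≡ false → adj G v u ≡ false
    adj-false {u} {v} eq with adj G v u in eq′
    ... | false = refl
    ... | true  = ⊥-elim (subst T eq (Graph.symmetric G v u (subst T (sym eq′) tt)))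

  adj-sym : ∀ u v → adj G u v ≡ adj G v u
  adj-sym u v with adj G u v in eq | adj G v u in eq′
  ... | true  | true  = refl
  ... | false | false = refl
  ... | true  | false = trans (sym eq) (adj-false eq′)
  ... | false | true  = trans (sym (adj-false eq)) eq′

  adj-irrefl : ∀ u → adj G u u ≡ false
  adj-irrefl u with adj G u u in eq
  ... | false = refl
  ... | true  = ⊥-elim (Graph.irreflexive G u (subst T (sym eq) tt))

  private
    inEdges : Fin n → Fin n → Bool
    inEdges u v = does ((u Fin.<? v) ×-dec T? (adj G u v))

    does⇒≡ : ∀ {a u : Fin n} → does (a Fin.≟ u) ≡ true → a ≡ u
    does⇒≡ {a} {u} p with a Fin.≟ u
    ... | yes a≡u = a≡u

    inEdges⇒< : ∀ {u v} → inEdges u v ≡ true → toℕ u < toℕ v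
    inEdges⇒< {u} {v} p with toℕ u <ᵇ toℕ v in eq
    ... | true = <ᵇ⇒< (toℕ u) (toℕ v) (subst T (sym eq) tt)

    -- A listed edge at `a` has `a` as its smaller or as its larger endpoint, never both, so the
    -- disjunction turns into a sum.
    split : ∀ p q r k → (p ≡ true → q ≡ true → r ≡ true → ⊥) →
            when-true p (when-true (q ∨ r) k) ≡ when-true q (when-true p k) + when-true r (when-true p k)
    split true  true  true  k exclusive = ⊥-elim (exclusive refl refl refl)
    split true  true  false k _ = sym (+-identityʳ k)
    split true  false true  k _ = refl
    split true  false false k _ = refl
    split false true  true  k _ = refl
    split false true  false k _ = refl
    split false false true  k _ = refl
    split false false false k _ = refl

    -- An edge between `a` and `v` is listed in one of the two orders only; the values agree because
    -- `grab` commutes.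
    merge : ∀ a v {k l} → k ≡ l → when-true (inEdges a v) k + when-true (inEdges v a) l ≡ when-true (adj G a v) k
    merge a v {k} refl with Fin.<-cmp a v
    ... | tri< a<v _ v≮a rewrite dec-true (a Fin.<? v) a<v | dec-false (v Fin.<? a) v≮a = +-identityʳ _
    ... | tri> a≮v _ v<a rewrite dec-true (v Fin.<? a) v<a | dec-false (a Fin.<? v) a≮v | adj-sym a v = refl
    ... | tri≈ a≮v refl _ rewrite dec-false (a Fin.<? a) a≮v | adj-irrefl a = refl

  listSum-edges : ∀ a h W → listSum (at a h W) (edges G) ≡ ∑ (λ v → when-true (adj G a v) (grab a (grab v h) W))
  listSum-edges a h W = begin
    listSum (at a h W) (edges G)
      ≡⟨ listSum-filter (λ (u , v) → (u Fin.<? v) ×-dec T? (adj G u v)) (at a h W) (cartesianProduct (allFin n) (allFin n)) ⟩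
    listSum F (cartesianProduct (allFin n) (allFin n))
      ≡⟨ listSum-product F (allFin n) (allFin n) ⟩
    listSum (λ u → listSum (λ v → F (u , v)) (allFin n)) (allFin n)
      ≡⟨ listSum-tabulate (λ u → listSum (λ v → F (u , v)) (allFin n)) id ⟩
    ∑ (λ u → listSum (λ v → F (u , v)) (allFin n))
      ≡⟨ sum-cong-≗ (λ u → listSum-tabulate (λ v → F (u , v)) id) ⟩
    ∑ (λ u → ∑ λ v → F (u , v))
      ≡⟨ sum-cong-≗ (λ u → trans (sum-cong-≗ λ v → split (inEdges u v) (does (a Fin.≟ u)) (does (a Fin.≟ v)) (g u v)
           λ p q r → <⇒≢ (inEdges⇒< p) (cong toℕ (trans (sym (does⇒≡ {a} q)) (does⇒≡ {a} r)))) (∑-distrib-+ (l u) (r u))) ⟩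
    ∑ (λ u → ∑ (l u) + ∑ (r u))
      ≡⟨ ∑-distrib-+ (λ u → ∑ (l u)) (λ u → ∑ (r u)) ⟩
    ∑ (λ u → ∑ (l u)) + ∑ (λ u → ∑ (r u))
      ≡⟨ cong₂ _+_ (trans (sum-cong-≗ λ u → ∑-when (does (a Fin.≟ u)) (f u)) (∑-δ a (λ u → ∑ (f u))))
                   (sum-cong-≗ λ u → ∑-δ a (f u)) ⟩
    ∑ (f a) + ∑ (λ v → f v a)
      ≡⟨ sym (∑-distrib-+ (f a) (λ v → f v a)) ⟩
    ∑ (λ v → f a v + f v a)
      ≡⟨ sum-cong-≗ (λ v → merge a v (grab-comm a v h W)) ⟩
    ∑ (λ v → when-true (adj G a v) (grab a (grab v h) W)) ∎
    where
    open ≡-Reasoning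
    F : Fin n × Fin n → ℕ
    F (u , v) = when-true (inEdges u v) (at a h W (u , v))
    g f l r : Fin n → Fin n → ℕ
    g u v = grab u (grab v h) W
    f u v = when-true (inEdges u v) (g u v)
    l u v = when-true (does (a Fin.≟ u)) (f u v)
    r u v = when-true (does (a Fin.≟ v)) (f u v)

  matchings-expand : ∀ a W → lookup W a ≡ true →
    matchings (edges G) W ≡ ∑ (λ v → when-true (adj G a v) (grab v (matchings (edges G)) (a ⊖ W)))
  matchings-expand a W Wa = trans (matchings-at a (edges G) W Wa)
    (trans (listSum-edges a (matchings (edges G)) W)
      (sum-cong-≗ λ v → cong (when-true (adj G a v)) (grab-true {h = grab v (matchings (edges G))} Wa)))

  length-perfectMatchings : length (perfectMatchings G) ≡ matchings (edges G) (replicate n true)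
  length-perfectMatchings = trans
    (cong length (filter-≐ coversEachVertexOnce? (covers? (replicate n true))
      ((λ {M} c w → trans (c w) (cong ⟦_⟧ (sym (lookup-replicate w true)))) ,
       (λ {M} c w → trans (c w) (cong ⟦_⟧ (lookup-replicate w true)))) (sublists (edges G))))
    (length-covers (edges G) loopless (replicate n true))
    where
    loopless : All (λ (u , v) → u ≢ v) (edges G)
    loopless = All.map (λ { {u , v} (u<v , _) u≡v → <-irrefl (cong toℕ u≡v) u<v })
                 (all-filter (λ (u , v) → (u Fin.<? v) ×-dec T? (adj G u v)) (cartesianProduct (allFin n) (allFin n)))

-- Sets of vertices as numbers

encode-set : ∀ {n} → Subset n → ℕ
encode-set []      = 0
encode-set (b ∷ X) = ⟦ b ⟧ + encode-set X * 2

⟦⟧≤1 : ∀ b → ⟦ b ⟧ ≤ 1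
⟦⟧≤1 true  = ≤-refl
⟦⟧≤1 false = z≤n

⟦⟧-injective : ∀ {b c} → ⟦ b ⟧ ≡ ⟦ c ⟧ → b ≡ c
⟦⟧-injective {true}  {true}  _ = refl
⟦⟧-injective {false} {false} _ = refl

half : ∀ b q → (⟦ b ⟧ + q * 2) / 2 ≡ q
half b q = trans (+-distrib-/-∣ʳ ⟦ b ⟧ (n∣m*n q)) (cong₂ _+_ (lemma b) (m*n/n≡m q 2))
  where
  lemma : ∀ b → ⟦ b ⟧ / 2 ≡ 0
  lemma true  = refl
  lemma false = refl

encode-set-injective : ∀ {n} (X Y : Subset n) → encode-set X ≡ encode-set Y → X ≡ Y
encode-set-injective []      []      _  = refl
encode-set-injective (b ∷ X) (c ∷ Y) eq with trans (sym (half b (encode-set X))) (trans (cong (_/ 2) eq) (half c (encode-set Y)))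
... | X≡Y = cong₂ _∷_
  (⟦⟧-injective (+-cancelʳ-≡ (encode-set Y * 2) ⟦ b ⟧ ⟦ c ⟧ (trans (cong (λ k → ⟦ b ⟧ + k * 2) (sym X≡Y)) eq)))
  (encode-set-injective X Y X≡Y)

encode-set< : ∀ {n} (X : Subset n) → encode-set X < 2 ^ n
encode-set< []      = s≤s z≤n
encode-set< {suc n} (b ∷ X) = begin-strict
  ⟦ b ⟧ + encode-set X * 2  <⟨ +-monoˡ-< (encode-set X * 2) (s≤s (⟦⟧≤1 b)) ⟩
  suc (encode-set X) * 2    ≤⟨ *-monoˡ-≤ 2 (encode-set< X) ⟩
  2 ^ n * 2                 ≡⟨ *-comm (2 ^ n) 2 ⟩
  2 ^ suc n                 ∎
  where open ≤-Reasoning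

encode-full : ∀ n → encode-set (replicate n true) ≡ 2 ^ n ∸ 1
encode-full n = cong (_∸ 1) (lemma n)
  where
  lemma : ∀ n → suc (encode-set (replicate n true)) ≡ 2 ^ n
  lemma zero    = refl
  lemma (suc n) = trans (cong (_* 2) (lemma n)) (*-comm (2 ^ n) 2)

encode-empty : ∀ n → encode-set (replicate n false) ≡ 0
encode-empty zero    = refl
encode-empty (suc n) = cong (_* 2) (encode-empty n)

encode-insert : ∀ {n} (X : Subset n) v → lookup X v ≡ false → encode-set X + 2 ^ toℕ v ≡ encode-set (X [ v ]≔ true)
encode-insert (false ∷ X) zero    _ = +-comm (encode-set X * 2) 1
encode-insert (b ∷ X)     (suc v) p = trans (lemma ⟦ b ⟧ (encode-set X) (2 ^ toℕ v))
  (cong (λ k → ⟦ b ⟧ + k * 2) (encode-insert X v p))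
  where
  lemma : ∀ x y z → x + y * 2 + 2 * z ≡ x + (y + z) * 2
  lemma = solve-∀

apply-div : ∀ m n .{{_ : NonZero n}} → apply div m n ≡ m / n
apply-div m (suc n) = refl

-- The membership test of the machine: bit `v` is the parity of the quotient by `2 ^ toℕ v`, and
-- `low-bit` extracts the parity with the operations available.
encode-shift : ∀ {n} (X : Subset n) v → Σ[ q ∈ ℕ ] apply div (encode-set X) (2 ^ toℕ v) ≡ ⟦ lookup X v ⟧ + q * 2
encode-shift (b ∷ X) zero    = encode-set X , n/1≡n _
encode-shift (b ∷ X) (suc v) with encode-shift X v
... | q , eq = q , (begin
  apply div (⟦ b ⟧ + encode-set X * 2) (2 * 2 ^ toℕ v)  ≡⟨ apply-div _ (2 ^ suc (toℕ v)) ⟩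
  (⟦ b ⟧ + encode-set X * 2) / (2 * 2 ^ toℕ v)          ≡⟨ sym (m/n/o≡m/[n*o] (⟦ b ⟧ + encode-set X * 2) 2 (2 ^ toℕ v)) ⟩
  (⟦ b ⟧ + encode-set X * 2) / 2 / 2 ^ toℕ v            ≡⟨ cong (_/ 2 ^ toℕ v) (half b (encode-set X)) ⟩
  encode-set X / 2 ^ toℕ v                              ≡⟨ sym (apply-div _ (2 ^ toℕ v)) ⟩
  apply div (encode-set X) (2 ^ toℕ v)                  ≡⟨ eq ⟩
  ⟦ lookup X v ⟧ + q * 2                                ∎)
  where
  open ≡-Reasoning
  instance
    2^v≢0 : NonZero (2 ^ toℕ v)
    2^v≢0 = m^n≢0 2 (toℕ v)
    2^1+v≢0 : NonZero (2 * 2 ^ toℕ v)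
    2^1+v≢0 = m^n≢0 2 (suc (toℕ v))

low-bit : ∀ {y} b q → y ≡ ⟦ b ⟧ + q * 2 → y ∸ y / 2 * 2 ≡ ⟦ b ⟧
low-bit b q refl = trans (cong (λ k → ⟦ b ⟧ + q * 2 ∸ k * 2) (half b q)) (m+n∸n≡m ⟦ b ⟧ (q * 2))

-- Counting families of sets between two given sets

size : ∀ {n} → Subset n → ℕ
size X = ∑ (λ v → ⟦ lookup X v ⟧)

insert : ∀ {n} → Fin n → Subset n → Subset n
insert v X = X [ v ]≔ true

size-insert : ∀ {n} (X : Subset n) v → lookup X v ≡ false → size (insert v X) ≡ suc (size X)
size-insert (false ∷ X) zero    _ = refl
size-insert (b ∷ X)     (suc v) p = trans (cong (⟦ b ⟧ +_) (size-insert X v p)) (+-suc ⟦ b ⟧ (size X))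

∑-mono : ∀ {n} {f g : Fin n → ℕ} → (∀ v → f v ≤ g v) → ∑ f ≤ ∑ g
∑-mono {zero}  f≤g = z≤n
∑-mono {suc n} f≤g = +-mono-≤ (f≤g zero) (∑-mono (f≤g ∘ suc))

∑-const : ∀ n k → ∑ {n} (λ _ → k) ≡ n * k
∑-const zero    k = refl
∑-const (suc n) k = cong (k +_) (∑-const n k)

size-empty : ∀ n → size (replicate n false) ≡ 0
size-empty zero    = refl
size-empty (suc n) = size-empty n

Between : ∀ {n} → Subset n → Subset n → Subset n → Set
Between lo hi X = ∀ v → (lookup lo v ≡ true → lookup X v ≡ true) × (lookup X v ≡ true → lookup hi v ≡ true)

free : ∀ {n} → Subset n → Subset n → ℕ
free lo hi = ∑ (λ v → ⟦ lookup hi v ∧ not (lookup lo v) ⟧)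

tails : ∀ {n} → Bool → List (Subset (suc n)) → List (Subset n)
tails c []                 = []
tails true  ((true ∷ X) ∷ xs)  = X ∷ tails true xs
tails true  ((false ∷ X) ∷ xs) = tails true xs
tails false ((true ∷ X) ∷ xs)  = tails false xs
tails false ((false ∷ X) ∷ xs) = X ∷ tails false xs

tails-all : ∀ {n} c {P : Subset (suc n) → Set} {xs} → All P xs → All (λ X → P (c ∷ X)) (tails c xs)
tails-all c     []                           = []
tails-all true  (_∷_ {true ∷ X} p ps)  = p ∷ tails-all true ps
tails-all true  (_∷_ {false ∷ X} p ps) = tails-all true ps
tails-all false (_∷_ {true ∷ X} p ps)  = tails-all false ps
tails-all false (_∷_ {false ∷ X} p ps) = p ∷ tails-all false ps

tails-unique : ∀ {n} c {xs : List (Subset (suc n))} → Unique xs → Unique (tails c xs)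
tails-unique c     []                           = []
tails-unique true  (_∷_ {true ∷ X} p ps)  = All.map (λ q → q ∘ cong (true ∷_)) (tails-all true p) ∷ tails-unique true ps
tails-unique true  (_∷_ {false ∷ X} p ps) = tails-unique true ps
tails-unique false (_∷_ {true ∷ X} p ps)  = tails-unique false ps
tails-unique false (_∷_ {false ∷ X} p ps) = All.map (λ q → q ∘ cong (false ∷_)) (tails-all false p) ∷ tails-unique false ps

weightSum : ∀ {n} → ℕ → List (Subset n) → ℕ
weightSum c = listSum (λ X → c ^ size X)

weightSum-tails : ∀ {n} c (xs : List (Subset (suc n))) →
                  weightSum c xs ≡ c * weightSum c (tails true xs) + weightSum c (tails false xs)
weightSum-tails c []                 = sym (trans (+-identityʳ (c * 0)) (*-zeroʳ c))
weightSum-tails c ((true ∷ X) ∷ xs)  = trans (cong (c * c ^ size X +_) (weightSum-tails c xs))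
  (lemma c (c ^ size X) (weightSum c (tails true xs)) (weightSum c (tails false xs)))
  where
  lemma : ∀ c x y z → c * x + (c * y + z) ≡ c * (x + y) + z
  lemma = solve-∀
weightSum-tails c ((false ∷ X) ∷ xs) = trans (cong (c ^ size X +_) (weightSum-tails c xs))
  (lemma (c ^ size X) (c * weightSum c (tails true xs)) (weightSum c (tails false xs)))
  where
  lemma : ∀ x y z → x + (y + z) ≡ y + (x + z)
  lemma = solve-∀

all-absurd : {A : Set} {P : A → Set} → (∀ x → ¬ P x) → ∀ {xs} → All P xs → xs ≡ []
all-absurd ¬p []      = refl
all-absurd ¬p (p ∷ _) = ⊥-elim (¬p _ p)

-- For c = 2 this beats the bound 2 ^ free if all the sets are large.
weightSum≤ : ∀ {n} c (lo hi : Subset n) {xs} → Unique xs → All (Between lo hi) xs →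
             weightSum c xs ≤ c ^ size lo * suc c ^ free lo hi
weightSum≤ c [] [] {[]} _ _ = z≤n
weightSum≤ c [] [] {[] ∷ []} _ _ = ≤-refl
weightSum≤ c [] [] {[] ∷ [] ∷ _} ((≢ ∷ _) ∷ _) _ = ⊥-elim (≢ refl)
weightSum≤ c (l ∷ lo) (h ∷ hi) {xs} u bs = ≤-trans (≤-reflexive (weightSum-tails c xs)) (go l h refl refl)
  where
  restrict : ∀ b → All (Between lo hi) (tails b xs)
  restrict b = All.map (λ p v → p (suc v)) (tails-all b bs)
  IH : ∀ b → weightSum c (tails b xs) ≤ c ^ size lo * suc c ^ free lo hi
  IH b = weightSum≤ c lo hi (tails-unique b u) (restrict b)
  none-false : l ≡ true → tails false xs ≡ []
  none-false eq = all-absurd (λ X p → case proj₁ (p zero) eq of λ ()) (tails-all false bs)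
  none-true : h ≡ false → tails true xs ≡ []
  none-true eq = all-absurd (λ X p → case trans (sym (proj₂ (p zero) refl)) eq of λ ()) (tails-all true bs)
  a = c ^ size lo
  b = suc c ^ free lo hi
  go : ∀ l′ h′ → l ≡ l′ → h ≡ h′ → c * weightSum c (tails true xs) + weightSum c (tails false xs) ≤
       c ^ (⟦ l′ ⟧ + size lo) * suc c ^ (⟦ h′ ∧ not l′ ⟧ + free lo hi)
  go true true p q rewrite none-false p =
    ≤-trans (≤-reflexive (+-identityʳ _)) (≤-trans (*-monoʳ-≤ c (IH true)) (≤-reflexive (sym (*-assoc c a b))))
  go true false p q rewrite none-false p | none-true q = ≤-trans (≤-reflexive (trans (+-identityʳ _) (*-zeroʳ c))) z≤n
  -- Only a free vertex lets both halves contribute, with weight `c` if it is present and 1 if it is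
  -- absent; hence the base `suc c`.
  go false true p q = ≤-trans (+-mono-≤ (*-monoʳ-≤ c (IH true)) (IH false)) (≤-reflexive (lemma a b c))
    where
    lemma : ∀ a b c → c * (a * b) + a * b ≡ a * ((1 + c) * b)
    lemma = solve-∀
  go false false p q rewrite none-true q = ≤-trans (≤-reflexive (cong (_+ weightSum c (tails false xs)) (*-zeroʳ c))) (IH false)

weightSum-size : ∀ {n} c s {xs : List (Subset n)} → All (λ X → size X ≡ s) xs → weightSum c xs ≡ length xs * c ^ s
weightSum-size c s []         = refl
weightSum-size c s (refl ∷ p) = cong (c ^ s +_) (weightSum-size c s p)

weightSum-1 : ∀ {n} (xs : List (Subset n)) → weightSum 1 xs ≡ length xs
weightSum-1 []       = refl
weightSum-1 (X ∷ xs) = cong₂ _+_ (^-zeroˡ (size X)) (weightSum-1 xs)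

length≤2^free : ∀ {n} (lo hi : Subset n) {xs} → Unique xs → All (Between lo hi) xs → length xs ≤ 2 ^ free lo hi
length≤2^free lo hi {xs} u bs = begin
  length xs                         ≡⟨ sym (weightSum-1 xs) ⟩
  weightSum 1 xs                    ≤⟨ weightSum≤ 1 lo hi u bs ⟩
  1 ^ size lo * 2 ^ free lo hi      ≡⟨ cong (_* 2 ^ free lo hi) (^-zeroˡ (size lo)) ⟩
  1 * 2 ^ free lo hi                ≡⟨ *-identityˡ _ ⟩
  2 ^ free lo hi                    ∎
  where open ≤-Reasoning

length≤2^n : ∀ {n} {xs : List (Subset n)} → Unique xs → length xs ≤ 2 ^ n
length≤2^n {n} {xs} u = ≤-trans
  (length≤2^free (replicate n false) (replicate n true) u (All.universal between xs))
  (^-monoʳ-≤ 2 (≤-trans (∑-mono {n} {g = λ _ → 1} (λ v → ⟦⟧≤1 (lookup (replicate n true) v ∧ not (lookup (replicate n false) v)))) (≤-reflexive (trans (∑-const n 1) (*-identityʳ n)))))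
  where
  between : ∀ X → Between (replicate n false) (replicate n true) X
  between X v = (λ p → case trans (sym (lookup-replicate v false)) p of λ ()) , (λ _ → lookup-replicate v true)

-- Ways to complete a partial matching

∁ : ∀ {n} → Subset n → Subset n
∁ = Vec.map not

lookup-∁ : ∀ {n} (X : Subset n) v → lookup (∁ X) v ≡ not (lookup X v)
lookup-∁ X v = lookup-map v not X

module _ {n : ℕ} (G : Graph n) where

  completions : Subset n → ℕ
  completions X = matchings (edges G) (∁ X)

  extend : Fin n → Subset n → Fin n → ℕ
  extend a X v = when-true (adj G a v) (when-true (not (lookup X v)) (completions (insert a (insert v X))))

  -- An unmatched `a` gets exactly one unmatched neighbour as its partner. This recurrence is what
  -- keeps the `total` of a level unchanged when `a` is matched.
  completions-expand : ∀ a X → lookup X a ≡ false → completions X ≡ ∑ (extend a X)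
  completions-expand a X Xa = trans (matchings-expand G a (∁ X) (trans (lookup-∁ X a) (cong not Xa)))
    (sum-cong-≗ λ v → lemma v (adj G a v) refl)
    where
    lemma : ∀ v b → adj G a v ≡ b → when-true b (grab v (matchings (edges G)) (a ⊖ ∁ X)) ≡
            when-true b (when-true (not (lookup X v)) (completions (insert a (insert v X))))
    lemma v false _ = refl
    lemma v true eq = cong₂ when-true (trans (lookup∘update′ (≢-sym a≢v) (∁ X) false) (lookup-∁ X v))
      (cong (matchings (edges G)) (begin
        v ⊖ a ⊖ ∁ X              ≡⟨ []≔-commutes {x = false} {y = false} (∁ X) a v a≢v ⟩
        a ⊖ v ⊖ ∁ X              ≡⟨ cong (a ⊖_) (sym (map-[]≔ not X v)) ⟩
        a ⊖ ∁ (insert v X)       ≡⟨ sym (map-[]≔ not (insert v X) a) ⟩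
        ∁ (insert a (insert v X)) ∎))
      where
      open ≡-Reasoning
      a≢v : a ≢ v
      a≢v refl = case trans (sym eq) (adj-irrefl G a) of λ ()

-- Tables and stacks of sets

put : (ℕ → ℕ) → ℕ → ℕ → ℕ → ℕ
put f i v j = if i ≡ᵇ j then v else f j

put-same : ∀ f i v → put f i v i ≡ v
put-same f i v rewrite ≡ᵇ-refl i = refl

put-other : ∀ f {i j} v → i ≢ j → put f i v j ≡ f j
put-other f v i≢j rewrite ≢⇒≡ᵇ-false i≢j = refl

module _ {n : ℕ} where

  -- a stack of sets, stored upwards from cell lo with its head on top
  Stack : (ℕ → ℕ) → ℕ → List (Subset n) → Set
  Stack Q lo []       = ⊤
  Stack Q lo (X ∷ xs) = Q (lo + length xs) ≡ encode-set X × Stack Q lo xs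

  stack-put : ∀ Q lo v i xs → lo + length xs ≤ i → Stack Q lo xs → Stack (put Q i v) lo xs
  stack-put Q lo v i []       _ _       = tt
  stack-put Q lo v i (X ∷ xs) le (p , s) =
    trans (put-other Q v (≢-sym (<⇒≢ lt))) p , stack-put Q lo v i xs (<⇒≤ lt) s
    where
    lt : lo + length xs < i
    lt = ≤-trans (≤-reflexive (sym (+-suc lo (length xs)))) le

  sumOver : (ℕ → ℕ) → (Subset n → ℕ) → List (Subset n) → ℕ
  sumOver T g = listSum (λ X → T (encode-set X) * g X)

  sumOver-cong : ∀ T T′ g xs → All (λ X → T (encode-set X) ≡ T′ (encode-set X)) xs → sumOver T g xs ≡ sumOver T′ g xs
  sumOver-cong T T′ g []       []       = refl
  sumOver-cong T T′ g (X ∷ xs) (p ∷ ps) = cong₂ _+_ (cong (_* g X) p) (sumOver-cong T T′ g xs ps)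

  put-set-other : ∀ T (Y : Subset n) v {Z} → Y ≢ Z → T (encode-set Z) ≡ put T (encode-set Y) v (encode-set Z)
  put-set-other T Y v {Z} Y≢Z = sym (put-other T v (Y≢Z ∘ encode-set-injective Y Z))

  ∉⇒all≢ : ∀ {Y : Subset n} {xs} → Y ∉ xs → All (Y ≢_) xs
  ∉⇒all≢ {xs = []}     Y∉ = []
  ∉⇒all≢ {xs = X ∷ xs} Y∉ = (Y∉ ∘ here) ∷ ∉⇒all≢ (Y∉ ∘ there)

  sumOver-put-∈ : ∀ T g {Y : Subset n} t xs → Unique xs → Y ∈ xs →
                  sumOver (put T (encode-set Y) (T (encode-set Y) + t)) g xs ≡ t * g Y + sumOver T g xs
  sumOver-put-∈ T g {Y} t (.Y ∷ xs) (Y≢ ∷ u) (here refl)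
    rewrite put-same T (encode-set Y) (T (encode-set Y) + t)
          | sym (sumOver-cong T (put T (encode-set Y) (T (encode-set Y) + t)) g xs (All.map (put-set-other T Y _) Y≢)) =
    lemma (T (encode-set Y)) t (g Y) (sumOver T g xs)
    where
    lemma : ∀ a t g s → (a + t) * g + s ≡ t * g + (a * g + s)
    lemma = solve-∀
  sumOver-put-∈ T g {Y} t (X ∷ xs) (X≢ ∷ u) (there Y∈) = trans
    (cong₂ _+_ (cong (_* g X) (sym (put-set-other T Y _ (≢-sym (All.lookup X≢ Y∈))))) (sumOver-put-∈ T g t xs u Y∈))
    (lemma (T (encode-set X) * g X) (t * g Y) (sumOver T g xs))
    where
    lemma : ∀ a b c → a + (b + c) ≡ b + (a + c)
    lemma = solve-∀

  sumOver-put-∉ : ∀ T g {Y : Subset n} v xs → Y ∉ xs → sumOver (put T (encode-set Y) v) g xs ≡ sumOver T g xs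
  sumOver-put-∉ T g {Y} v xs Y∉ = sym (sumOver-cong T (put T (encode-set Y) v) g xs (All.map (put-set-other T Y v) (∉⇒all≢ Y∉)))

  ∈⇒≤sumOver : ∀ T {Y : Subset n} {xs} → Y ∈ xs → T (encode-set Y) ≤ sumOver T (λ _ → 1) xs
  ∈⇒≤sumOver T {Y} {xs = X ∷ xs} (here refl) = ≤-trans (≤-reflexive (sym (*-identityʳ (T (encode-set Y))))) (m≤m+n _ _)
  ∈⇒≤sumOver T {xs = X ∷ xs} (there Y∈) = ≤-trans (∈⇒≤sumOver T Y∈) (m≤n+m _ _)

-- Reachable sets and the passage to the next level

module States {n : ℕ} (G : Graph n) (side : Fin n → Bool)
              (proper : ∀ u v → adj G u v ≡ true → side u ≢ side v) where

  -- X is a possible set of matched vertices after the vertices in done, a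
  -- subset of side false, have been matched.
  record Reachable (done X : Subset n) : Set where
    constructor reachable
    field
      agrees  : ∀ a → side a ≡ false → lookup X a ≡ lookup done a
      twice   : size X ≡ 2 * size done
      touched : ∀ b → side b ≡ true → lookup X b ≡ true → Σ[ a ∈ Fin n ] lookup done a ≡ true × adj G a b ≡ true

  reachable-insert : ∀ {done X a v} → side a ≡ false → lookup done a ≡ false → adj G a v ≡ true → lookup X v ≡ false →
                     Reachable done X → Reachable (insert a done) (insert a (insert v X))
  reachable-insert {done} {X} {a} {v} a-false a∉ av v∉ (reachable ag tw tou) = reachable agrees twice touched
    where
    a≢v : a ≢ v
    a≢v refl = proper a a av refl
    v-true : side v ≡ true
    v-true with side v in eq
    ... | true  = refl
    ... | false = ⊥-elim (proper a v av (trans a-false (sym eq)))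
    agrees : ∀ c → side c ≡ false → lookup (insert a (insert v X)) c ≡ lookup (insert a done) c
    agrees c c-false with c Fin.≟ a
    ... | yes refl = trans (lookup∘update c (insert v X) true) (sym (lookup∘update c done true))
    ... | no c≢a = trans (lookup∘update′ c≢a (insert v X) true)
      (trans (lookup∘update′ (λ c≡v → case trans (sym c-false) (trans (cong side c≡v) v-true) of λ ()) X true)
        (trans (ag c c-false) (sym (lookup∘update′ c≢a done true))))
    twice : size (insert a (insert v X)) ≡ 2 * size (insert a done)
    twice = trans (size-insert (insert v X) a (trans (lookup∘update′ a≢v X true) (trans (ag a a-false) a∉)))
      (trans (cong suc (trans (size-insert X v v∉) (cong suc tw)))
        (trans (lemma (size done)) (cong (2 *_) (sym (size-insert done a a∉)))))
      where
      lemma : ∀ k → suc (suc (2 * k)) ≡ 2 * suc k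
      lemma = solve-∀
    touched : ∀ b → side b ≡ true → lookup (insert a (insert v X)) b ≡ true →
              Σ[ c ∈ Fin n ] lookup (insert a done) c ≡ true × adj G c b ≡ true
    touched b b-true b∈ with b Fin.≟ v
    ... | yes refl = a , lookup∘update a done true , av
    ... | no b≢v with tou b b-true (trans (sym (lookup∘update′ b≢v X true)) (trans (sym (lookup∘update′ b≢a (insert v X) true)) b∈))
      where
      b≢a : b ≢ a
      b≢a b≡a = case trans (sym a-false) (trans (cong side (sym b≡a)) b-true) of λ ()
    ...   | c , c∈ , cb = c , lookup-insert , cb
      where
      lookup-insert : lookup (insert a done) c ≡ true
      lookup-insert with c Fin.≟ a
      ... | yes refl = lookup∘update c done true
      ... | no c≢a   = trans (lookup∘update′ c≢a done true) c∈

  -- The tables while the vertex a is being matched: T₀ is the old table of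
  -- numbers of ways, rest are the old states still to be extended, new is the
  -- list of extended states found so far, and pending and pendingMass are the
  -- contributions still to come.
  record Build (a : Fin n) (done : Subset n) (T₀ : ℕ → ℕ) (lo hi : ℕ) (rest : List (Subset n))
               (goal pending pendingMass : ℕ) (T Q : ℕ → ℕ) (top : ℕ) : Set where
    constructor build
    field
      restStack : Stack Q lo rest
      restBelow : lo + length rest ≤ hi
      new       : List (Subset n)
      unique    : Unique new
      states    : All (Reachable (insert a done)) new
      newStack  : Stack Q hi new
      top≡      : top ≡ hi + length new
      -- Old states lack `a` and new ones contain it, so a single table can be read for the old
      -- level while the new one is written.
      old       : ∀ Z → lookup Z a ≡ false → T (encode-set Z) ≡ T₀ (encode-set Z)
      support   : ∀ Z → lookup Z a ≡ true → T (encode-set Z) ≢ 0 → Z ∈ new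
      nonzero   : All (λ Z → T (encode-set Z) ≢ 0) new
      total     : pending + sumOver T (completions G) new ≡ goal
      -- A state has at most `n` extensions, so a level multiplies the sum of the entries by at most
      -- `n`. This keeps every entry, even during the updates, within the range of the machine.
      mass      : pendingMass + sumOver T (λ _ → 1) new ≤ n ^ suc (size done)

  module _ {a : Fin n} {done : Subset n} {T₀ : ℕ → ℕ} {lo hi : ℕ} {rest : List (Subset n)}
           {goal p m : ℕ} {T Q : ℕ → ℕ} {top : ℕ} where

    build-top : Build a done T₀ lo hi rest goal p m T Q top → top ≤ hi + 2 ^ n
    build-top b = ≤-trans (≤-reflexive top≡) (+-monoʳ-≤ hi (length≤2^n unique))
      where open Build b

    build-weaken : ∀ {p′ m′} → p′ ≡ p → m′ ≤ m → Build a done T₀ lo hi rest goal p m T Q top →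
                   Build a done T₀ lo hi rest goal p′ m′ T Q top
    build-weaken refl m′≤m (build rs rb nw u st ns t≡ o sp nz to ma) =
      build rs rb nw u st ns t≡ o sp nz to (≤-trans (+-monoˡ-≤ _ m′≤m) ma)

  module _ {a : Fin n} {done : Subset n} {T₀ : ℕ → ℕ} {lo hi : ℕ} {rest : List (Subset n)}
           {goal p m : ℕ} {T Q : ℕ → ℕ} {top : ℕ} {Y : Subset n} {t : ℕ} (t≢0 : t ≢ 0)
           (a∈Y : lookup Y a ≡ true) (state : Reachable (insert a done) Y)
           (b : Build a done T₀ lo hi rest goal (t * completions G Y + p) (t + m) T Q top) where

    private
      open Build b
      T′ : ℕ → ℕ
      T′ = put T (encode-set Y) (T (encode-set Y) + t)

      T′Y≢0 : T′ (encode-set Y) ≢ 0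
      T′Y≢0 eq = t≢0 (m+n≡0⇒n≡0 (T (encode-set Y)) (trans (sym (put-same T (encode-set Y) _)) eq))

      old′ : ∀ Z → lookup Z a ≡ false → T′ (encode-set Z) ≡ T₀ (encode-set Z)
      old′ Z a∉Z = trans (sym (put-set-other T Y _ {Z} λ Y≡Z →
        case trans (sym a∉Z) (trans (cong (λ W → lookup W a) (sym Y≡Z)) a∈Y) of λ ())) (old Z a∉Z)

      nonzero′ : ∀ {Z : Subset n} → T (encode-set Z) ≢ 0 → T′ (encode-set Z) ≢ 0
      nonzero′ {Z} TZ≢0 eq with encode-set Y ≟ encode-set Z
      ... | yes p = T′Y≢0 (trans (cong T′ p) eq)
      ... | no ¬p = TZ≢0 (trans (sym (put-other T _ ¬p)) eq)

      finish : ∀ {Q′ top′ new′} → Y ∈ new′ → (b′ : Build a done T₀ lo hi rest goal p m T′ Q′ top′) →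
               Build.new b′ ≡ new′ → T (encode-set Y) + t ≤ n ^ suc (size done)
      finish Y∈ b′ refl = ≤-trans (≤-reflexive (sym (put-same T (encode-set Y) _)))
        (≤-trans (∈⇒≤sumOver T′ Y∈) (≤-trans (m≤n+m _ m) (Build.mass b′)))

      regroup : ∀ x p s → p + (x + s) ≡ x + p + s
      regroup = solve-∀

    -- Listed states have nonzero entries, so an entry 0 shows that `Y` is not yet listed. The table
    -- itself thus decides what goes onto the stack, and the stack stays free of repetitions.
    push-new : T (encode-set Y) ≡ 0 →
               Build a done T₀ lo hi rest goal p m T′ (put Q top (encode-set Y)) (suc top) ×
               T (encode-set Y) + t ≤ n ^ suc (size done)
    push-new TY≡0 = b′ , finish (here refl) b′ refl
      where
      Y∉ : Y ∉ new
      Y∉ Y∈ = All.lookup nonzero Y∈ TY≡0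
      sum′ : ∀ g → sumOver T′ g (Y ∷ new) ≡ t * g Y + sumOver T g new
      sum′ g = cong₂ _+_ (cong (_* g Y) (trans (put-same T (encode-set Y) _) (cong (_+ t) TY≡0))) (sumOver-put-∉ T g _ new Y∉)
      top′ : hi + length new ≤ top
      top′ = ≤-reflexive (sym top≡)
      b′ : Build a done T₀ lo hi rest goal p m T′ (put Q top (encode-set Y)) (suc top)
      b′ = record
        { restStack = stack-put Q lo _ top rest (≤-trans restBelow (≤-trans (m≤m+n hi (length new)) top′)) restStack
        ; restBelow = restBelow
        ; new       = Y ∷ new
        ; unique    = ∉⇒all≢ Y∉ ∷ unique
        ; states    = state ∷ states
        ; newStack  = trans (cong (put Q top (encode-set Y)) (sym top≡)) (put-same Q top _) , stack-put Q hi _ top new top′ newStack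
        ; top≡      = trans (cong suc top≡) (sym (+-suc hi (length new)))
        ; old       = old′
        ; support   = λ Z a∈Z T′Z≢0 → case Vec.≡-dec Bool._≟_ Y Z of λ
            { (yes Y≡Z) → here (sym Y≡Z)
            ; (no Y≢Z)  → there (support Z a∈Z (T′Z≢0 ∘ trans (sym (put-set-other T Y _ {Z} Y≢Z)))) }
        ; nonzero   = T′Y≢0 ∷ All.map (λ {Z} → nonzero′ {Z}) nonzero
        ; total     = trans (cong (p +_) (sum′ (completions G))) (trans (regroup (t * completions G Y) p _) total)
        ; mass      = ≤-trans (≤-reflexive (trans (cong (m +_) (trans (sum′ (λ _ → 1)) (cong (_+ sumOver T (λ _ → 1) new) (*-identityʳ t))))
                        (regroup t m (sumOver T (λ _ → 1) new)))) mass
        }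

    push-old : T (encode-set Y) ≢ 0 →
               Build a done T₀ lo hi rest goal p m T′ Q top × T (encode-set Y) + t ≤ n ^ suc (size done)
    push-old TY≢0 = b′ , finish Y∈ b′ refl
      where
      Y∈ : Y ∈ new
      Y∈ = support Y a∈Y TY≢0
      b′ : Build a done T₀ lo hi rest goal p m T′ Q top
      b′ = record
        { restStack = restStack
        ; restBelow = restBelow
        ; new       = new
        ; unique    = unique
        ; states    = states
        ; newStack  = newStack
        ; top≡      = top≡
        ; old       = old′
        ; support   = λ Z a∈Z T′Z≢0 → case Vec.≡-dec Bool._≟_ Y Z of λ
            { (yes Y≡Z) → subst (_∈ new) Y≡Z Y∈
            ; (no Y≢Z)  → support Z a∈Z (T′Z≢0 ∘ trans (sym (put-set-other T Y _ {Z} Y≢Z))) }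
        ; nonzero   = All.map (λ {Z} → nonzero′ {Z}) nonzero
        ; total     = trans (cong (p +_) (sumOver-put-∈ T (completions G) t new unique Y∈)) (trans (regroup (t * completions G Y) p _) total)
        ; mass      = ≤-trans (≤-reflexive (trans (cong (m +_) (trans (sumOver-put-∈ T (λ _ → 1) t new unique Y∈) (cong (_+ sumOver T (λ _ → 1) new) (*-identityʳ t))))
                        (regroup t m (sumOver T (λ _ → 1) new)))) mass
        }

-- The program that counts

K : ℕ
K = 25

cAdj cComp cSide cU cV cW cCu cCv cFlip cRank cKey cAcc cCount cPow cTable cQueue cLo cTop cRound cA cHi cI cX cT cY : Fin K
cAdj = # 0
cComp = # 1
cSide = # 2
cU = # 3
cV = # 4
cW = # 5
cCu = # 6
cCv = # 7
cFlip = # 8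
cRank = # 9
cKey = # 10
cAcc = # 11
cCount = # 12
cPow = # 13
cTable = # 14
cQueue = # 15
cLo = # 16
cTop = # 17
cRound = # 18
cA = # 19
cHi = # 20
cI = # 21
cX = # 22
cT = # 23
cY = # 24

infixl 6 _⊕_ _⊝_
infixl 7 _⊛_ _⊘_

_⊕_ _⊝_ _⊛_ _⊘_ : Exp K → Exp K → Exp K
_⊕_ = bin add
_⊝_ = bin sub
_⊛_ = bin mul
_⊘_ = bin div

var : Fin K → Exp K
var x = rd x (lit 0)

set : Fin K → Exp K → Cmd K
set x e = wr x (lit 0) e

-- column 0 holds the input: the number n of vertices in cell 0, and the
-- adjacency of u to v in cell 1 + (u * n + v)
order : Exp K
order = rd cAdj (lit 0)

edge : Fin K → Fin K → Exp K
edge u v = rd cAdj (lit 1 ⊕ (var u ⊛ order ⊕ var v))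

-- As neither `v` nor `a` is in the set, adding two powers of 2 inserts them. The expression
-- `lit 1 ⊝ e` tests whether `e` is 0; in `pushC` the test precedes the update of the entry, which
-- would spoil it.
pushC treat tryC levelC : Cmd K
pushC =
  set cY (var cX ⊕ rd cPow (var cV) ⊕ rd cPow (var cA)) ▸
  when (lit 1 ⊝ rd cTable (var cY))
    (wr cQueue (var cTop) (var cY) ▸
     set cTop (var cTop ⊕ lit 1)) ▸
  wr cTable (var cY) (rd cTable (var cY) ⊕ var cT)
tryC =
  when (edge cA cV)
    (set cY (var cX ⊘ rd cPow (var cV)) ▸
     when (lit 1 ⊝ (var cY ⊝ var cY ⊘ lit 2 ⊛ lit 2)) pushC)
treat =
  -- The level is read from its top downwards, the order in which `Stack` lists its sets.
  set cX (rd cQueue (var cHi ⊝ lit 1 ⊝ var cI)) ▸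
  set cT (rd cTable (var cX)) ▸
  for cV order tryC
levelC =
  set cHi (var cTop) ▸
  for cI (var cHi ⊝ var cLo) treat ▸
  set cLo (var cHi)

-- Meant for commands without loops; the 0 for `for` is a mere default, and loops are charged
-- through `forWork`.
flat : Cmd K → ℕ
flat (wr a e f)  = sizeE e + (sizeE f + 4)
flat (c ▸ d)     = flat c + flat d
flat (when e c)  = sizeE e + (flat c + 2)
flat (for x e c) = 0

forWork : Exp K → ℕ → ℕ → ℕ
forWork e N w = sizeE e + (2 + N * (w + 4))

forWork-mono : ∀ e {N N′ w w′} → N ≤ N′ → w ≤ w′ → forWork e N w ≤ forWork e N′ w′
forWork-mono e N≤ w≤ = +-monoʳ-≤ (sizeE e) (+-monoʳ-≤ 2 (*-mono-≤ N≤ (+-monoˡ-≤ 4 w≤)))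

treatWork : ℕ → ℕ
treatWork n = flat (set cX (rd cQueue (var cHi ⊝ lit 1 ⊝ var cI))) +
              (flat (set cT (rd cTable (var cX))) + forWork order n (flat tryC))

levelWork : ℕ → ℕ → ℕ
levelWork n M = flat (set cHi (var cTop)) + (forWork (var cHi ⊝ var cLo) M (treatWork n) + flat (set cLo (var cHi)))

levelWork-mono : ∀ n {M M′} → M ≤ M′ → levelWork n M ≤ levelWork n M′
levelWork-mono n M≤ = +-monoʳ-≤ (flat (set cHi (var cTop)))
  (+-monoˡ-≤ (flat (set cLo (var cHi))) (forWork-mono (var cHi ⊝ var cLo) {w = treatWork n} M≤ ≤-refl))

-- The tail of the sum from index `k` on, that is, what a loop over the vertices still has to
-- contribute.
remaining : ∀ {n} → ℕ → (Fin n → ℕ) → ℕ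
remaining         zero    f = ∑ f
remaining {zero}  (suc k) f = 0
remaining {suc n} (suc k) f = remaining k (f ∘ suc)

remaining-step : ∀ {n} (f : Fin n → ℕ) v → remaining (toℕ v) f ≡ f v + remaining (suc (toℕ v)) f
remaining-step f zero    = refl
remaining-step f (suc v) = remaining-step (f ∘ suc) v

remaining-end : ∀ {n} (f : Fin n → ℕ) → remaining n f ≡ 0
remaining-end {zero}  f = refl
remaining-end {suc n} f = remaining-end (f ∘ suc)

n<2^n : ∀ n → n < 2 ^ n
n<2^n zero    = s≤s z≤n
n<2^n (suc n) = ≤-trans (+-mono-≤ (m^n>0 2 n) (n<2^n n)) (≤-reflexive (cong (2 ^ n +_) (sym (+-identityʳ (2 ^ n)))))

-- The term `n * n` makes room for table entries up to `n ^ n`, the rest for encoded sets, for the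
-- stacked levels of at most `2 ^ n` sets each, and for the literals. Being quadratic, it keeps the
-- bit lengths polynomial.
exponentV : ℕ → ℕ
exponentV n = n * n + (n + n + 8)

module Bounds (n V : ℕ) (V-large : 2 ^ exponentV n ≤ V) where

  pow≤V : ∀ {k} → k ≤ exponentV n → 2 ^ k ≤ V
  pow≤V p = ≤-trans (^-monoʳ-≤ 2 p) V-large

  8≤V : 8 ≤ V
  8≤V = ≤-trans (^-monoʳ-≤ 2 {3} {8} (s≤s (s≤s (s≤s z≤n)))) (pow≤V (≤-trans (m≤n+m 8 (n + n)) (m≤n+m _ (n * n))))

  linear≤V : ∀ {k} → k ≤ exponentV n → k ≤ V
  linear≤V {k} p = ≤-trans (<⇒≤ (n<2^n k)) (pow≤V p)

  cell< : ∀ (u v : Fin n) → suc (toℕ u * n + toℕ v) ≤ n * n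
  cell< u v = begin
    suc (toℕ u * n + toℕ v)  ≡⟨ sym (+-suc (toℕ u * n) (toℕ v)) ⟩
    toℕ u * n + suc (toℕ v)  ≤⟨ +-monoʳ-≤ (toℕ u * n) (toℕ<n v) ⟩
    toℕ u * n + n            ≡⟨ +-comm (toℕ u * n) n ⟩
    suc (toℕ u) * n          ≤⟨ *-monoˡ-≤ n (toℕ<n u) ⟩
    n * n                    ∎
    where open ≤-Reasoning

  n²≤V : n * n ≤ V
  n²≤V = linear≤V (m≤m+n (n * n) _)

  2^n≤V : 2 ^ n ≤ V
  2^n≤V = pow≤V (≤-trans (m≤m+n n (n + 8)) (≤-trans (≤-reflexive (sym (+-assoc n n 8))) (m≤n+m _ (n * n))))

  -- room for n + 2 levels in the queue
  queue≤V : ∀ {k} → k ≤ 2 + n → suc (k * 2 ^ n) ≤ V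
  queue≤V {k} k≤ = begin
    suc (k * 2 ^ n)            ≤⟨ +-mono-≤ (m^n>0 2 n) (*-monoˡ-≤ (2 ^ n) k≤) ⟩
    (3 + n) * 2 ^ n            ≤⟨ *-monoˡ-≤ (2 ^ n) (<⇒≤ (n<2^n (3 + n))) ⟩
    2 ^ (3 + n) * 2 ^ n        ≡⟨ sym (^-distribˡ-+-* 2 (3 + n) n) ⟩
    2 ^ (3 + n + n)            ≤⟨ pow≤V (≤-trans (≤-reflexive (trans (cong (3 +_) refl) (+-comm 3 (n + n))))
                                   (≤-trans (+-monoʳ-≤ (n + n) (s≤s (s≤s (s≤s z≤n)))) (m≤n+m (n + n + 8) (n * n)))) ⟩
    V                          ∎
    where open ≤-Reasoning

  n^n≤V : n ^ n ≤ V
  n^n≤V = begin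
    n ^ n          ≤⟨ ^-monoˡ-≤ n (<⇒≤ (n<2^n n)) ⟩
    (2 ^ n) ^ n    ≡⟨ ^-*-assoc 2 n n ⟩
    2 ^ (n * n)    ≤⟨ pow≤V (m≤m+n (n * n) _) ⟩
    V              ∎
    where open ≤-Reasoning

module Edge {n : ℕ} (G : Graph n) (base V : ℕ) (0<base : 0 < base) (base≤V : base ≤ V)
            (V-large : 2 ^ exponentV n ≤ V) where

  open Bounds n V V-large
  open Machine K base V 0<base base≤V 8≤V

  edge-eval : ∀ {σ} x y (u v : Fin n) → σ cAdj 0 ≡ n → (∀ u v → σ cAdj (suc (toℕ u * n + toℕ v)) ≡ ⟦ adj G u v ⟧) →
              σ x 0 ≡ toℕ u → σ y 0 ≡ toℕ v → eval σ (edge x y) ≡ ⟦ adj G u v ⟧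
  edge-eval {σ} x y u v en ea eu ev rewrite eu | ev | en = ea u v

  edge-fine : ∀ {σ} x y (u v : Fin n) → σ cAdj 0 ≡ n → σ x 0 ≡ toℕ u → σ y 0 ≡ toℕ v → Fine σ (edge x y)
  edge-fine {σ} x y u v en eu ev rewrite eu | ev | en =
    _ , ((_ , _ , ≤-trans (≤-trans (m≤m+n _ (toℕ v)) (<⇒≤ (cell< u v))) n²≤V) , _ ,
         ≤-trans (<⇒≤ (cell< u v)) n²≤V) , ≤-trans (cell< u v) n²≤V

-- Correctness of the commands for one level

module Count {n : ℕ} (G : Graph n) (side : Fin n → Bool)
             (proper : ∀ u v → adj G u v ≡ true → side u ≢ side v) (key : Fin n → ℕ)
             (base V : ℕ) (0<base : 0 < base) (base≤V : base ≤ V) (V-large : 2 ^ exponentV n ≤ V) where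

  open Bounds n V V-large
  open States G side proper
  open Machine K base V 0<base base≤V 8≤V
  open Edge G base V 0<base base≤V V-large

  Env : State K → Set
  Env σ = σ cAdj 0 ≡ n
        × (∀ u v → σ cAdj (suc (toℕ u * n + toℕ v)) ≡ ⟦ adj G u v ⟧)
        × (∀ v → σ cSide (toℕ v) ≡ ⟦ side v ⟧)
        × (∀ v → σ cKey (toℕ v) ≡ key v)
        × (∀ i → i ≤ n → σ cPow i ≡ 2 ^ i)

  module Level-step (a : Fin n) (done : Subset n) (side-a : side a ≡ false) (a∉done : lookup done a ≡ false)
                    (r lo hi goal : ℕ) (hi≤ : hi ≤ suc n * 2 ^ n) (T₀ : ℕ → ℕ) where

    Ctx : State K → Set
    Ctx σ = Env σ × σ cA 0 ≡ toℕ a × σ cRound 0 ≡ r × σ cLo 0 ≡ lo × σ cHi 0 ≡ hi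

    Building : List (Subset n) → ℕ → ℕ → State K → Set
    Building rest p m σ = Build a done T₀ lo hi rest goal p m (σ cTable) (σ cQueue) (σ cTop 0)

    size-insert≤n : suc (size done) ≤ n
    size-insert≤n = ≤-trans (≤-reflexive (sym (size-insert done a a∉done)))
      (≤-trans (∑-mono {n} {g = λ _ → 1} (λ v → ⟦⟧≤1 (lookup (insert a done) v)))
        (≤-reflexive (trans (∑-const n 1) (*-identityʳ n))))

    n^size≤V : n ^ suc (size done) ≤ V
    n^size≤V = ≤-trans (^-monoʳ-≤ n {{n≢0}} size-insert≤n) n^n≤V
      where
      n≢0 : NonZero n
      n≢0 = >-nonZero (≤-trans (s≤s z≤n) size-insert≤n)

    top-fits : ∀ {rest p m σ} → Building rest p m σ → σ cTop 0 + 1 ≤ V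
    top-fits {σ = σ} b = ≤-trans (≤-reflexive (+-comm (σ cTop 0) 1))
      (≤-trans (s≤s (≤-trans (build-top b) (≤-trans (+-monoˡ-≤ (2 ^ n) hi≤) (≤-reflexive (+-comm (suc n * 2 ^ n) (2 ^ n))))))
        (queue≤V ≤-refl))

    module _ (X : Subset n) (rest : List (Subset n)) (state : Reachable done X) (t : ℕ) (t≢0 : t ≢ 0) where

      VLoop : ℕ → ℕ → State K → Set
      VLoop p m σ = Ctx σ × σ cX 0 ≡ encode-set X × σ cT 0 ≡ t × Building rest p m σ

      push-triple : ∀ {v p m σ} → adj G a v ≡ true → lookup X v ≡ false → σ cV 0 ≡ toℕ v →
                    VLoop (t * completions G (insert a (insert v X)) + p) (t + m) σ →
                    Triple pushC σ (flat pushC) (VLoop p m)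
      push-triple {v} {p} {m} {σ} av v∉X ev (ctx@((en , ea , es , ek , ep) , eA , eR , eL , eH) , eX , eT , b) =
        t-seq (t-wr _ ((_ , _ , sum₁≤) , _ , sum₂≤)
          (t-seq (t-when _ (λ ≢0 → t-seq (t-wr _ _ (t-wr _ (_ , _ , top-fits {σ = σ} b) (new ≢0))))
                           (λ ≡0 → old ≡0))))
        where
        Y = insert a (insert v X)
        a≢v : a ≢ v
        a≢v refl = proper a a av refl
        a∉X : lookup X a ≡ false
        a∉X = trans (Reachable.agrees state a side-a) a∉done
        step₁ : σ cX 0 + σ cPow (σ cV 0) ≡ encode-set (insert v X)
        step₁ = trans (cong₂ _+_ eX (trans (cong (σ cPow) ev) (ep (toℕ v) (<⇒≤ (toℕ<n v))))) (encode-insert X v v∉X)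
        step₂ : σ cX 0 + σ cPow (σ cV 0) + σ cPow (σ cA 0) ≡ encode-set Y
        step₂ = trans (cong₂ _+_ step₁ (trans (cong (σ cPow) eA) (ep (toℕ a) (<⇒≤ (toℕ<n a)))))
          (encode-insert (insert v X) a (trans (lookup∘update′ a≢v X true) a∉X))
        sum₁≤ : σ cX 0 + σ cPow (σ cV 0) ≤ V
        sum₁≤ = ≤-trans (≤-reflexive step₁) (≤-trans (<⇒≤ (encode-set< (insert v X))) 2^n≤V)
        sum₂≤ : σ cX 0 + σ cPow (σ cV 0) + σ cPow (σ cA 0) ≤ V
        sum₂≤ = ≤-trans (≤-reflexive step₂) (≤-trans (<⇒≤ (encode-set< Y)) 2^n≤V)
        y = σ cX 0 + σ cPow (σ cV 0) + σ cPow (σ cA 0)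
        state′ : Reachable (insert a done) Y
        state′ = reachable-insert side-a a∉done av v∉X state
        last : ∀ {Q top} → (Build a done T₀ lo hi rest goal p m (put (σ cTable) (encode-set Y) (σ cTable (encode-set Y) + t)) Q top ×
                            σ cTable (encode-set Y) + t ≤ n ^ suc (size done)) →
               Build a done T₀ lo hi rest goal p m (put (σ cTable) y (σ cTable y + σ cT 0)) Q top × σ cTable y + σ cT 0 ≤ V
        last (b′ , le) rewrite step₂ | eT = b′ , ≤-trans le n^size≤V
        new : 1 ∸ σ cTable y ≢ 0 → Triple (wr cTable (var cY) (rd cTable (var cY) ⊕ var cT))
                (upd (upd (upd σ cY 0 y) cQueue (σ cTop 0) y) cTop 0 (σ cTop 0 + 1)) _ (VLoop p m)
        new ≢0 = t-wr _ (_ , _ , proj₂ pushed)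
          (((en , ea , es , ek , ep) , eA , eR , eL , eH) , eX , eT , proj₁ pushed)
          where
          pushed : Build a done T₀ lo hi rest goal p m (put (σ cTable) y (σ cTable y + σ cT 0)) (put (σ cQueue) (σ cTop 0) y) (σ cTop 0 + 1) ×
                   σ cTable y + σ cT 0 ≤ V
          pushed = last (subst₂ (λ z k → Build a done T₀ lo hi rest goal p m (put (σ cTable) (encode-set Y) (σ cTable (encode-set Y) + t))
                           (put (σ cQueue) (σ cTop 0) z) k × σ cTable (encode-set Y) + t ≤ n ^ suc (size done))
                           (sym step₂) (+-comm 1 (σ cTop 0))
                           (push-new t≢0 (lookup∘update a (insert v X) true) state′ b (zero? (σ cTable (encode-set Y)) (subst (λ z → 1 ∸ σ cTable z ≢ 0) step₂ ≢0))))
            where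
            zero? : ∀ k → 1 ∸ k ≢ 0 → k ≡ 0
            zero? zero          _ = refl
            zero? (suc zero)    p = ⊥-elim (p refl)
            zero? (suc (suc k)) p = ⊥-elim (p refl)
        old : 1 ∸ σ cTable y ≡ 0 → Triple (wr cTable (var cY) (rd cTable (var cY) ⊕ var cT)) (upd σ cY 0 y) _ (VLoop p m)
        old ≡0 = t-wr _ (_ , _ , proj₂ pushed)
          (((en , ea , es , ek , ep) , eA , eR , eL , eH) , eX , eT , proj₁ pushed)
          where
          pushed : Build a done T₀ lo hi rest goal p m (put (σ cTable) y (σ cTable y + σ cT 0)) (σ cQueue) (σ cTop 0) × σ cTable y + σ cT 0 ≤ V
          pushed = last (push-old t≢0 (lookup∘update a (insert v X) true) state′ b
            (λ Ty≡0 → case trans (sym (trans (cong (λ z → 1 ∸ σ cTable z) step₂) (cong (1 ∸_) Ty≡0))) ≡0 of λ ()))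

      try-triple : ∀ {v p m σ} → σ cV 0 ≡ toℕ v →
                   VLoop (t * remaining (toℕ v) (extend G a X) + p) ((n ∸ toℕ v) * t + m) σ →
                   Triple tryC σ (flat tryC)
                     (VLoop (t * remaining (suc (toℕ v)) (extend G a X) + p) ((n ∸ suc (toℕ v)) * t + m))
      try-triple {v} {p} {m} {σ} ev inv@(ctx@((en , ea , es , ek , ep) , eA , eR , eL , eH) , eX , eT , b) =
        t-when (edge-fine {σ} cA cV a v en eA ev)
          (λ ≢0 → t-seq (t-wr _ _ (t-when (_ , _ , (_ , _ , half≤))
            (λ ≢0′ → push-triple {v} (adjacent ≢0) (fresh ≢0′) ev
               (proj₁ inv , eX , eT , build-weaken (advance (adjacent ≢0) (fresh ≢0′)) mass-advance b))
            (λ ≡0′ → ctx , eX , eT , skip (stale⇒0 (stale ≡0′))))))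
          (λ ≡0 → ctx , eX , eT , skip (nonadjacent⇒0 (nonadjacent ≡0)))
        where
        f = extend G a X
        shift = encode-shift X v
        q = proj₁ shift
        y = apply div (σ cX 0) (σ cPow (σ cV 0))
        y≡ : y ≡ ⟦ lookup X v ⟧ + q * 2
        y≡ = trans (cong₂ (apply div) eX (trans (cong (σ cPow) ev) (ep (toℕ v) (<⇒≤ (toℕ<n v))))) (proj₂ shift)
        bit : y ∸ y / 2 * 2 ≡ ⟦ lookup X v ⟧
        bit = low-bit (lookup X v) q y≡
        half≤ : y / 2 * 2 ≤ V
        half≤ = ≤-trans (m/n*n≤m y 2) (apply-div≤ (σ cPow (σ cV 0))
                  (≤-trans (≤-reflexive eX) (≤-trans (<⇒≤ (encode-set< X)) 2^n≤V)))
        edge≡ = edge-eval {σ} cA cV a v en ea eA ev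
        true-if : ∀ {b} → ⟦ b ⟧ ≢ 0 → b ≡ true
        true-if {true}  _ = refl
        true-if {false} p = ⊥-elim (p refl)
        adjacent : eval σ (edge cA cV) ≢ 0 → adj G a v ≡ true
        adjacent ≢0 = true-if (λ eq → ≢0 (trans edge≡ eq))
        nonadjacent : eval σ (edge cA cV) ≡ 0 → adj G a v ≡ false
        nonadjacent ≡0 = ⟦⟧≡0 (trans (sym ≡0) edge≡)
        fresh : 1 ∸ (y ∸ y / 2 * 2) ≢ 0 → lookup X v ≡ false
        fresh ≢0 with lookup X v in eq
        ... | false = refl
        ... | true  = ⊥-elim (≢0 (cong (1 ∸_) (trans bit (cong ⟦_⟧ eq))))
        stale : 1 ∸ (y ∸ y / 2 * 2) ≡ 0 → lookup X v ≡ true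
        stale ≡0 with lookup X v in eq
        ... | true  = refl
        ... | false = case trans (sym (cong (1 ∸_) (trans bit (cong ⟦_⟧ eq)))) ≡0 of λ ()
        n∸v : n ∸ toℕ v ≡ suc (n ∸ suc (toℕ v))
        n∸v = +-∸-assoc 1 (toℕ<n v)
        mass-advance : t + ((n ∸ suc (toℕ v)) * t + m) ≤ (n ∸ toℕ v) * t + m
        mass-advance = ≤-reflexive (trans (sym (+-assoc t _ m)) (cong (λ k → k * t + m) (sym n∸v)))
        advance : adj G a v ≡ true → lookup X v ≡ false →
                  t * completions G (insert a (insert v X)) + (t * remaining (suc (toℕ v)) f + p) ≡ t * remaining (toℕ v) f + p
        advance av v∉X = trans (lemma t (completions G (insert a (insert v X))) (remaining (suc (toℕ v)) f) p)
          (cong (λ k → t * k + p) (trans (cong (_+ remaining (suc (toℕ v)) f) (sym f≡)) (sym (remaining-step f v))))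
          where
          lemma : ∀ t x y p → t * x + (t * y + p) ≡ t * (x + y) + p
          lemma = solve-∀
          f≡ : f v ≡ completions G (insert a (insert v X))
          f≡ = cong₂ when-true av (cong (λ c → when-true (not c) (completions G (insert a (insert v X)))) v∉X)
        stale⇒0 : lookup X v ≡ true → f v ≡ 0
        stale⇒0 eq rewrite eq with adj G a v
        ... | true  = refl
        ... | false = refl
        nonadjacent⇒0 : adj G a v ≡ false → f v ≡ 0
        nonadjacent⇒0 eq rewrite eq = refl
        skip : f v ≡ 0 → Building rest (t * remaining (suc (toℕ v)) f + p) ((n ∸ suc (toℕ v)) * t + m) σ
        skip f≡0 = build-weaken
          (cong (λ k → t * k + p) (sym (trans (remaining-step f v) (cong (_+ remaining (suc (toℕ v)) f) f≡0))))
          (≤-trans (m≤n+m _ t) mass-advance) b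

    module _ (current : List (Subset n)) (hi≡ : hi ≡ lo + length current) where

      -- The last component serves empty levels: there the loop ends with `k` still 0, and the next
      -- level is seen to be empty as well.
      QLoop : ℕ → State K → Set
      QLoop k σ = Ctx σ × Σ[ rest ∈ List (Subset n) ] length rest + k ≡ length current ×
        All (λ X → Reachable done X × T₀ (encode-set X) ≢ 0) rest ×
        Σ[ b ∈ Building rest (sumOver T₀ (completions G) rest) (n * sumOver T₀ (λ _ → 1) rest) σ ] (k ≡ 0 → Build.new b ≡ [])

      treat-triple : ∀ {k σ} → k < length current → QLoop k σ → Triple treat (upd σ cI 0 k) (treatWork n) (QLoop (suc k))
      treat-triple {k} {σ} k< (ctx , [] , len , _) = ⊥-elim (<⇒≢ k< len)
      treat-triple {k} {σ} k< (ctx@(env , eA , eR , eL , eH) , X ∷ rest , len , (state , t≢0) ∷ good , b , _) =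
        t-seq (t-wr _ _ (t-seq (t-wr _ _ (t-map (λ {σ′} → finish {σ′})
          (t-forFin (proj₁ env) _ (λ k → VLoop X rest state t t≢0 (t * remaining k f + p) ((n ∸ k) * t + m))
            (ctx , X≡ , t≡ , start)
            (λ {v} {σ′} inv → try-triple X rest state t t≢0 {v} {p} {m} {upd σ′ cV 0 (toℕ v)} refl inv))))))
        where
        open Build b
        t = T₀ (encode-set X)
        f = extend G a X
        p = sumOver T₀ (completions G) rest
        m = n * sumOver T₀ (λ _ → 1) rest
        a∉X : lookup X a ≡ false
        a∉X = trans (Reachable.agrees state a side-a) a∉done
        index : σ cHi 0 ∸ 1 ∸ k ≡ lo + length rest
        index = trans (cong (λ h → h ∸ 1 ∸ k) (trans eH (trans hi≡ (cong (lo +_) (sym len)))))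
          (trans (cong (λ z → z ∸ 1 ∸ k) (trans (sym (+-assoc lo (suc (length rest)) k)) (cong (_+ k) (+-suc lo (length rest)))))
            (m+n∸n≡m (lo + length rest) k))
        X≡ : σ cQueue (σ cHi 0 ∸ 1 ∸ k) ≡ encode-set X
        X≡ = trans (cong (σ cQueue) index) (proj₁ restStack)
        t≡ : σ cTable (σ cQueue (σ cHi 0 ∸ 1 ∸ k)) ≡ t
        t≡ = trans (cong (σ cTable) X≡) (old X a∉X)
        drop : ∀ {p m T Q top} → Build a done T₀ lo hi (X ∷ rest) goal p m T Q top → Build a done T₀ lo hi rest goal p m T Q top
        drop b = record
          { restStack = proj₂ B.restStack ; restBelow = ≤-trans (+-monoʳ-≤ lo (n≤1+n _)) B.restBelow
          ; new = B.new ; unique = B.unique ; states = B.states ; newStack = B.newStack ; top≡ = B.top≡ ; old = B.old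
          ; support = B.support ; nonzero = B.nonzero ; total = B.total ; mass = B.mass }
          where module B = Build b
        start : Building rest (t * remaining 0 f + p) (n * t + m) σ
        start = build-weaken (cong (λ k → t * k + p) (sym (completions-expand G a X a∉X)))
          (≤-reflexive (lemma n t (sumOver T₀ (λ _ → 1) rest))) (drop b)
          where
          lemma : ∀ n t s → n * t + n * s ≡ n * (t * 1 + s)
          lemma = solve-∀
        finish : ∀ {σ′} → VLoop X rest state t t≢0 (t * remaining n f + p) ((n ∸ n) * t + m) σ′ → QLoop (suc k) σ′
        finish (ctx , _ , _ , b) = ctx , rest , trans (+-suc (length rest) k) len , good ,
          build-weaken (cong (_+ p) (sym (trans (cong (t *_) (remaining-end f)) (*-zeroʳ t)))) (m≤n+m m _) b , λ ()

  -- The table is never cleared, so `inside` and `support` must tell the levels apart: the sets with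
  -- nonzero entries meet side false within `done`, and those that contain all of `done` are the
  -- current ones. The invariant `total` says that entries times completions always add up to the
  -- number sought. By `balanced`, a bound on the states is called for only when the sides have
  -- equal size.
  record Level (Balanced : Set) (goal : ℕ) (done : Subset n) (T Q : ℕ → ℕ) (lo top : ℕ) : Set where
    constructor level
    field
      current  : List (Subset n)
      unique   : Unique current
      states   : All (λ X → Reachable done X × T (encode-set X) ≢ 0) current
      stack    : Stack Q lo current
      top≡     : top ≡ lo + length current
      lo≤      : lo ≤ size done * 2 ^ n
      inside   : ∀ Z → T (encode-set Z) ≢ 0 → ∀ a → side a ≡ false → lookup Z a ≡ true → lookup done a ≡ true
      support  : ∀ Z → T (encode-set Z) ≢ 0 → (∀ a → side a ≡ false → lookup done a ≡ true → lookup Z a ≡ true) → Z ∈ current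
      total    : sumOver T (completions G) current ≡ goal
      mass     : sumOver T (λ _ → 1) current ≤ n ^ size done
      balanced : Balanced ⊎ current ≡ []

  AtLevel : Set → ℕ → ℕ → Subset n → State K → Set
  AtLevel Balanced goal r done σ = Env σ × σ cRound 0 ≡ r × Level Balanced goal done (σ cTable) (σ cQueue) (σ cLo 0) (σ cTop 0)

  level-triple : ∀ {Balanced goal r done a M σ} → side a ≡ false → lookup done a ≡ false → σ cA 0 ≡ toℕ a →
                 ((l : AtLevel Balanced goal r done σ) → length (Level.current (proj₂ (proj₂ l))) ≤ M) →
                 AtLevel Balanced goal r done σ → Triple levelC σ (levelWork n M) (AtLevel Balanced goal r (insert a done))
  level-triple {Balanced} {goal} {r} {done} {a} {M} {σ} side-a a∉ eA bound l₀@(env , eR , l) =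
    t-weaken (levelWork-mono n (bound l₀))
    (t-seq (t-wr _ _ (t-seq (t-map (λ {σ′} → finish {σ′}) (t-for {w = treatWork n} count _ (QLoop current top≡)
      ((env , eA , eR , refl , refl) , current , +-identityʳ _ , states , start , (λ _ → refl))
      (λ {k} {σ′} → treat-triple current top≡ {k} {σ′}))))))
    where
    open Level l
    lo = σ cLo 0
    hi = σ cTop 0
    hi≤ : hi ≤ suc (size done) * 2 ^ n
    hi≤ = ≤-trans (≤-reflexive (trans top≡ (+-comm lo _))) (+-mono-≤ (length≤2^n unique) lo≤)
    size≤n : size done ≤ n
    size≤n = ≤-trans (∑-mono {n} {g = λ _ → 1} (λ v → ⟦⟧≤1 (lookup done v))) (≤-reflexive (trans (∑-const n 1) (*-identityʳ n)))
    open Level-step a done side-a a∉ r lo hi goal (≤-trans hi≤ (*-monoˡ-≤ (2 ^ n) (s≤s size≤n))) (σ cTable)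
    count : hi ∸ lo ≡ length current
    count = trans (cong (_∸ lo) top≡) (m+n∸m≡n lo (length current))
    start : Building current (sumOver (σ cTable) (completions G) current) (n * sumOver (σ cTable) (λ _ → 1) current) σ
    start = record
      { restStack = stack ; restBelow = ≤-reflexive (sym top≡) ; new = [] ; unique = [] ; states = [] ; newStack = tt
      ; top≡ = sym (+-identityʳ hi) ; old = λ _ _ → refl
      ; support = λ Z a∈Z TZ≢0 → case trans (sym a∉) (inside Z TZ≢0 a side-a a∈Z) of λ ()
      ; nonzero = [] ; total = trans (+-identityʳ _) total
      ; mass = ≤-trans (≤-reflexive (+-identityʳ _)) (*-monoʳ-≤ n mass) }
    finish : ∀ {σ′} → QLoop current top≡ (length current) σ′ →
             Triple (set cLo (var cHi)) σ′ (flat (set cLo (var cHi))) (AtLevel Balanced goal r (insert a done))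
    finish {σ′} (_ , _ ∷ rest , len , _) = ⊥-elim (<⇒≢ (s≤s (m≤n+m (length current) (length rest))) (sym len))
    finish {σ′} ((env , _ , eR , eL , eH) , [] , _ , _ , b , empty) = t-wr _ _ (env , eR , next (σ′ cHi 0) eH)
      where
      module B = Build b
      inherit : ∀ {c} → lookup done c ≡ true → lookup (insert a done) c ≡ true
      inherit {c} c∈ with c Fin.≟ a
      ... | yes refl = lookup∘update c done true
      ... | no c≢a   = trans (lookup∘update′ c≢a done true) c∈
      split : ∀ Z → σ′ cTable (encode-set Z) ≢ 0 →
              (lookup Z a ≡ true × Z ∈ B.new) ⊎ (lookup Z a ≡ false × σ cTable (encode-set Z) ≢ 0)
      split Z TZ≢0 with lookup Z a in eq
      ... | true  = inj₁ (refl , B.support Z eq TZ≢0)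
      ... | false = inj₂ (refl , λ TZ≡0 → TZ≢0 (trans (B.old Z eq) TZ≡0))
      next : ∀ h → h ≡ hi → Level Balanced goal (insert a done) (σ′ cTable) (σ′ cQueue) h (σ′ cTop 0)
      next .hi refl = record
        { current = B.new ; unique = B.unique ; states = All.zip (B.states , B.nonzero) ; stack = B.newStack ; top≡ = B.top≡
        ; lo≤ = ≤-trans hi≤ (≤-reflexive (cong (_* 2 ^ n) (sym (size-insert done a a∉))))
        ; inside = λ Z TZ≢0 c side-c c∈Z → case split Z TZ≢0 of λ
            { (inj₁ (_ , Z∈)) → trans (sym (Reachable.agrees (All.lookup B.states Z∈) c side-c)) c∈Z
            ; (inj₂ (_ , TZ≢0)) → inherit (inside Z TZ≢0 c side-c c∈Z) }
        ; support = λ Z TZ≢0 covers → case split Z TZ≢0 of λ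
            { (inj₁ (_ , Z∈)) → Z∈
            ; (inj₂ (a∉Z , _)) → case trans (sym a∉Z) (covers a side-a (lookup∘update a done true)) of λ () }
        ; total = B.total
        ; mass = ≤-trans (≤-trans (m≤n+m _ (n * 0)) B.mass) (≤-reflexive (cong (n ^_) (sym (size-insert done a a∉))))
        ; balanced = case balanced of λ
            { (inj₁ bal) → inj₁ bal
            ; (inj₂ cur≡[]) → inj₂ (empty (cong length cur≡[])) } }

-- Balanced sides, and the run through all levels

lookup-ext : ∀ {n} {X Y : Subset n} → (∀ v → lookup X v ≡ lookup Y v) → X ≡ Y
lookup-ext {X = X} {Y} eq = trans (sym (Vec.tabulate∘lookup X)) (trans (Vec.tabulate-cong eq) (Vec.tabulate∘lookup Y))

matchings-empty : ∀ {n} (es : List (Fin n × Fin n)) → matchings es (replicate n false) ≡ 1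
matchings-empty {n} []             = cong ⟦_⟧ (isEmpty-true (replicate n false) λ w → lookup-replicate w false)
matchings-empty {n} ((u , v) ∷ es) = trans
  (cong (matchings es (replicate n false) +_) (grab-false {u = u} {grab v (matchings es)} {replicate n false} (lookup-replicate u false)))
  (trans (+-identityʳ _) (matchings-empty es))

sizeIn : ∀ {n} → (Fin n → Bool) → Subset n → ℕ
sizeIn p W = ∑ (λ v → ⟦ lookup W v ∧ p v ⟧)

sizeIn-⊖ : ∀ {n} (p : Fin n → Bool) u (W : Subset n) → lookup W u ≡ true → sizeIn p W ≡ ⟦ p u ⟧ + sizeIn p (u ⊖ W)
sizeIn-⊖ p zero    (true ∷ W) _  = refl
sizeIn-⊖ p (suc u) (b ∷ W)    eq = trans (cong (⟦ b ∧ p zero ⟧ +_) (sizeIn-⊖ (p ∘ suc) u W eq))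
  (lemma ⟦ b ∧ p zero ⟧ ⟦ p (suc u) ⟧ (sizeIn (p ∘ suc) (u ⊖ W)))
  where
  lemma : ∀ x y z → x + (y + z) ≡ y + (x + z)
  lemma = solve-∀

sizeIn-empty : ∀ {n} (p : Fin n → Bool) (W : Subset n) → isEmpty W ≡ true → sizeIn p W ≡ 0
sizeIn-empty p []          _  = refl
sizeIn-empty p (false ∷ W) eq = sizeIn-empty (p ∘ suc) W eq

-- Every edge of a matching removes one vertex from each side.
matchings⇒balanced : ∀ {n} (side : Fin n → Bool) (es : List (Fin n × Fin n)) → All (λ (u , v) → side u ≢ side v) es →
                     ∀ W → matchings es W ≢ 0 → sizeIn side W ≡ sizeIn (not ∘ side) W
matchings⇒balanced side [] [] W ≢0 with isEmpty W in eq
... | true  = trans (sizeIn-empty side W eq) (sym (sizeIn-empty (not ∘ side) W eq))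
... | false = ⊥-elim (≢0 refl)
matchings⇒balanced side ((u , v) ∷ es) (u≢v ∷ es≢) W ≢0 with matchings es W ≟ 0
... | no ≢0′ = matchings⇒balanced side es es≢ W ≢0′
... | yes ≡0 = go (lookup W u) (lookup (u ⊖ W) v) refl refl
  where
  edge≢0 : grabEdge (u , v) (matchings es) W ≢ 0
  edge≢0 eq = ≢0 (cong₂ _+_ ≡0 eq)
  go : ∀ b c → lookup W u ≡ b → lookup (u ⊖ W) v ≡ c → sizeIn side W ≡ sizeIn (not ∘ side) W
  go false c Wu Wv = ⊥-elim (edge≢0 (grab-false {u = u} {grab v (matchings es)} {W} Wu))
  go true false Wu Wv = ⊥-elim (edge≢0 (trans (grab-true {u = u} {grab v (matchings es)} {W} Wu) (grab-false {u = v} {matchings es} {u ⊖ W} Wv)))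
  go true true Wu Wv = begin
    sizeIn side W                                             ≡⟨ both side ⟩
    ⟦ side u ⟧ + (⟦ side v ⟧ + sizeIn side W′)                ≡⟨ cong (λ k → ⟦ side u ⟧ + (⟦ side v ⟧ + k)) IH ⟩
    ⟦ side u ⟧ + (⟦ side v ⟧ + sizeIn (not ∘ side) W′)        ≡⟨ flip (side u) (side v) u≢v _ ⟩
    ⟦ not (side u) ⟧ + (⟦ not (side v) ⟧ + sizeIn (not ∘ side) W′)  ≡⟨ sym (both (not ∘ side)) ⟩
    sizeIn (not ∘ side) W                                     ∎
    where
    open ≡-Reasoning
    W′ = v ⊖ u ⊖ W
    both : ∀ p → sizeIn p W ≡ ⟦ p u ⟧ + (⟦ p v ⟧ + sizeIn p W′)
    both p = trans (sizeIn-⊖ p u W Wu) (cong (⟦ p u ⟧ +_) (sizeIn-⊖ p v (u ⊖ W) Wv))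
    IH = matchings⇒balanced side es es≢ W′ λ eq → edge≢0
      (trans (grab-true {u = u} {grab v (matchings es)} {W} Wu) (trans (grab-true {u = v} {matchings es} {u ⊖ W} Wv) eq))
    flip : ∀ b c → b ≢ c → ∀ k → ⟦ b ⟧ + (⟦ c ⟧ + k) ≡ ⟦ not b ⟧ + (⟦ not c ⟧ + k)
    flip true  true  b≢c k = ⊥-elim (b≢c refl)
    flip true  false _ k = refl
    flip false true  _ k = refl
    flip false false b≢c k = ⊥-elim (b≢c refl)

sizeIn-full : ∀ {n} (p : Fin n → Bool) → sizeIn p (replicate n true) ≡ ∑ (λ v → ⟦ p v ⟧)
sizeIn-full p = sum-cong-≗ λ v → cong (λ b → ⟦ b ∧ p v ⟧) (lookup-replicate v true)

-- Nothing is sorted: each round runs through all vertices and treats those whose key is the number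
-- of the round, and keys are at most `n * n + n`. The tests rest on truncation: `x ⊝ y` and `y ⊝ x`
-- are both 0 only for equal `x` and `y`.
rounds balance pick : Exp K
rounds  = order ⊛ order ⊕ order ⊕ lit 1
balance = lit 1 ⊝ (var cCount ⊕ var cCount ⊝ order) ⊝ (order ⊝ (var cCount ⊕ var cCount))
pick    = lit 1 ⊝ rd cSide (var cA) ⊝ (rd cKey (var cA) ⊝ var cRound) ⊝ (var cRound ⊝ rd cKey (var cA))

startC stepC countC : Cmd K
startC = when balance (set cTop (lit 1) ▸ wr cTable (lit 0) (lit 1))
stepC  = when pick levelC
countC = startC ▸ for cRound rounds (for cA order stepC)

result : Exp K
result = rd cTable (rd cPow order ⊝ lit 1)

countWork : ℕ → ℕ → ℕ
countWork n M = flat startC + forWork rounds (n * n + n + 1) (forWork order n (sizeE pick + (levelWork n M + 2)))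

module Counting {n : ℕ} (G : Graph n) (side : Fin n → Bool)
                (proper : ∀ u v → adj G u v ≡ true → side u ≢ side v) (key : Fin n → ℕ) (key≤ : ∀ v → key v ≤ n * n + n)
                (base V : ℕ) (0<base : 0 < base) (base≤V : base ≤ V) (V-large : 2 ^ exponentV n ≤ V) where

  open Bounds n V V-large
  open States G side proper
  open Machine K base V 0<base base≤V 8≤V
  open Count G side proper key base V 0<base base≤V V-large

  -- the vertices whose level is over when vertex k is up in round r
  treated? : ℕ → ℕ → Fin n → Bool
  treated? r k a = not (side a) ∧ ((key a <ᵇ r) ∨ ((key a ≡ᵇ r) ∧ (toℕ a <ᵇ k)))

  treated : ℕ → ℕ → Subset n
  treated r k = Vec.tabulate (treated? r k)

  lookup-treated : ∀ r k a → lookup (treated r k) a ≡ treated? r k a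
  lookup-treated r k a = Vec.lookup∘tabulate (treated? r k) a

  <ᵇ-true : ∀ {i j} → i < j → (i <ᵇ j) ≡ true
  <ᵇ-true {i} {j} i<j = dec-true (i <? j) i<j

  <ᵇ-false : ∀ {i j} → i ≮ j → (i <ᵇ j) ≡ false
  <ᵇ-false {i} {j} i≮j = dec-false (i <? j) i≮j

  ∧-false : ∀ b → b ∧ false ≡ false
  ∧-false true  = refl
  ∧-false false = refl

  treated-start : treated 0 0 ≡ replicate n false
  treated-start = lookup-ext λ a → trans (lookup-treated 0 0 a) (trans (lemma (key a) (side a)) (sym (lookup-replicate a false)))
    where
    lemma : ∀ k s → not s ∧ ((k <ᵇ 0) ∨ ((k ≡ᵇ 0) ∧ false)) ≡ false
    lemma k s = trans (cong (not s ∧_) (∧-false (k ≡ᵇ 0))) (∧-false (not s))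

  treated-round : ∀ r → treated r n ≡ treated (suc r) 0
  treated-round r = lookup-ext λ a → trans (lookup-treated r n a) (trans (lemma a) (sym (lookup-treated (suc r) 0 a)))
    where
    lemma : ∀ a → treated? r n a ≡ treated? (suc r) 0 a
    lemma a rewrite <ᵇ-true (toℕ<n a) | ∧-false (key a ≡ᵇ suc r) with <-cmp (key a) r
    ... | tri< k<r _ _ rewrite <ᵇ-true k<r | <ᵇ-true (m≤n⇒m≤1+n k<r) = refl
    ... | tri≈ _ refl _ rewrite <ᵇ-false (<-irrefl {key a} refl) | ≡ᵇ-refl (key a) | <ᵇ-true (n<1+n (key a)) = refl
    ... | tri> k≮r k≢r r<k rewrite <ᵇ-false k≮r | ≢⇒≡ᵇ-false k≢r | <ᵇ-false (≤⇒≯ r<k) = refl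

  treated-other : ∀ r a → (side a ≡ true ⊎ key a ≢ r) → treated r (toℕ a) ≡ treated r (suc (toℕ a))
  treated-other r a idle = lookup-ext λ c → trans (lookup-treated r (toℕ a) c) (trans (lemma c) (sym (lookup-treated r (suc (toℕ a)) c)))
    where
    lemma : ∀ c → treated? r (toℕ a) c ≡ treated? r (suc (toℕ a)) c
    lemma c with <-cmp (toℕ c) (toℕ a)
    ... | tri< c<a _ _ rewrite <ᵇ-true c<a | <ᵇ-true (m≤n⇒m≤1+n c<a) = refl
    ... | tri> c≮a _ a<c rewrite <ᵇ-false c≮a | <ᵇ-false (≤⇒≯ a<c) = refl
    ... | tri≈ _ c≡a _ with toℕ-injective c≡a
    ...   | refl = own idle
      where
      own : side a ≡ true ⊎ key a ≢ r → treated? r (toℕ a) a ≡ treated? r (suc (toℕ a)) a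
      own (inj₁ p) rewrite p = refl
      own (inj₂ p) rewrite ≢⇒≡ᵇ-false p = refl

  treated-insert : ∀ a → side a ≡ false → insert a (treated (key a) (toℕ a)) ≡ treated (key a) (suc (toℕ a))
  treated-insert a side-a = lookup-ext λ c → trans (lemma c) (sym (lookup-treated (key a) (suc (toℕ a)) c))
    where
    lemma : ∀ c → lookup (insert a (treated (key a) (toℕ a))) c ≡ treated? (key a) (suc (toℕ a)) c
    lemma c with c Fin.≟ a
    ... | yes refl rewrite lookup∘update a (treated (key a) (toℕ a)) true | side-a | <ᵇ-false (<-irrefl {key a} refl)
                         | ≡ᵇ-refl (key a) | <ᵇ-true (n<1+n (toℕ a)) = refl
    ... | no c≢a rewrite lookup∘update′ c≢a (treated (key a) (toℕ a)) true | lookup-treated (key a) (toℕ a) c with <-cmp (toℕ c) (toℕ a)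
    ...   | tri< c<a _ _ rewrite <ᵇ-true c<a | <ᵇ-true (m≤n⇒m≤1+n c<a) = refl
    ...   | tri> c≮a _ a<c rewrite <ᵇ-false c≮a | <ᵇ-false (≤⇒≯ a<c) = refl
    ...   | tri≈ _ c≡a _ = ⊥-elim (c≢a (toℕ-injective c≡a))

  treated-fresh : ∀ a → lookup (treated (key a) (toℕ a)) a ≡ false
  treated-fresh a rewrite lookup-treated (key a) (toℕ a) a | <ᵇ-false (<-irrefl {key a} refl)
                        | <ᵇ-false (<-irrefl {toℕ a} refl) | ∧-false (key a ≡ᵇ key a) = ∧-false (not (side a))

  treated-all : ∀ a → side a ≡ false → lookup (treated (n * n + n + 1) 0) a ≡ true
  treated-all a side-a rewrite lookup-treated (n * n + n + 1) 0 a | side-a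
                             | <ᵇ-true (≤-trans (s≤s (key≤ a)) (≤-reflexive (+-comm 1 (n * n + n)))) = refl

  treated-side : ∀ r k a → lookup (treated r k) a ≡ true → side a ≡ false
  treated-side r k a eq with trans (sym (lookup-treated r k a)) eq
  ... | p with side a
  ...   | false = refl

  Sorted : Subset n → Set
  Sorted done = ∀ a c → lookup done a ≡ true → lookup done c ≡ false → side c ≡ false → key a ≤ key c

  treated-sorted : ∀ r k → Sorted (treated r k)
  treated-sorted r k a c a∈ c∉ side-c = ≤-trans (upper (side a) (trans (sym (lookup-treated r k a)) a∈))
    (lower (trans (sym (lookup-treated r k c)) c∉))
    where
    upper : ∀ s → not s ∧ ((key a <ᵇ r) ∨ ((key a ≡ᵇ r) ∧ (toℕ a <ᵇ k))) ≡ true → key a ≤ r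
    upper false eq with <-cmp (key a) r
    ... | tri< k<r _ _ = <⇒≤ k<r
    ... | tri≈ _ k≡r _ = ≤-reflexive k≡r
    ... | tri> k≮r k≢r _ rewrite <ᵇ-false k≮r | ≢⇒≡ᵇ-false k≢r = case eq of λ ()
    lower : treated? r k c ≡ false → r ≤ key c
    lower eq with key c <? r
    ... | no ≮ = ≮⇒≥ ≮
    ... | yes k<r rewrite side-c | <ᵇ-true k<r = case eq of λ ()

  Within : Set → ℕ → Set
  Within Balanced M = ∀ done → (∀ a → lookup done a ≡ true → side a ≡ false) → Sorted done →
                      ∀ xs → Unique xs → All (Reachable done) xs → Balanced → length xs ≤ M

  goal : ℕ
  goal = matchings (edges G) (replicate n true)

  module _ (p : ℕ) (p≡ : p ≡ ∑ (λ v → ⟦ not (side v) ⟧)) where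

    Balanced : Set
    Balanced = p + p ≡ n

    unbalanced⇒goal≡0 : ¬ Balanced → goal ≡ 0
    unbalanced⇒goal≡0 ¬bal with goal ≟ 0
    ... | yes eq = eq
    ... | no ≢0  = ⊥-elim (¬bal (begin
      p + p                                                 ≡⟨ cong₂ _+_ p≡ p≡ ⟩
      ∑ (λ v → ⟦ not (side v) ⟧) + ∑ (λ v → ⟦ not (side v) ⟧)  ≡⟨ cong (∑ (λ v → ⟦ not (side v) ⟧) +_) (sym equal-sides) ⟩
      ∑ (λ v → ⟦ not (side v) ⟧) + ∑ (λ v → ⟦ side v ⟧)        ≡⟨ sym (∑-distrib-+ (λ v → ⟦ not (side v) ⟧) (λ v → ⟦ side v ⟧)) ⟩
      ∑ (λ v → ⟦ not (side v) ⟧ + ⟦ side v ⟧)                  ≡⟨ sum-cong-≗ (λ v → one (side v)) ⟩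
      ∑ {n} (λ v → 1)                                       ≡⟨ trans (∑-const n 1) (*-identityʳ n) ⟩
      n                                                     ∎))
      where
      open ≡-Reasoning
      one : ∀ b → ⟦ not b ⟧ + ⟦ b ⟧ ≡ 1
      one true  = refl
      one false = refl
      T⇒true : ∀ {b} → T b → b ≡ true
      T⇒true {true} _ = refl
      edges-proper : All (λ (u , v) → side u ≢ side v) (edges G)
      edges-proper = All.map (λ { {u , v} (_ , uv) → proper u v (T⇒true uv) })
        (all-filter (λ (u , v) → (u Fin.<? v) ×-dec T? (adj G u v)) (cartesianProduct (allFin n) (allFin n)))
      equal-sides : ∑ (λ v → ⟦ side v ⟧) ≡ ∑ (λ v → ⟦ not (side v) ⟧)
      equal-sides = trans (sym (sizeIn-full side)) (trans (matchings⇒balanced side (edges G) edges-proper (replicate n true) ≢0)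
        (sizeIn-full (not ∘ side)))

    Done : Subset n → State K → Set
    Done done σ = Env σ × Level Balanced goal done (σ cTable) (σ cQueue) (σ cLo 0) (σ cTop 0)

    p≤n : p ≤ n
    p≤n = ≤-trans (≤-reflexive p≡) (≤-trans (∑-mono {n} {g = λ _ → 1} (λ v → ⟦⟧≤1 (not (side v)))) (≤-reflexive (trans (∑-const n 1) (*-identityʳ n))))

    start-triple : ∀ {σ} → Env σ → σ cCount 0 ≡ p → (∀ i → σ cTable i ≡ 0) → σ cQueue 0 ≡ 0 → σ cLo 0 ≡ 0 → σ cTop 0 ≡ 0 →
                   Triple startC σ (flat startC) (Done (treated 0 0))
    start-triple {σ} env@(en , _) eC eT eQ eL eTop = t-when ((_ , (_ , _ , 2p≤V) , _) , _ , (_ , _ , 2p≤V))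
      (λ ≢0 → t-seq (t-wr _ _ (t-wr _ _ (env , singleton (balanced-if ≢0)))))
      (λ ≡0 → env , nothing (λ bal → absurd bal ≡0))
      where
      2p≤V : σ cCount 0 + σ cCount 0 ≤ V
      2p≤V = ≤-trans (+-mono-≤ (≤-trans (≤-reflexive eC) p≤n) (≤-trans (≤-reflexive eC) p≤n))
        (linear≤V (≤-trans (m≤m+n (n + n) 8) (m≤n+m _ (n * n))))
      eval≡ : eval σ balance ≡ 1 ∸ (p + p ∸ n) ∸ (n ∸ (p + p))
      eval≡ = cong₂ (λ c k → 1 ∸ (c + c ∸ k) ∸ (k ∸ (c + c))) eC en
      balanced-if : eval σ balance ≢ 0 → Balanced
      balanced-if ≢0 with <-cmp (p + p) n
      ... | tri≈ _ eq _ = eq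
      ... | tri< lt _ _ = ⊥-elim (≢0 (trans eval≡ (m≤n⇒m∸n≡0 (≤-trans (m∸n≤m 1 (p + p ∸ n)) (m<n⇒0<n∸m lt)))))
      ... | tri> _ _ gt = ⊥-elim (≢0 (trans eval≡ (trans (cong (_∸ (n ∸ (p + p))) (m≤n⇒m∸n≡0 (m<n⇒0<n∸m gt))) (0∸n≡0 (n ∸ (p + p))))))
      absurd : Balanced → eval σ balance ≢ 0
      absurd bal ≡0 = case trans (sym (trans eval≡ (cong₂ (λ x y → 1 ∸ x ∸ y) (m≤n⇒m∸n≡0 (≤-reflexive bal)) (m≤n⇒m∸n≡0 (≤-reflexive (sym bal)))))) ≡0 of λ ()
      empty∈ : ∀ {Z : Subset n} → put (σ cTable) 0 1 (encode-set Z) ≢ 0 → Z ≡ replicate n false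
      empty∈ {Z} ≢0 with encode-set Z ≟ 0
      ... | yes eq = encode-set-injective Z (replicate n false) (trans eq (sym (encode-empty n)))
      ... | no neq = ⊥-elim (≢0 (trans (put-other (σ cTable) 1 (≢-sym neq)) (eT _)))
      ∁-empty : ∁ (replicate n false) ≡ replicate n true
      ∁-empty = Vec.map-replicate not false n
      size-start : size (treated 0 0) ≡ 0
      size-start = trans (cong size treated-start) (size-empty n)
      one : put (σ cTable) 0 1 (encode-set (replicate n false)) ≡ 1
      one = trans (cong (put (σ cTable) 0 1) (encode-empty n)) (put-same (σ cTable) 0 1)
      singleton : Balanced → Level Balanced goal (treated 0 0) (put (σ cTable) 0 1) (σ cQueue) (σ cLo 0) 1
      singleton bal = record
        { current = replicate n false ∷ []
        ; unique = [] ∷ []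
        ; states = (reachable (λ a _ → cong (λ X → lookup X a) (sym treated-start))
                      (trans (size-empty n) (cong (2 *_) (sym size-start)))
                      (λ b _ b∈ → case trans (sym (lookup-replicate b false)) b∈ of λ ()) ,
                    λ ≡0 → case trans (sym one) ≡0 of λ ()) ∷ []
        ; stack = trans (cong (σ cQueue) (trans (+-identityʳ _) eL)) (trans eQ (sym (encode-empty n))) , tt
        ; top≡ = cong (_+ 1) (sym eL)
        ; lo≤ = ≤-trans (≤-reflexive eL) z≤n
        ; inside = λ Z ≢0 a _ a∈Z → case trans (sym (lookup-replicate a false)) (trans (cong (λ X → lookup X a) (sym (empty∈ {Z} ≢0))) a∈Z) of λ ()
        ; support = λ Z ≢0 _ → here (empty∈ {Z} ≢0)
        ; total = trans (+-identityʳ _) (trans (cong (_* completions G (replicate n false)) one)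
            (trans (*-identityˡ _) (cong (matchings (edges G)) ∁-empty)))
        ; mass = ≤-reflexive (trans (cong (λ k → k * 1 + 0) one) (cong (n ^_) (sym size-start)))
        ; balanced = inj₁ bal }
      nothing : ¬ Balanced → Level Balanced goal (treated 0 0) (σ cTable) (σ cQueue) (σ cLo 0) (σ cTop 0)
      nothing ¬bal = record
        { current = [] ; unique = [] ; states = [] ; stack = tt
        ; top≡ = trans eTop (sym (trans (+-identityʳ _) eL))
        ; lo≤ = ≤-trans (≤-reflexive eL) z≤n
        ; inside = λ Z ≢0 → ⊥-elim (≢0 (eT _)) ; support = λ Z ≢0 → ⊥-elim (≢0 (eT _))
        ; total = sym (unbalanced⇒goal≡0 ¬bal) ; mass = z≤n ; balanced = inj₂ refl }

    count-triple : ∀ {M σ} → Within Balanced M →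
                   Env σ → σ cCount 0 ≡ p → (∀ i → σ cTable i ≡ 0) → σ cQueue 0 ≡ 0 → σ cLo 0 ≡ 0 → σ cTop 0 ≡ 0 →
                   Triple countC σ (countWork n M) (Done (treated (n * n + n + 1) 0))
    count-triple {M} {σ} within env eC eT eQ eL eTop =
      t-seq (t-map outer (start-triple env eC eT eQ eL eTop))
      where
      step : ∀ {r a σ} → σ cA 0 ≡ toℕ a → AtLevel Balanced goal r (treated r (toℕ a)) σ →
             Triple stepC σ (sizeE pick + (levelWork n M + 2)) (AtLevel Balanced goal r (treated r (suc (toℕ a))))
      step {r} {a} {σ} eA l@((en , ea , es , ek , ep) , eR , lev) = t-when _ picked skipped
        where
        eval≡ : eval σ pick ≡ 1 ∸ ⟦ side a ⟧ ∸ (key a ∸ r) ∸ (r ∸ key a)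
        eval≡ rewrite eA | eR | es a | ek a = refl
        picked : eval σ pick ≢ 0 → Triple levelC σ (levelWork n M) (AtLevel Balanced goal r (treated r (suc (toℕ a))))
        picked ≢0 with side a in side-a | <-cmp (key a) r
        ... | true | _ = ⊥-elim (≢0 (trans eval≡ (trans (cong (λ b → 1 ∸ ⟦ b ⟧ ∸ (key a ∸ r) ∸ (r ∸ key a)) side-a)
                (trans (cong (_∸ (r ∸ key a)) (0∸n≡0 (key a ∸ r))) (0∸n≡0 (r ∸ key a))))))
        ... | false | tri< lt _ _ = ⊥-elim (≢0 (trans eval≡ (m≤n⇒m∸n≡0 (≤-trans (m∸n≤m _ (key a ∸ r)) (≤-trans (m∸n≤m 1 ⟦ side a ⟧) (m<n⇒0<n∸m lt))))))
        ... | false | tri> _ _ gt = ⊥-elim (≢0 (trans eval≡ (trans (cong (_∸ (r ∸ key a)) (m≤n⇒m∸n≡0 (≤-trans (m∸n≤m 1 ⟦ side a ⟧) (m<n⇒0<n∸m gt)))) (0∸n≡0 (r ∸ key a)))))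
        ... | false | tri≈ _ refl _ = subst (λ done → Triple levelC σ (levelWork n M) (AtLevel Balanced goal (key a) done)) (treated-insert a side-a)
          (level-triple side-a (treated-fresh a) eA bound l)
          where
          bound : (l : AtLevel Balanced goal (key a) (treated (key a) (toℕ a)) σ) → length (Level.current (proj₂ (proj₂ l))) ≤ M
          bound (_ , _ , lev) with Level.balanced lev
          ... | inj₁ bal = within (treated (key a) (toℕ a)) (treated-side (key a) (toℕ a)) (treated-sorted (key a) (toℕ a))
                 (Level.current lev) (Level.unique lev) (All.map proj₁ (Level.states lev)) bal
          ... | inj₂ eq = ≤-trans (≤-reflexive (cong length eq)) z≤n
        skipped : eval σ pick ≡ 0 → AtLevel Balanced goal r (treated r (suc (toℕ a))) σ
        skipped ≡0 = subst (λ done → AtLevel Balanced goal r done σ) (treated-other r a idle) l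
          where
          idle : side a ≡ true ⊎ key a ≢ r
          idle with side a in side-a
          ... | true  = inj₁ refl
          ... | false = inj₂ λ { refl → case trans (sym (trans eval≡ (trans (cong (λ b → 1 ∸ ⟦ b ⟧ ∸ (key a ∸ key a) ∸ (key a ∸ key a)) side-a)
                          (cong (λ z → 1 ∸ z ∸ z) (n∸n≡0 (key a)))))) ≡0 of λ () }
      rounds-eval : ∀ {σ} → Env σ → eval σ rounds ≡ n * n + n + 1
      rounds-eval (en , _) = cong (λ k → k * k + k + 1) en
      rounds≤V : n * n + n + 1 ≤ V
      rounds≤V = linear≤V (≤-trans (≤-reflexive (+-assoc (n * n) n 1)) (+-monoʳ-≤ (n * n) (+-mono-≤ (m≤m+n n n) (s≤s z≤n))))
      rounds-fine : ∀ {σ} → Env σ → Fine σ rounds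
      rounds-fine {σ} (en , _) rewrite en =
        (( _ , _ , n²≤V) , _ , ≤-trans (m≤m+n (n * n + n) 1) rounds≤V) , _ , rounds≤V
      outer : ∀ {σ} → Done (treated 0 0) σ → Triple (for cRound rounds (for cA order stepC)) σ
                (forWork rounds (n * n + n + 1) (forWork order n (sizeE pick + (levelWork n M + 2)))) (Done (treated (n * n + n + 1) 0))
      outer {σ} d@(env , _) = t-for (rounds-eval {σ} env) (rounds-fine {σ} env) (λ r → Done (treated r 0)) d
        λ { {r} {σ′} _ (env′ , lev′) → t-map (λ { (e , _ , l) → e , subst (λ done → Level Balanced goal done _ _ _ _) (treated-round r) l })
              (t-forFin {w = sizeE pick + (levelWork n M + 2)} (proj₁ env′) _ (λ k → AtLevel Balanced goal r (treated r k)) (env′ , refl , lev′)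
                (λ {v} {σ″} l → step {r} {v} {upd σ″ cA 0 (toℕ v)} refl l)) }

    -- In the last level all of side false is matched, so an unmatched vertex has no unmatched
    -- neighbour. Hence only the full set has a completion, namely the empty one, and `total`
    -- reduces to its entry.
    result-correct : ∀ {σ} → Done (treated (n * n + n + 1) 0) σ → eval σ result ≡ goal
    result-correct {σ} ((en , _ , _ , _ , ep) , lev) = trans (cong (σ cTable) index) answer
      where
      open Level lev
      full = replicate n true
      τ = σ cTable
      index : σ cPow (σ cAdj 0) ∸ 1 ≡ encode-set full
      index = trans (cong (_∸ 1) (trans (cong (σ cPow) en) (ep n ≤-refl))) (sym (encode-full n))
      completions-full : completions G full ≡ 1
      completions-full = trans (cong (matchings (edges G)) (Vec.map-replicate not true n)) (matchings-empty (edges G))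
      -- every vertex outside a state of the last level is on side true
      stuck : ∀ X → Reachable (treated (n * n + n + 1) 0) X → X ≢ full → completions G X ≡ 0
      stuck X state X≢full = case Fin.any? (λ b → lookup X b Bool.≟ false) of λ
        { (yes (b , b∉X)) → trans (completions-expand G b X b∉X) (trans (sum-cong-≗ (λ v → dead b b∉X v)) (∑-zero n))
        ; (no all∈) → ⊥-elim (X≢full (lookup-ext λ v → trans (¬false⇒true (λ v∉ → all∈ (v , v∉))) (sym (lookup-replicate v true)))) }
        where
        ¬false⇒true : ∀ {b} → b ≢ false → b ≡ true
        ¬false⇒true {true}  _ = refl
        ¬false⇒true {false} p = ⊥-elim (p refl)
        member : ∀ a → side a ≡ false → lookup X a ≡ true
        member a side-a = trans (Reachable.agrees state a side-a) (treated-all a side-a)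
        dead : ∀ b → lookup X b ≡ false → ∀ v → extend G b X v ≡ 0
        dead b b∉X v with adj G b v in bv
        ... | false = refl
        ... | true with side v in side-v
        ...   | false rewrite member v side-v = refl
        ...   | true = ⊥-elim (proper b v bv (trans side-b (sym side-v)))
          where
          side-b : side b ≡ true
          side-b with side b in eq
          ... | true  = refl
          ... | false = case trans (sym b∉X) (member b eq) of λ ()
      absent : ∀ xs → All (Reachable (treated (n * n + n + 1) 0)) xs → All (full ≢_) xs → sumOver τ (completions G) xs ≡ 0
      absent []       []       []       = refl
      absent (X ∷ xs) (s ∷ ss) (X≢ ∷ ≢s) = cong₂ _+_ (trans (cong (τ (encode-set X) *_) (stuck X s (≢-sym X≢))) (*-zeroʳ (τ (encode-set X)))) (absent xs ss ≢s)
      present : ∀ xs → Unique xs → All (Reachable (treated (n * n + n + 1) 0)) xs → full ∈ xs →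
                sumOver τ (completions G) xs ≡ τ (encode-set full)
      present (.full ∷ xs) (X≢ ∷ u) (_ ∷ ss) (here refl) = trans (cong₂ _+_ (trans (cong (τ (encode-set full) *_) completions-full) (*-identityʳ _)) (absent xs ss X≢)) (+-identityʳ _)
      present (X ∷ xs) (X≢ ∷ u) (s ∷ ss) (there full∈) = trans (cong (_+ sumOver τ (completions G) xs)
        (trans (cong (τ (encode-set X) *_) (stuck X s (All.lookup X≢ full∈))) (*-zeroʳ (τ (encode-set X))))) (present xs u ss full∈)
      answer : τ (encode-set full) ≡ goal
      answer with τ (encode-set full) ≟ 0
      ... | no ≢0 = trans (sym (present current unique (All.map proj₁ states) (support full ≢0 (λ a _ _ → lookup-replicate a true)))) total
      ... | yes ≡0 = trans ≡0 (sym (trans (sym total) (absent current (All.map proj₁ states) (∉⇒all≢ λ full∈ → proj₂ (All.lookup states full∈) ≡0))))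

-- The number of states in a level

module Ranks {n : ℕ} (G : Graph n) where

  deg : Fin n → ℕ
  deg v = ∑ (λ u → ⟦ adj G v u ⟧)

  deg≤n : ∀ v → deg v ≤ n
  deg≤n v = ≤-trans (∑-mono {n} {g = λ _ → 1} (λ u → ⟦⟧≤1 (adj G v u))) (≤-reflexive (trans (∑-const n 1) (*-identityʳ n)))

  -- distinct positive numbers, decreasing with the degree
  rank : Fin n → ℕ
  rank b = n * (n ∸ deg b) + toℕ b + 1

  0<rank : ∀ b → 0 < rank b
  0<rank b = ≤-trans (s≤s z≤n) (≤-reflexive (+-comm 1 _))

  rank≤ : ∀ b → rank b ≤ n * n + n
  rank≤ b = ≤-trans (≤-reflexive (trans (+-assoc _ (toℕ b) 1) (cong (n * (n ∸ deg b) +_) (+-comm (toℕ b) 1))))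
    (+-mono-≤ (*-monoʳ-≤ n (m∸n≤m n (deg b))) (toℕ<n b))

  rank-injective : ∀ {b c} → rank b ≡ rank c → b ≡ c
  rank-injective {b} {c} eq = toℕ-injective (trans (sym (mod b)) (trans (cong (_% n) (+-cancelʳ-≡ 1 _ _ eq)) (mod c)))
    where
    instance
      n≢0 : NonZero n
      n≢0 = >-nonZero (≤-trans (s≤s z≤n) (toℕ<n b))
    mod : ∀ v → (n * (n ∸ deg v) + toℕ v) % n ≡ toℕ v
    mod v = trans (cong (_% n) (trans (+-comm _ (toℕ v)) (cong (toℕ v +_) (*-comm n (n ∸ deg v)))))
      (trans ([m+kn]%n≡m%n (toℕ v) (n ∸ deg v) n) (m<n⇒m%n≡m (toℕ<n v)))

  rank-antitone : ∀ {b c} → rank b < rank c → deg c ≤ deg b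
  rank-antitone {b} {c} lt with deg c ≤? deg b
  ... | yes p = p
  ... | no ¬p = ⊥-elim (<⇒≱ lt (+-monoˡ-≤ 1 (begin
    n * (n ∸ deg c) + toℕ c   ≤⟨ +-monoʳ-≤ (n * (n ∸ deg c)) (<⇒≤ (toℕ<n c)) ⟩
    n * (n ∸ deg c) + n       ≡⟨ trans (+-comm _ n) (sym (*-suc n (n ∸ deg c))) ⟩
    n * suc (n ∸ deg c)       ≤⟨ *-monoʳ-≤ n (∸-monoʳ-< (≰⇒> ¬p) (deg≤n c)) ⟩
    n * (n ∸ deg b)           ≤⟨ m≤m+n _ (toℕ b) ⟩
    n * (n ∸ deg b) + toℕ b   ∎)))
    where open ≤-Reasoning

<⇒<ᵇ≡true : ∀ {i j} → i < j → (i <ᵇ j) ≡ true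
<⇒<ᵇ≡true {i} {j} p = dec-true (i <? j) p

<ᵇ≡true⇒< : ∀ {i j} → (i <ᵇ j) ≡ true → i < j
<ᵇ≡true⇒< {i} {j} eq = <ᵇ⇒< i j (subst T (sym eq) tt)

<ᵇ≡false⇒≥ : ∀ {i j} → (i <ᵇ j) ≡ false → j ≤ i
<ᵇ≡false⇒≥ {i} {j} eq = ≮⇒≥ λ p → case trans (sym (<⇒<ᵇ≡true p)) eq of λ ()

∑-≥ : ∀ {n} (f : Fin n → ℕ) v → f v ≤ ∑ f
∑-≥ f zero    = m≤m+n _ _
∑-≥ f (suc v) = ≤-trans (∑-≥ (f ∘ suc) v) (m≤n+m _ (f zero))

∑-unique≤1 : ∀ {n} (p : Fin n → Bool) → (∀ u v → p u ≡ true → p v ≡ true → u ≡ v) → ∑ (λ v → ⟦ p v ⟧) ≤ 1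
∑-unique≤1 {zero}  p uniq = z≤n
∑-unique≤1 {suc n} p uniq with p zero in eq
... | false = ∑-unique≤1 (p ∘ suc) λ u v pu pv → Fin.suc-injective (uniq (suc u) (suc v) pu pv)
... | true  = s≤s (≤-trans (∑-mono {n} {g = λ _ → 0} (λ v → ≤-reflexive (lemma v (p (suc v)) refl))) (≤-reflexive (∑-zero n)))
  where
  lemma : ∀ v b → p (suc v) ≡ b → ⟦ b ⟧ ≡ 0
  lemma v false _ = refl
  lemma v true q  = case uniq zero (suc v) eq q of λ ()

least-from : (P : ℕ → Set) → Decidable P → ∀ k → P (suc k) → Σ[ i ∈ ℕ ] P (suc i) × (i ≡ 0 ⊎ ¬ P i)
least-from P P? zero    p = 0 , p , inj₁ refl
least-from P P? (suc k) p with P? (suc k)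
... | yes q = least-from P P? k q
... | no ¬q = suc k , p , inj₂ ¬q

module Threshold {n : ℕ} (G : Graph n) (side : Fin n → Bool)
                 (proper : ∀ u v → adj G u v ≡ true → side u ≢ side v) (key : Fin n → ℕ)
                 (rank≤key : ∀ a b → adj G a b ≡ true → Ranks.rank G b ≤ key a)
                 (key-attained : ∀ a → key a ≡ 0 ⊎ Σ[ b ∈ Fin n ] adj G a b ≡ true × Ranks.rank G b ≡ key a) where

  open Ranks G
  open States G side proper

  m E : ℕ
  m = ∑ (λ v → ⟦ side v ⟧)
  E = ∑ (λ v → ⟦ side v ⟧ * deg v)

  -- High rank means low degree.
  high low : ℕ → Fin n → Bool
  high θ b = side b ∧ not (rank b <ᵇ θ)
  low  θ b = side b ∧ (rank b <ᵇ θ)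

  highDegrees highCount lowCount : ℕ → ℕ
  highDegrees θ = ∑ (λ b → ⟦ high θ b ⟧ * deg b)
  highCount   θ = ∑ (λ b → ⟦ high θ b ⟧)
  lowCount    θ = ∑ (λ b → ⟦ low θ b ⟧)

  high+low : ∀ θ b → ⟦ side b ⟧ ≡ ⟦ high θ b ⟧ + ⟦ low θ b ⟧
  high+low θ b = lemma (side b) (rank b <ᵇ θ)
    where
    lemma : ∀ s c → ⟦ s ⟧ ≡ ⟦ s ∧ not c ⟧ + ⟦ s ∧ c ⟧
    lemma true  true  = refl
    lemma true  false = refl
    lemma false c     = refl

  highCount+lowCount : ∀ θ → highCount θ + lowCount θ ≡ m
  highCount+lowCount θ = trans (sym (∑-distrib-+ (λ b → ⟦ high θ b ⟧) (λ b → ⟦ low θ b ⟧))) (sum-cong-≗ λ b → sym (high+low θ b))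

  high-rank : ∀ θ {b} → high θ b ≡ true → side b ≡ true × θ ≤ rank b
  high-rank θ {b} eq with side b | rank b <ᵇ θ in lt
  ... | true | false = refl , <ᵇ≡false⇒≥ lt

  low-rank : ∀ θ {b} → low θ b ≡ true → side b ≡ true × rank b < θ
  low-rank θ {b} eq with side b | rank b <ᵇ θ in lt
  ... | true | true = refl , <ᵇ≡true⇒< lt

  high-intro : ∀ θ {b} → side b ≡ true → θ ≤ rank b → high θ b ≡ true
  high-intro θ {b} s le rewrite s | dec-false (rank b <? θ) (≤⇒≯ le) = refl

  -- The vertices of least degree have at most the average degree of their side. Any vertex of low
  -- rank has at least the degree of any vertex of high rank, and summing this over all such pairs
  -- gives `exchange`.
  high-average : ∀ θ → m * highDegrees θ ≤ highCount θ * E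
  high-average θ = begin
    m * S                     ≡⟨ cong (_* S) (sym (highCount+lowCount θ)) ⟩
    (h + l) * S               ≡⟨ *-distribʳ-+ S h l ⟩
    h * S + l * S             ≤⟨ +-monoʳ-≤ (h * S) exchange ⟩
    h * S + h * S′            ≡⟨ sym (*-distribˡ-+ h S S′) ⟩
    h * (S + S′)              ≡⟨ cong (h *_) (trans (sym (∑-distrib-+ (λ b → ⟦ high θ b ⟧ * deg b) (λ b → ⟦ low θ b ⟧ * deg b)))
                                  (sum-cong-≗ λ b → trans (sym (*-distribʳ-+ (deg b) ⟦ high θ b ⟧ ⟦ low θ b ⟧)) (cong (_* deg b) (sym (high+low θ b))))) ⟩
    h * E                     ∎
    where
    open ≤-Reasoning
    S  = highDegrees θ
    S′ = ∑ (λ b → ⟦ low θ b ⟧ * deg b)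
    h  = highCount θ
    l  = lowCount θ
    product : ∀ (f g : Fin n → ℕ) → ∑ f * ∑ g ≡ ∑ (λ c → ∑ (λ b → f c * g b))
    product f g = trans (*-distribʳ-sum (∑ g) f) (sum-cong-≗ λ c → *-distribˡ-sum (f c) g)
    term : ∀ c b → ⟦ low θ c ⟧ * (⟦ high θ b ⟧ * deg b) ≤ ⟦ high θ b ⟧ * (⟦ low θ c ⟧ * deg c)
    term c b with low θ c in lo | high θ b in hi
    ... | false | _     = z≤n
    ... | true  | false = z≤n
    ... | true  | true  = +-monoˡ-≤ 0 (+-monoˡ-≤ 0 (rank-antitone (<-≤-trans (proj₂ (low-rank θ lo)) (proj₂ (high-rank θ hi)))))
    exchange : l * S ≤ h * S′
    exchange = begin
      l * S                                                      ≡⟨ product (λ c → ⟦ low θ c ⟧) (λ b → ⟦ high θ b ⟧ * deg b) ⟩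
      ∑ (λ c → ∑ (λ b → ⟦ low θ c ⟧ * (⟦ high θ b ⟧ * deg b)))     ≤⟨ ∑-mono (λ c → ∑-mono (term c)) ⟩
      ∑ (λ c → ∑ (λ b → ⟦ high θ b ⟧ * (⟦ low θ c ⟧ * deg c)))     ≡⟨ ∑-comm (λ c b → ⟦ high θ b ⟧ * (⟦ low θ c ⟧ * deg c)) ⟩
      ∑ (λ b → ∑ (λ c → ⟦ high θ b ⟧ * (⟦ low θ c ⟧ * deg c)))     ≡⟨ sym (product (λ b → ⟦ high θ b ⟧) (λ c → ⟦ low θ c ⟧ * deg c)) ⟩
      h * S′                                                     ∎

  -- Ranks are distinct, so only one vertex can have rank exactly `θ`. This is the source of the 1
  -- lost in `threshold`.
  highCount-step : ∀ θ → highCount θ ≤ suc (highCount (suc θ))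
  highCount-step θ = begin
    highCount θ                                         ≤⟨ ∑-mono term ⟩
    ∑ (λ b → ⟦ rank b ≡ᵇ θ ⟧ + ⟦ high (suc θ) b ⟧)       ≡⟨ ∑-distrib-+ (λ b → ⟦ rank b ≡ᵇ θ ⟧) (λ b → ⟦ high (suc θ) b ⟧) ⟩
    ∑ (λ b → ⟦ rank b ≡ᵇ θ ⟧) + highCount (suc θ)        ≤⟨ +-monoˡ-≤ (highCount (suc θ)) (∑-unique≤1 (λ b → rank b ≡ᵇ θ) λ u v pu pv →
                                                            rank-injective (trans (≡ᵇ≡true u pu) (sym (≡ᵇ≡true v pv)))) ⟩
    suc (highCount (suc θ))                             ∎
    where
    open ≤-Reasoning
    ≡ᵇ≡true : ∀ v → (rank v ≡ᵇ θ) ≡ true → rank v ≡ θ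
    ≡ᵇ≡true v eq = ≡ᵇ⇒≡ (rank v) θ (subst T (sym eq) tt)
    term : ∀ b → ⟦ high θ b ⟧ ≤ ⟦ rank b ≡ᵇ θ ⟧ + ⟦ high (suc θ) b ⟧
    term b with high θ b in hi
    ... | false = z≤n
    ... | true with high-rank θ {b} hi
    ...   | s , le with rank b ≟ θ
    ...     | yes eq rewrite eq | ≡ᵇ-refl θ = s≤s z≤n
    ...     | no neq rewrite high-intro (suc θ) {b} s (≤∧≢⇒< le (≢-sym neq)) = m≤n+m 1 ⟦ rank b ≡ᵇ θ ⟧

  -- If the vertices of rank above θ have at most j neighbours, then these are
  -- the last to be matched.
  module _ (done : Subset n) (done⊆ : ∀ a → lookup done a ≡ true → side a ≡ false)
           (sorted : ∀ a c → lookup done a ≡ true → lookup done c ≡ false → side c ≡ false → key a ≤ key c)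
           (θ j : ℕ) (few : highDegrees (suc θ) ≤ j)
           (left : size done + j ≡ ∑ (λ v → ⟦ not (side v) ⟧)) where

    private
      above : Fin n → Bool
      above a = not (side a) ∧ not (key a <ᵇ suc θ)

      -- A vertex with a key above `θ` has a neighbour of that rank, and is counted in the degree of
      -- this neighbour.
      above-count : ∑ (λ a → ⟦ above a ⟧) ≤ highDegrees (suc θ)
      above-count = begin
        ∑ (λ a → ⟦ above a ⟧)                                              ≤⟨ ∑-mono term ⟩
        ∑ (λ a → ∑ (λ b → ⟦ high (suc θ) b ⟧ * ⟦ adj G b a ⟧))              ≡⟨ ∑-comm (λ a b → ⟦ high (suc θ) b ⟧ * ⟦ adj G b a ⟧) ⟩
        ∑ (λ b → ∑ (λ a → ⟦ high (suc θ) b ⟧ * ⟦ adj G b a ⟧))              ≡⟨ sum-cong-≗ (λ b → sym (*-distribˡ-sum ⟦ high (suc θ) b ⟧ (λ a → ⟦ adj G b a ⟧))) ⟩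
        highDegrees (suc θ)                                                ∎
        where
        open ≤-Reasoning
        term : ∀ a → ⟦ above a ⟧ ≤ ∑ (λ b → ⟦ high (suc θ) b ⟧ * ⟦ adj G b a ⟧)
        term a with side a in side-a | key a <ᵇ suc θ in lt
        ... | true  | _    = z≤n
        ... | false | true = z≤n
        ... | false | false with key-attained a
        ...   | inj₁ ≡0 = case ≤-trans (<ᵇ≡false⇒≥ {key a} {suc θ} lt) (≤-reflexive ≡0) of λ ()
        ...   | inj₂ (b , ab , rank≡) = ≤-trans (≤-reflexive (sym one)) (∑-≥ (λ b → ⟦ high (suc θ) b ⟧ * ⟦ adj G b a ⟧) b)
          where
          side-b : side b ≡ true
          side-b with side b in eq
          ... | true  = refl
          ... | false = ⊥-elim (proper a b ab (trans side-a (sym eq)))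
          one : ⟦ high (suc θ) b ⟧ * ⟦ adj G b a ⟧ ≡ 1
          one = cong₂ (λ x y → ⟦ x ⟧ * ⟦ y ⟧)
            (high-intro (suc θ) {b} side-b (≤-trans (<ᵇ≡false⇒≥ {key a} {suc θ} lt) (≤-reflexive (sym rank≡)))) (trans (adj-sym G b a) ab)

    -- Otherwise, by `sorted`, the `j` unmatched vertices of side false have keys above `θ` too.
    -- Together with `a` these are `j + 1` vertices, more than `above-count` and `few` allow.
    done-below : ∀ a → lookup done a ≡ true → key a ≤ θ
    done-below a a∈ with key a ≤? θ
    ... | yes p = p
    ... | no ¬p = ⊥-elim (<⇒≱ overflow (≤-trans above-count few))
      where
      term : ∀ c → ⟦ not (side c) ⟧ + ⟦ lookup (replicate n false [ a ]≔ true) c ⟧ ≤ ⟦ lookup done c ⟧ + ⟦ above c ⟧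
      term c with c Fin.≟ a
      ... | yes refl rewrite lookup∘update c (replicate n false) true | a∈ | done⊆ c a∈
                           | dec-false (key c <? suc θ) (λ lt → ¬p (≤-pred lt)) = ≤-refl
      ... | no c≢a rewrite lookup∘update′ c≢a (replicate n false) true | lookup-replicate c false
        with side c in side-c | lookup done c in c∈
      ...   | true  | _     = z≤n
      ...   | false | true  = s≤s z≤n
      ...   | false | false rewrite dec-false (key c <? suc θ) (λ lt → ¬p (≤-trans (sorted a c a∈ c∈ side-c) (≤-pred lt))) = ≤-refl
      overflow : j < ∑ (λ c → ⟦ above c ⟧)
      overflow = +-cancelˡ-≤ (size done) (suc j) _ (begin
        size done + suc j                                                             ≡⟨ +-suc (size done) j ⟩
        suc (size done + j)                                                           ≡⟨ cong suc left ⟩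
        suc (∑ (λ v → ⟦ not (side v) ⟧))                                               ≡⟨ +-comm 1 _ ⟩
        ∑ (λ v → ⟦ not (side v) ⟧) + 1                                                 ≡⟨ cong (∑ (λ v → ⟦ not (side v) ⟧) +_)
                                                                                         (sym (trans (size-insert (replicate n false) a (lookup-replicate a false)) (cong suc (size-empty n)))) ⟩
        ∑ (λ v → ⟦ not (side v) ⟧) + size (replicate n false [ a ]≔ true)               ≡⟨ sym (∑-distrib-+ (λ v → ⟦ not (side v) ⟧) (λ v → ⟦ lookup (replicate n false [ a ]≔ true) v ⟧)) ⟩
        ∑ (λ c → ⟦ not (side c) ⟧ + ⟦ lookup (replicate n false [ a ]≔ true) c ⟧)        ≤⟨ ∑-mono term ⟩
        ∑ (λ c → ⟦ lookup done c ⟧ + ⟦ above c ⟧)                                        ≡⟨ ∑-distrib-+ (λ c → ⟦ lookup done c ⟧) (λ c → ⟦ above c ⟧) ⟩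
        size done + ∑ (λ c → ⟦ above c ⟧)                                               ∎)
        where open ≤-Reasoning

    private
      hi : Subset n
      hi = Vec.tabulate (λ v → if side v then rank v <ᵇ suc θ else lookup done v)

      between : ∀ X → Reachable done X → Between done hi X
      between X state v = lower , upper
        where
        lower : lookup done v ≡ true → lookup X v ≡ true
        lower v∈ = trans (Reachable.agrees state v (done⊆ v v∈)) v∈
        upper : lookup X v ≡ true → lookup hi v ≡ true
        upper v∈ rewrite Vec.lookup∘tabulate (λ v → if side v then rank v <ᵇ suc θ else lookup done v) v with side v in side-v
        ... | false = trans (sym (Reachable.agrees state v side-v)) v∈
        ... | true with Reachable.touched state v side-v v∈
        ...   | a , a∈ , av = <⇒<ᵇ≡true (s≤s (≤-trans (rank≤key a v av) (done-below a a∈)))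

      free≡ : free done hi ≡ lowCount (suc θ)
      free≡ = sum-cong-≗ λ v → cong ⟦_⟧ (trans (cong (_∧ not (lookup done v)) (Vec.lookup∘tabulate _ v)) (lemma v))
        where
        lemma : ∀ v → (if side v then rank v <ᵇ suc θ else lookup done v) ∧ not (lookup done v) ≡ low (suc θ) v
        lemma v with side v in side-v | lookup done v in v∈
        ... | true  | true  = case trans (sym side-v) (done⊆ v v∈) of λ ()
        ... | true  | false = Bool.∧-identityʳ _
        ... | false | true  = refl
        ... | false | false = refl

    -- With s = `size done`, a state has 2s vertices, of which `done` fixes s. Weighing a set X by
    -- 2^|X| thus bounds the number of states times 4^s by 2^s times a power of 3, and 2^s cancels.
    states≤ : ∀ {xs} → Unique xs → All (Reachable done) xs →
              length xs ≤ 2 ^ lowCount (suc θ) × length xs * 2 ^ size done ≤ 3 ^ lowCount (suc θ)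
    states≤ {xs} u rs = subst (λ f → length xs ≤ 2 ^ f) free≡ (length≤2^free done hi u bs) ,
      *-cancelˡ-≤ (2 ^ size done) {{m^n≢0 2 (size done)}} (begin
        2 ^ size done * (length xs * 2 ^ size done)           ≡⟨ lemma (2 ^ size done) (length xs) ⟩
        length xs * (2 ^ size done * 2 ^ size done)           ≡⟨ cong (length xs *_) (trans (sym (^-distribˡ-+-* 2 (size done) (size done)))
                                                                  (cong (λ k → 2 ^ (size done + k)) (sym (+-identityʳ (size done))))) ⟩
        length xs * 2 ^ (2 * size done)                       ≡⟨ sym (weightSum-size 2 (2 * size done) (All.map Reachable.twice rs)) ⟩
        weightSum 2 xs                                        ≤⟨ weightSum≤ 2 done hi u bs ⟩
        2 ^ size done * 3 ^ free done hi                      ≡⟨ cong (λ f → 2 ^ size done * 3 ^ f) free≡ ⟩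
        2 ^ size done * 3 ^ lowCount (suc θ)                  ∎)
      where
      open ≤-Reasoning
      bs = All.map (λ {X} → between X) rs
      lemma : ∀ a l → a * (l * a) ≡ l * (a * a)
      lemma = solve-∀

  StatesBound : ℕ → ℕ → Set
  StatesBound j r = ∀ done → (∀ a → lookup done a ≡ true → side a ≡ false) →
    (∀ a c → lookup done a ≡ true → lookup done c ≡ false → side c ≡ false → key a ≤ key c) →
    size done + j ≡ ∑ (λ v → ⟦ not (side v) ⟧) → ∀ {xs} → Unique xs → All (Reachable done) xs →
    length xs ≤ 2 ^ r × length xs * 2 ^ size done ≤ 3 ^ r

  abstract
    -- The search stops at a `θ` for which the degrees of rank above `θ` add up to at most `j`,
    -- while those of rank at least `θ` exceed `j`. By `high-average` the latter vertices, `κ` in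
    -- number, satisfy `m * j ≤ κ * E`; the set of the former lacks at most one of them, hence
    -- `suc m`. If `θ` reaches 0, all ranks lie above it and `r` is 0.
    threshold : ∀ j → Σ[ r ∈ ℕ ] StatesBound j r × (r ≡ 0 ⊎ Σ[ κ ∈ ℕ ] κ + r ≤ suc m × m * j ≤ κ * E)
    threshold j with least-from (λ θ → highDegrees θ ≤ j) (λ θ → highDegrees θ ≤? j) (n * n + n) nothing
      where
      nothing : highDegrees (suc (n * n + n)) ≤ j
      nothing = ≤-trans (≤-reflexive (trans (sum-cong-≗ λ b → cong (_* deg b) (zero-high b)) (∑-zero n))) z≤n
        where
        zero-high : ∀ b → ⟦ high (suc (n * n + n)) b ⟧ ≡ 0
        zero-high b with high (suc (n * n + n)) b in hi
        ... | false = refl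
        ... | true  = ⊥-elim (<⇒≱ (proj₂ (high-rank (suc (n * n + n)) {b} hi)) (rank≤ b))
    ... | θ , few , first = lowCount (suc θ) , (λ done ⊆ sorted left u rs → states≤ done ⊆ sorted θ j few left u rs) , size-claim first
      where
      size-claim : θ ≡ 0 ⊎ ¬ highDegrees θ ≤ j → lowCount (suc θ) ≡ 0 ⊎ Σ[ κ ∈ ℕ ] κ + lowCount (suc θ) ≤ suc m × m * j ≤ κ * E
      size-claim (inj₁ refl) = inj₁ (trans (sum-cong-≗ zero-low) (∑-zero n))
        where
        zero-low : ∀ b → ⟦ low 1 b ⟧ ≡ 0
        zero-low b with low 1 b in lo
        ... | false = refl
        ... | true  = ⊥-elim (<⇒≱ (proj₂ (low-rank 1 {b} lo)) (0<rank b))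
      size-claim (inj₂ ¬few) = inj₂ (highCount θ ,
        ≤-trans (+-monoˡ-≤ (lowCount (suc θ)) (highCount-step θ)) (s≤s (≤-reflexive (highCount+lowCount (suc θ)))) ,
        ≤-trans (*-monoʳ-≤ m (<⇒≤ (≰⇒> ¬few))) (high-average θ))

-- Finding the sides and the order

-- Two components are merged by relabelling that of `v`. Both labels and the decision to switch are
-- saved beforehand, since relabelling alters the cells of `v` itself. The sum of the two truncated
-- differences of bits is their exclusive or.
joinC relabelC prepC : Cmd K
relabelC =
  when (lit 1 ⊝ (rd cComp (var cW) ⊝ var cCv) ⊝ (var cCv ⊝ rd cComp (var cW)))
    (wr cComp (var cW) (var cCu) ▸
     wr cSide (var cW) ((rd cSide (var cW) ⊝ var cFlip) ⊕ (var cFlip ⊝ rd cSide (var cW))))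
joinC =
  set cCu (rd cComp (var cU)) ▸
  set cCv (rd cComp (var cV)) ▸
  set cFlip (lit 1 ⊝ (rd cSide (var cU) ⊝ rd cSide (var cV)) ⊝ (rd cSide (var cV) ⊝ rd cSide (var cU))) ▸
  for cW order relabelC

splitC rankC keyC tallyC powC : Cmd K
splitC =
  for cU order (wr cComp (var cU) (var cU)) ▸
  for cU order (for cV order (when (edge cU cV) joinC))
rankC =
  for cU order
    (set cAcc (lit 0) ▸
     for cV order (set cAcc (var cAcc ⊕ edge cU cV)) ▸
     wr cRank (var cU) (order ⊛ (order ⊝ var cAcc) ⊕ var cU ⊕ lit 1))
keyC =
  for cA order
    (set cAcc (lit 0) ▸
     -- Under truncation, `y ⊕ (z ⊝ y)` is the maximum of `y` and `z`. It starts from 0, so an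
     -- isolated vertex gets key 0, below every rank.
     for cV order (when (edge cA cV) (set cAcc (var cAcc ⊕ (rd cRank (var cV) ⊝ var cAcc)))) ▸
     wr cKey (var cA) (var cAcc))
tallyC =
  set cCount (lit 0) ▸
  for cV order (set cCount (var cCount ⊕ (lit 1 ⊝ rd cSide (var cV))))
powC =
  wr cPow (lit 0) (lit 1) ▸
  for cV order (wr cPow (var cV ⊕ lit 1) (rd cPow (var cV) ⊕ rd cPow (var cV)))
prepC = splitC ▸ rankC ▸ keyC ▸ tallyC ▸ powC

forFlat : Exp K → ℕ → Cmd K → ℕ
forFlat e N c = forWork e N (flat c)

joinWork : ℕ → ℕ
joinWork n = flat (set cCu (rd cComp (var cU))) + (flat (set cCv (rd cComp (var cV))) +
  (flat (set cFlip (lit 1 ⊝ (rd cSide (var cU) ⊝ rd cSide (var cV)) ⊝ (rd cSide (var cV) ⊝ rd cSide (var cU)))) +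
   forWork order n (flat relabelC)))

splitWork : ℕ → ℕ
splitWork n = forFlat order n (wr cComp (var cU) (var cU)) + forWork order n (forWork order n (sizeE (edge cU cV) + (joinWork n + 2)))

rankWork : ℕ → ℕ
rankWork n = forWork order n (flat (set cAcc (lit 0)) + (forFlat order n (set cAcc (var cAcc ⊕ edge cU cV)) +
  flat (wr cRank (var cU) (order ⊛ (order ⊝ var cAcc) ⊕ var cU ⊕ lit 1))))

keyWork : ℕ → ℕ
keyWork n = forWork order n (flat (set cAcc (lit 0)) + (forFlat order n (when (edge cA cV) (set cAcc (var cAcc ⊕ (rd cRank (var cV) ⊝ var cAcc)))) +
  flat (wr cKey (var cA) (var cAcc))))

tallyWork : ℕ → ℕ
tallyWork n = flat (set cCount (lit 0)) + forFlat order n (set cCount (var cCount ⊕ (lit 1 ⊝ rd cSide (var cV))))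

powWork : ℕ → ℕ
powWork n = flat (wr cPow (lit 0) (lit 1)) + forFlat order n (wr cPow (var cV ⊕ lit 1) (rd cPow (var cV) ⊕ rd cPow (var cV)))

prepWork : ℕ → ℕ
prepWork n = splitWork n + (rankWork n + (keyWork n + (tallyWork n + powWork n)))

equal-test : ∀ {i j} → 1 ∸ (i ∸ j) ∸ (j ∸ i) ≢ 0 → i ≡ j
equal-test {i} {j} ≢0 with <-cmp i j
... | tri≈ _ eq _ = eq
... | tri< lt _ _ = ⊥-elim (≢0 (m≤n⇒m∸n≡0 (≤-trans (m∸n≤m 1 (i ∸ j)) (m<n⇒0<n∸m lt))))
... | tri> _ _ gt = ⊥-elim (≢0 (trans (cong (_∸ (j ∸ i)) (m≤n⇒m∸n≡0 (m<n⇒0<n∸m gt))) (0∸n≡0 (j ∸ i))))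

different-test : ∀ {i j} → 1 ∸ (i ∸ j) ∸ (j ∸ i) ≡ 0 → i ≢ j
different-test {i} ≡0 refl = case trans (sym (cong (λ k → 1 ∸ k ∸ k) (n∸n≡0 i))) ≡0 of λ ()

-- Correctness of the preparation: sides, ranks, keys and powers of 2

module Prep {n : ℕ} (G : Graph n) (side₀ : Fin n → Bool) (proper₀ : ∀ u v → adj G u v ≡ true → side₀ u ≢ side₀ v)
            (base V : ℕ) (0<base : 0 < base) (base≤V : base ≤ V) (V-large : 2 ^ exponentV n ≤ V) where

  open Bounds n V V-large
  open Ranks G
  open Machine K base V 0<base base≤V 8≤V
  open Edge G base V 0<base base≤V V-large

  Keep : State K → Set
  Keep σ = σ cAdj 0 ≡ n
         × (∀ u v → σ cAdj (suc (toℕ u * n + toℕ v)) ≡ ⟦ adj G u v ⟧)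
         × (∀ i → σ cTable i ≡ 0) × σ cQueue 0 ≡ 0 × σ cLo 0 ≡ 0 × σ cTop 0 ≡ 0

  edge≡ : ∀ {σ} x y (u v : Fin n) → Keep σ → σ x 0 ≡ toℕ u → σ y 0 ≡ toℕ v → eval σ (edge x y) ≡ ⟦ adj G u v ⟧
  edge≡ {σ} x y u v (en , ea , _) = edge-eval {σ} x y u v en ea

  edge-ok : ∀ {σ} x y (u v : Fin n) → Keep σ → σ x 0 ≡ toℕ u → σ y 0 ≡ toℕ v → Fine σ (edge x y)
  edge-ok {σ} x y u v (en , _) = edge-fine {σ} x y u v en

  ⟦⟧≢0 : ∀ {b} → ⟦ b ⟧ ≢ 0 → b ≡ true
  ⟦⟧≢0 {true}  _ = refl
  ⟦⟧≢0 {false} p = ⊥-elim (p refl)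

  -- The contents of an array in the middle of a loop that rewrites it, the cells below `k` being
  -- done.
  mix : {A : Set} → ℕ → (Fin n → A) → (Fin n → A) → Fin n → A
  mix k new old x = if toℕ x <ᵇ k then new x else old x

  mix-old : ∀ {A : Set} {new old : Fin n → A} x → mix (toℕ x) new old x ≡ old x
  mix-old x rewrite dec-false (toℕ x <? toℕ x) (<-irrefl refl) = refl

  mix-end : ∀ {A : Set} {new old : Fin n → A} x → mix n new old x ≡ new x
  mix-end x rewrite dec-true (toℕ x <? n) (toℕ<n x) = refl

  mix-other : ∀ {A : Set} {new old : Fin n → A} {w} x → w ≢ x → mix (toℕ w) new old x ≡ mix (suc (toℕ w)) new old x
  mix-other {w = w} x w≢x with <-cmp (toℕ x) (toℕ w)
  ... | tri< lt _ _ rewrite dec-true (toℕ x <? toℕ w) lt | dec-true (toℕ x <? suc (toℕ w)) (m≤n⇒m≤1+n lt) = refl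
  ... | tri≈ _ eq _ = ⊥-elim (w≢x (toℕ-injective (sym eq)))
  ... | tri> ≮ _ gt rewrite dec-false (toℕ x <? toℕ w) ≮ | dec-false (toℕ x <? suc (toℕ w)) (≤⇒≯ gt) = refl

  mix-new : ∀ {A : Set} {new old : Fin n → A} x → mix (suc (toℕ x)) new old x ≡ new x
  mix-new x rewrite dec-true (toℕ x <? suc (toℕ x)) ≤-refl = refl

  mix-put : ∀ {A : Set} (h : A → ℕ) {new old : Fin n → A} (f : ℕ → ℕ) w {v} → v ≡ h (new w) →
            (∀ x → f (toℕ x) ≡ h (mix (toℕ w) new old x)) →
            ∀ x → put f (toℕ w) v (toℕ x) ≡ h (mix (suc (toℕ w)) new old x)
  mix-put h {new} {old} f w {v} v≡ f≡ x with w Fin.≟ x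
  ... | yes refl = trans (put-same f (toℕ w) v) (trans v≡ (cong h (sym (mix-new {new = new} {old} w))))
  ... | no w≢x = trans (put-other f v (w≢x ∘ toℕ-injective)) (trans (f≡ x) (cong h (mix-other {new = new} {old} x w≢x)))

  mix-skip : ∀ {A : Set} (h : A → ℕ) {new old : Fin n → A} (f : ℕ → ℕ) w → new w ≡ old w →
             (∀ x → f (toℕ x) ≡ h (mix (toℕ w) new old x)) → ∀ x → f (toℕ x) ≡ h (mix (suc (toℕ w)) new old x)
  mix-skip h {new} {old} f w same f≡ x with w Fin.≟ x
  ... | yes refl = trans (f≡ w) (cong h (trans (mix-old {new = new} {old} w) (trans (sym same) (sym (mix-new {new = new} {old} w)))))
  ... | no w≢x = trans (f≡ x) (cong h (mix-other {new = new} {old} x w≢x))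

  -- The sides found so far agree with the given ones up to a switch of
  -- whole components.
  record Split (joined : Fin n → Fin n → Set) (C S : ℕ → ℕ) : Set where
    constructor split
    field
      side       : Fin n → Bool
      side≡      : ∀ x → S (toℕ x) ≡ ⟦ side x ⟧
      consistent : ∀ x y → C (toℕ x) ≡ C (toℕ y) → side x xor side₀ x ≡ side y xor side₀ y
      together   : ∀ x y → joined x y → adj G x y ≡ true → C (toℕ x) ≡ C (toℕ y)

  Joined : ℕ → ℕ → Fin n → Fin n → Set
  Joined r k x y = toℕ x < r ⊎ (toℕ x ≡ r × toℕ y < k)

  module Join (u v : Fin n) (uv : adj G u v ≡ true) (C S : ℕ → ℕ) (s : Split (Joined (toℕ u) (toℕ v)) C S) where
    open Split s

    -- The component of `v` is switched if `u` and `v` are on equal sides so far. If they are in one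
    -- component already, `consistent` and `proper₀` force their sides to differ, so nothing is
    -- switched.
    flip : Bool
    flip = not (side u xor side v)

    comp′ : Fin n → ℕ
    comp′ x = if does (C (toℕ x) ≟ C (toℕ v)) then C (toℕ u) else C (toℕ x)

    side′ : Fin n → Bool
    side′ x = if does (C (toℕ x) ≟ C (toℕ v)) then side x xor flip else side x

    -- By the hypothesis on `e xor g`, the left side is `not (a xor d)`, and `c ≢ d` makes `c` equal
    -- to `not d`. So a switched component deviates from the given sides exactly as that of `u`
    -- does.
    offset : ∀ a b c d e g → c ≢ d → e xor g ≡ b xor d → (e xor not (a xor b)) xor g ≡ a xor c
    offset a b c d e g c≢d eq = trans (cong ((e xor not (a xor b)) xor_) (solve-xor e g eq)) (rest a b c d e c≢d)
      where
      solve-xor : ∀ e g {h} → e xor g ≡ h → g ≡ e xor h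
      solve-xor true  true  refl = refl
      solve-xor true  false refl = refl
      solve-xor false g     refl = refl
      rest : ∀ a b c d e → c ≢ d → (e xor not (a xor b)) xor (e xor (b xor d)) ≡ a xor c
      rest a     b     true  true  e     c≢d = ⊥-elim (c≢d refl)
      rest a     b     false false e     c≢d = ⊥-elim (c≢d refl)
      rest true  true  true  false true  _ = refl
      rest true  true  true  false false _ = refl
      rest true  true  false true  true  _ = refl
      rest true  true  false true  false _ = refl
      rest true  false true  false true  _ = refl
      rest true  false true  false false _ = refl
      rest true  false false true  true  _ = refl
      rest true  false false true  false _ = refl
      rest false true  true  false true  _ = refl
      rest false true  true  false false _ = refl
      rest false true  false true  true  _ = refl
      rest false true  false true  false _ = refl
      rest false false true  false true  _ = refl
      rest false false true  false false _ = refl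
      rest false false false true  true  _ = refl
      rest false false false true  false _ = refl

    moved : ∀ x → C (toℕ x) ≡ C (toℕ v) → (side x xor flip) xor side₀ x ≡ side u xor side₀ u
    moved x eq = offset (side u) (side v) (side₀ u) (side₀ v) (side x) (side₀ x) (proper₀ u v uv) (consistent x v eq)

    comp-yes : ∀ x → C (toℕ x) ≡ C (toℕ v) → comp′ x ≡ C (toℕ u)
    comp-yes x eq rewrite dec-true (C (toℕ x) ≟ C (toℕ v)) eq = refl

    comp-no : ∀ x → C (toℕ x) ≢ C (toℕ v) → comp′ x ≡ C (toℕ x)
    comp-no x neq rewrite dec-false (C (toℕ x) ≟ C (toℕ v)) neq = refl

    side-yes : ∀ x → C (toℕ x) ≡ C (toℕ v) → side′ x ≡ side x xor flip
    side-yes x eq rewrite dec-true (C (toℕ x) ≟ C (toℕ v)) eq = refl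

    side-no : ∀ x → C (toℕ x) ≢ C (toℕ v) → side′ x ≡ side x
    side-no x neq rewrite dec-false (C (toℕ x) ≟ C (toℕ v)) neq = refl

    consistent′ : ∀ x y → comp′ x ≡ comp′ y → side′ x xor side₀ x ≡ side′ y xor side₀ y
    consistent′ x y eq = go (C (toℕ x) ≟ C (toℕ v)) (C (toℕ y) ≟ C (toℕ v))
      where
      yes-offset : ∀ x → C (toℕ x) ≡ C (toℕ v) → side′ x xor side₀ x ≡ side u xor side₀ u
      yes-offset x p = trans (cong (_xor side₀ x) (side-yes x p)) (moved x p)
      no-offset : ∀ x → C (toℕ x) ≢ C (toℕ v) → side′ x xor side₀ x ≡ side x xor side₀ x
      no-offset x p = cong (_xor side₀ x) (side-no x p)
      go : Dec (C (toℕ x) ≡ C (toℕ v)) → Dec (C (toℕ y) ≡ C (toℕ v)) → side′ x xor side₀ x ≡ side′ y xor side₀ y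
      go (yes p) (yes q) = trans (yes-offset x p) (sym (yes-offset y q))
      go (yes p) (no q)  = trans (yes-offset x p) (trans (consistent u y (trans (sym (comp-yes x p)) (trans eq (comp-no y q)))) (sym (no-offset y q)))
      go (no p)  (yes q) = trans (no-offset x p) (trans (consistent x u (trans (sym (comp-no x p)) (trans eq (comp-yes y q)))) (sym (yes-offset y q)))
      go (no p)  (no q)  = trans (no-offset x p) (trans (consistent x y (trans (sym (comp-no x p)) (trans eq (comp-no y q)))) (sym (no-offset y q)))

    comp′-cong : ∀ x y → C (toℕ x) ≡ C (toℕ y) → comp′ x ≡ comp′ y
    comp′-cong x y eq rewrite eq = refl

    comp′-uv : comp′ u ≡ comp′ v
    comp′-uv = trans (case C (toℕ u) ≟ C (toℕ v) of λ { (yes p) → comp-yes u p ; (no p) → comp-no u p }) (sym (comp-yes v refl))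

    joined : ∀ {C′ S′} → (∀ x → C′ (toℕ x) ≡ comp′ x) → (∀ x → S′ (toℕ x) ≡ ⟦ side′ x ⟧) →
             Split (Joined (toℕ u) (suc (toℕ v))) C′ S′
    joined c s = record
      { side = side′ ; side≡ = s
      ; consistent = λ x y eq → consistent′ x y (trans (sym (c x)) (trans eq (c y)))
      ; together = λ x y xy e → trans (c x) (trans (both x y xy e) (sym (c y))) }
      where
      both : ∀ x y → Joined (toℕ u) (suc (toℕ v)) x y → adj G x y ≡ true → comp′ x ≡ comp′ y
      both x y (inj₁ lt) e = comp′-cong x y (together x y (inj₁ lt) e)
      both x y (inj₂ (x≡ , lt)) e with toℕ y ≟ toℕ v
      ... | yes y≡ rewrite toℕ-injective {i = x} {u} x≡ | toℕ-injective {i = y} {v} y≡ = comp′-uv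
      ... | no y≢ = comp′-cong x y (together x y (inj₂ (x≡ , ≤∧≢⇒< (≤-pred lt) y≢)) e)

  xor-test : ∀ b c → (⟦ b ⟧ ∸ ⟦ c ⟧) + (⟦ c ⟧ ∸ ⟦ b ⟧) ≡ ⟦ b xor c ⟧
  xor-test true  true  = refl
  xor-test true  false = refl
  xor-test false true  = refl
  xor-test false false = refl

  xnor-test : ∀ b c → 1 ∸ (⟦ b ⟧ ∸ ⟦ c ⟧) ∸ (⟦ c ⟧ ∸ ⟦ b ⟧) ≡ ⟦ not (b xor c) ⟧
  xnor-test true  true  = refl
  xnor-test true  false = refl
  xnor-test false true  = refl
  xnor-test false false = refl

  AtPair : ℕ → ℕ → State K → Set
  AtPair r k σ = Keep σ × σ cU 0 ≡ r × Split (Joined r k) (σ cComp) (σ cSide)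

  join-triple : ∀ {u v σ} → adj G u v ≡ true → σ cV 0 ≡ toℕ v → AtPair (toℕ u) (toℕ v) σ →
                Triple joinC σ (joinWork n) (AtPair (toℕ u) (suc (toℕ v)))
  join-triple {u} {v} {σ} uv eV (keep@(en , _) , eU , s) =
    t-seq (t-wr _ _ (t-seq (t-wr _ _ (t-seq (t-wr _ _ (t-map (λ {σ′} → finish {σ′})
      (t-forFin en _ Loop (keep , eU , (λ x → refl) , side≡ , cong (σ cComp) eU , cong (σ cComp) eV , flip≡)
        (λ {w} {σ′} → relabel w {σ′}))))))))
    where
    open Split s
    open Join u v uv (σ cComp) (σ cSide) s
    Loop : ℕ → State K → Set
    Loop k σ′ = Keep σ′ × σ′ cU 0 ≡ toℕ u × (∀ x → σ′ cComp (toℕ x) ≡ mix k comp′ (σ cComp ∘ toℕ) x) ×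
      (∀ x → σ′ cSide (toℕ x) ≡ ⟦ mix k side′ side x ⟧) ×
      σ′ cCu 0 ≡ σ cComp (toℕ u) × σ′ cCv 0 ≡ σ cComp (toℕ v) × σ′ cFlip 0 ≡ ⟦ flip ⟧
    flip≡ : 1 ∸ (σ cSide (σ cU 0) ∸ σ cSide (σ cV 0)) ∸ (σ cSide (σ cV 0) ∸ σ cSide (σ cU 0)) ≡ ⟦ flip ⟧
    flip≡ = trans (cong₂ (λ x y → 1 ∸ (x ∸ y) ∸ (y ∸ x)) (trans (cong (σ cSide) eU) (side≡ u)) (trans (cong (σ cSide) eV) (side≡ v)))
      (xnor-test (side u) (side v))
    relabel : ∀ w {σ′} → Loop (toℕ w) σ′ → Triple relabelC (upd σ′ cW 0 (toℕ w)) (flat relabelC) (Loop (suc (toℕ w)))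
    relabel w {σ′} (keep , eU , c≡ , s≡ , eCu , eCv , eF) = t-when _
      (λ ≢0 → t-seq (t-wr _ _ (t-wr _ (_ , _ , side≤V)
        (keep , eU , mix-put id {comp′} {σ cComp ∘ toℕ} (σ′ cComp) w (trans eCu (sym (comp-yes w (hit ≢0)))) c≡ ,
         mix-put ⟦_⟧ {side′} {side} (σ′ cSide) w (trans new-side (cong ⟦_⟧ (sym (side-yes w (hit ≢0))))) s≡ , eCu , eCv , eF))))
      (λ ≡0 → keep , eU , mix-skip id {comp′} {σ cComp ∘ toℕ} (σ′ cComp) w (comp-no w (miss ≡0)) c≡ , mix-skip ⟦_⟧ {side′} {side} (σ′ cSide) w (side-no w (miss ≡0)) s≡ , eCu , eCv , eF)
      where
      c-w : σ′ cComp (toℕ w) ≡ σ cComp (toℕ w)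
      c-w = trans (c≡ w) (mix-old {new = comp′} {σ cComp ∘ toℕ} w)
      s-w : σ′ cSide (toℕ w) ≡ ⟦ side w ⟧
      s-w = trans (s≡ w) (cong ⟦_⟧ (mix-old {new = side′} {side} w))
      hit : 1 ∸ (σ′ cComp (toℕ w) ∸ σ′ cCv 0) ∸ (σ′ cCv 0 ∸ σ′ cComp (toℕ w)) ≢ 0 → σ cComp (toℕ w) ≡ σ cComp (toℕ v)
      hit ≢0 = trans (sym c-w) (trans (equal-test {σ′ cComp (toℕ w)} {σ′ cCv 0} ≢0) eCv)
      miss : 1 ∸ (σ′ cComp (toℕ w) ∸ σ′ cCv 0) ∸ (σ′ cCv 0 ∸ σ′ cComp (toℕ w)) ≡ 0 → σ cComp (toℕ w) ≢ σ cComp (toℕ v)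
      miss ≡0 eq = different-test {σ′ cComp (toℕ w)} {σ′ cCv 0} ≡0 (trans c-w (trans eq (sym eCv)))
      new-side : (σ′ cSide (toℕ w) ∸ σ′ cFlip 0) + (σ′ cFlip 0 ∸ σ′ cSide (toℕ w)) ≡ ⟦ side w xor flip ⟧
      new-side = trans (cong₂ (λ x y → (x ∸ y) + (y ∸ x)) s-w eF) (xor-test (side w) flip)
      side≤V : (σ′ cSide (toℕ w) ∸ σ′ cFlip 0) + (σ′ cFlip 0 ∸ σ′ cSide (toℕ w)) ≤ V
      side≤V = ≤-trans (≤-reflexive new-side) (≤-trans (⟦⟧≤1 _) (≤-trans (s≤s z≤n) 8≤V))
    finish : ∀ {σ′} → Loop n σ′ → AtPair (toℕ u) (suc (toℕ v)) σ′
    finish (keep , eU , c≡ , s≡ , _) = keep , eU ,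
      joined (λ x → trans (c≡ x) (mix-end {new = comp′} {σ cComp ∘ toℕ} x)) (λ x → trans (s≡ x) (cong ⟦_⟧ (mix-end {new = side′} {side} x)))

  Sided : State K → Set
  Sided σ = Keep σ × Σ[ side ∈ (Fin n → Bool) ] (∀ u v → adj G u v ≡ true → side u ≢ side v) × (∀ v → σ cSide (toℕ v) ≡ ⟦ side v ⟧)

  split-triple : ∀ {σ} → Keep σ → (∀ i → σ cSide i ≡ 0) → Triple splitC σ (splitWork n) Sided
  split-triple {σ} keep@(en , _) s≡0 = t-seq (t-map (λ {σ′} → edgewise {σ′}) (t-forFin en _ Fill (keep , s≡0 , λ _ ())
    (λ {v} {σ′} (keep , s≡0 , c≡) → t-wr _ _ (keep , s≡0 , filled v {σ′} c≡))))
    where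
    Fill : ℕ → State K → Set
    Fill k σ = Keep σ × (∀ i → σ cSide i ≡ 0) × (∀ i → i < k → σ cComp i ≡ i)
    filled : ∀ (v : Fin n) {σ′} → (∀ i → i < toℕ v → σ′ cComp i ≡ i) → ∀ i → i < suc (toℕ v) → put (σ′ cComp) (toℕ v) (toℕ v) i ≡ i
    filled v {σ′} c≡ i lt with toℕ v ≟ i
    ... | yes refl = put-same (σ′ cComp) i i
    ... | no v≢i   = trans (put-other (σ′ cComp) (toℕ v) v≢i) (c≡ i (≤∧≢⇒< (≤-pred lt) (≢-sym v≢i)))
    edgewise : ∀ {σ} → Fill n σ → Triple (for cU order (for cV order (when (edge cU cV) joinC))) σ
                 (forWork order n (forWork order n (sizeE (edge cU cV) + ((joinWork n) + 2)))) Sided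
    edgewise {σ} (keep@(en , _) , s≡0 , c≡) = t-map (λ {σ′} → finish {σ′}) (t-forFin en _ Outer (keep , start)
      λ {u} {σ′} (keep , s) → t-map (λ {σ″} → next {u} {σ″}) (t-forFin (proj₁ keep) _ (AtPair (toℕ u)) (keep , refl , weaken s)
        λ {v} {σ″} (keep , eU , s) → t-when (edge-ok {upd σ″ cV 0 (toℕ v)} cU cV u v keep eU refl)
          (λ ≢0 → join-triple {u} {v} (⟦⟧≢0 (λ eq → ≢0 (trans (edge≡ {upd σ″ cV 0 (toℕ v)} cU cV u v keep eU refl) eq))) refl (keep , eU , s))
          (λ ≡0 → keep , eU , absent u v (⟦⟧≡0 (trans (sym ≡0) (edge≡ {upd σ″ cV 0 (toℕ v)} cU cV u v keep eU refl))) s)))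
      where
      Outer : ℕ → State K → Set
      Outer r σ = Keep σ × Split (λ x y → toℕ x < r) (σ cComp) (σ cSide)
      start : Split (λ x y → toℕ x < 0) (σ cComp) (σ cSide)
      start = split (λ _ → false) (λ x → s≡0 (toℕ x))
        (λ x y eq → cong side₀ (toℕ-injective (trans (sym (c≡ (toℕ x) (toℕ<n x))) (trans eq (c≡ (toℕ y) (toℕ<n y)))))) (λ _ _ ())
      weaken : ∀ {r C S} → Split (λ x y → toℕ x < r) C S → Split (Joined r 0) C S
      weaken (split a b c d) = split a b c λ { x y (inj₁ lt) → d x y lt }
      next : ∀ {u σ} → AtPair (toℕ u) n σ → Outer (suc (toℕ u)) σ
      next {u} (keep , _ , split a b c d) = keep , split a b c λ x y lt → d x y (case toℕ x ≟ toℕ u of λ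
        { (yes eq) → inj₂ (eq , toℕ<n y) ; (no neq) → inj₁ (≤∧≢⇒< (≤-pred lt) neq) })
      absent : ∀ (u v : Fin n) {C S} → adj G u v ≡ false → Split (Joined (toℕ u) (toℕ v)) C S → Split (Joined (toℕ u) (suc (toℕ v))) C S
      absent u v nuv (split a b c d) = split a b c go
        where
        go : ∀ x y → Joined (toℕ u) (suc (toℕ v)) x y → adj G x y ≡ true → _
        go x y (inj₁ lt) xy = d x y (inj₁ lt) xy
        go x y (inj₂ (x≡ , lt)) xy with toℕ y ≟ toℕ v
        ... | no neq = d x y (inj₂ (x≡ , ≤∧≢⇒< (≤-pred lt) neq)) xy
        ... | yes y≡ = case trans (sym xy) (trans (cong₂ (adj G) (toℕ-injective x≡) (toℕ-injective y≡)) nuv) of λ ()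
      -- The ends of an edge are now in one component, where found and given sides differ by a
      -- constant; equal found sides would give equal given sides.
      finish : ∀ {σ} → Outer n σ → Sided σ
      finish (keep , split side side≡ con tog) = keep , side , (λ u v uv eq →
        proper₀ u v uv (cancel (side u) (side₀ u) (side₀ v) (trans (con u v (tog u v (toℕ<n u) uv)) (cong (_xor side₀ v) (sym eq))))) , side≡
        where
        cancel : ∀ a b c → a xor b ≡ a xor c → b ≡ c
        cancel true  true  true  _ = refl
        cancel true  false false _ = refl
        cancel false b     c     p = p

  Sides : (Fin n → Bool) → State K → Set
  Sides side σ = Keep σ × (∀ v → σ cSide (toℕ v) ≡ ⟦ side v ⟧)

  put-below : ∀ {P : Fin n → ℕ → Set} (f : ℕ → ℕ) (v : Fin n) {y} → P v y →
              (∀ x → toℕ x < toℕ v → P x (f (toℕ x))) → ∀ x → toℕ x < suc (toℕ v) → P x (put f (toℕ v) y (toℕ x))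
  put-below {P} f v {y} new old x lt with v Fin.≟ x
  ... | yes refl = subst (P v) (sym (put-same f (toℕ v) y)) new
  ... | no v≢x   = subst (P x) (sym (put-other f y (v≢x ∘ toℕ-injective))) (old x (≤∧≢⇒< (≤-pred lt) (λ eq → v≢x (toℕ-injective (sym eq)))))

  remaining≤ : ∀ {n} k (f : Fin n → ℕ) {a} → a + remaining k f ≡ ∑ f → a ≤ ∑ f
  remaining≤ k f eq = ≤-trans (m≤m+n _ (remaining k f)) (≤-reflexive eq)

  advance : ∀ {n} (f : Fin n → ℕ) v {a} → a + remaining (toℕ v) f ≡ ∑ f → a + f v + remaining (suc (toℕ v)) f ≡ ∑ f
  advance f v {a} eq = trans (+-assoc a (f v) _) (trans (cong (a +_) (sym (remaining-step f v))) eq)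

  module _ (side : Fin n → Bool) where

    Ranked : ℕ → State K → Set
    Ranked k σ = Sides side σ × (∀ x → toℕ x < k → σ cRank (toℕ x) ≡ rank x)

    rank-triple : ∀ {σ} → Sides side σ → Triple rankC σ (rankWork n) (Ranked n)
    rank-triple {σ} sides@((en , _) , _) = t-forFin en _ Ranked (sides , λ _ ()) λ {u} {σ′} → row u {σ′}
      where
      row : ∀ u {σ} → Ranked (toℕ u) σ → Triple _ (upd σ cU 0 (toℕ u)) _ (Ranked (suc (toℕ u)))
      row u {σ} (sides , ranked) = t-seq (t-wr _ _ (t-seq (t-map (λ {σ′} → finish {σ′}) (t-forFin (proj₁ (proj₁ sides)) _ Sum
        (sides , ranked , refl , refl) (λ {v} {σ′} → add-up {v} {σ′})))))
        where
        f : Fin n → ℕ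
        f v = ⟦ adj G u v ⟧
        Sum : ℕ → State K → Set
        Sum k σ′ = Sides side σ′ × (∀ x → toℕ x < toℕ u → σ′ cRank (toℕ x) ≡ rank x) × σ′ cU 0 ≡ toℕ u ×
          σ′ cAcc 0 + remaining k f ≡ ∑ f
        add-up : ∀ {v σ′} → Sum (toℕ v) σ′ → Triple (set cAcc (var cAcc ⊕ edge cU cV)) (upd σ′ cV 0 (toℕ v)) _ (Sum (suc (toℕ v)))
        add-up {v} {σ′} (sides@(keep , _) , ranked , eU , sum≡) = t-wr _ (_ , edge-ok {upd σ′ cV 0 (toℕ v)} cU cV u v keep eU refl , fits)
          (sides , ranked , eU , trans (cong (λ z → σ′ cAcc 0 + z + remaining (suc (toℕ v)) f) e≡) (advance f v sum≡))
          where
          e≡ = edge≡ {upd σ′ cV 0 (toℕ v)} cU cV u v keep eU refl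
          fits : σ′ cAcc 0 + eval (upd σ′ cV 0 (toℕ v)) (edge cU cV) ≤ V
          fits = ≤-trans (≤-reflexive (cong (σ′ cAcc 0 +_) e≡)) (≤-trans (remaining≤ (suc (toℕ v)) f (advance f v sum≡))
            (≤-trans (deg≤n u) (linear≤V (≤-trans (m≤m+n n (n + 8)) (≤-trans (≤-reflexive (sym (+-assoc n n 8))) (m≤n+m _ (n * n)))))))
        finish : ∀ {σ′} → Sum n σ′ → Triple (wr cRank (var cU) (order ⊛ (order ⊝ var cAcc) ⊕ var cU ⊕ lit 1)) σ′ _ (Ranked (suc (toℕ u)))
        finish {σ′} (sides@((en , _) , _) , ranked , eU , sum≡) = t-wr _
          (((_ , _ , ≤-trans (m≤m+n _ _) sum₁) , _ , sum₁) , _ , ≤-trans (≤-reflexive value≡) rank≤V)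
          (sides , subst (λ i → ∀ x → toℕ x < suc (toℕ u) → put (σ′ cRank) i (eval σ′ (order ⊛ (order ⊝ var cAcc) ⊕ var cU ⊕ lit 1)) (toℕ x) ≡ rank x)
            (sym eU) (put-below {λ x y → y ≡ rank x} (σ′ cRank) u value≡ ranked))
          where
          value≡ : eval σ′ (order ⊛ (order ⊝ var cAcc) ⊕ var cU ⊕ lit 1) ≡ rank u
          value≡ = trans (cong₂ (λ k a → k * (k ∸ a) + σ′ cU 0 + 1) en (trans (sym (+-identityʳ _)) (trans (cong (σ′ cAcc 0 +_) (sym (remaining-end f))) sum≡)))
            (cong (λ i → n * (n ∸ deg u) + i + 1) eU)
          rank≤V : rank u ≤ V
          rank≤V = ≤-trans (rank≤ u) (linear≤V (+-monoʳ-≤ (n * n) (≤-trans (m≤m+n n n) (m≤m+n (n + n) 8))))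
          sum₁ : σ′ cAdj 0 * (σ′ cAdj 0 ∸ σ′ cAcc 0) + σ′ cU 0 ≤ V
          sum₁ = ≤-trans (m≤m+n _ 1) (≤-trans (≤-reflexive value≡) rank≤V)

    KeyFor : Fin n → ℕ → Set
    KeyFor a y = (∀ b → adj G a b ≡ true → rank b ≤ y) × (y ≡ 0 ⊎ Σ[ b ∈ Fin n ] adj G a b ≡ true × rank b ≡ y)

    Keyed : ℕ → State K → Set
    Keyed k σ = Ranked n σ × (∀ x → toℕ x < k → KeyFor x (σ cKey (toℕ x)))

    key-triple : ∀ {σ} → Ranked n σ → Triple keyC σ (keyWork n) (Keyed n)
    key-triple {σ} ranked@(((en , _) , _) , _) = t-forFin en _ Keyed (ranked , λ _ ()) λ {a} {σ′} → row a {σ′}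
      where
      row : ∀ a {σ} → Keyed (toℕ a) σ → Triple _ (upd σ cA 0 (toℕ a)) _ (Keyed (suc (toℕ a)))
      row a {σ} (ranked , keyed) = t-seq (t-wr _ _ (t-seq (t-map (λ {σ′} → finish {σ′}) (t-forFin (proj₁ (proj₁ (proj₁ ranked))) _ Max
        (ranked , keyed , refl , (λ _ ()) , inj₁ refl) (λ {v} {σ′} → raise {v} {σ′})))))
        where
        Largest : ℕ → ℕ → Set
        Largest k y = (∀ b → toℕ b < k → adj G a b ≡ true → rank b ≤ y) × (y ≡ 0 ⊎ Σ[ b ∈ Fin n ] adj G a b ≡ true × rank b ≡ y)
        Max : ℕ → State K → Set
        Max k σ′ = Ranked n σ′ × (∀ x → toℕ x < toℕ a → KeyFor x (σ′ cKey (toℕ x))) × σ′ cA 0 ≡ toℕ a × Largest k (σ′ cAcc 0)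
        raise : ∀ {v σ′} → Max (toℕ v) σ′ → Triple (when (edge cA cV) (set cAcc (var cAcc ⊕ (rd cRank (var cV) ⊝ var cAcc)))) (upd σ′ cV 0 (toℕ v)) _ (Max (suc (toℕ v)))
        raise {v} {σ′} (ranked@((keep , _) , rank≡) , keyed , eA , (upper , attained)) = t-when (edge-ok {upd σ′ cV 0 (toℕ v)} cA cV a v keep eA refl)
          (λ ≢0 → t-wr _ (_ , _ , value≤V) (ranked , keyed , eA , subst (Largest (suc (toℕ v))) (sym value≡) (larger (⟦⟧≢0 (λ eq → ≢0 (trans e≡ eq))))))
          (λ ≡0 → ranked , keyed , eA , (λ b lt ab → case v Fin.≟ b of λ
             { (yes refl) → case trans (sym ab) (⟦⟧≡0 (trans (sym ≡0) e≡)) of λ ()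
             ; (no v≢b) → upper b (≤∧≢⇒< (≤-pred lt) (λ eq → v≢b (toℕ-injective (sym eq)))) ab }) , attained)
          where
          e≡ = edge≡ {upd σ′ cV 0 (toℕ v)} cA cV a v keep eA refl
          y = σ′ cAcc 0
          value≡ : y + (σ′ cRank (toℕ v) ∸ y) ≡ y ⊔ rank v
          value≡ = trans (cong (λ r → y + (r ∸ y)) (rank≡ v (toℕ<n v))) (lemma y (rank v))
            where
            lemma : ∀ i j → i + (j ∸ i) ≡ i ⊔ j
            lemma i j with ≤-total i j
            ... | inj₁ i≤j = trans (m+[n∸m]≡n i≤j) (sym (m≤n⇒m⊔n≡n i≤j))
            ... | inj₂ j≤i = trans (cong (i +_) (m≤n⇒m∸n≡0 j≤i)) (trans (+-identityʳ i) (sym (m≥n⇒m⊔n≡m j≤i)))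
          rank≤V : ∀ b → rank b ≤ V
          rank≤V b = ≤-trans (rank≤ b) (linear≤V (+-monoʳ-≤ (n * n) (≤-trans (m≤m+n n n) (m≤m+n (n + n) 8))))
          y≤V : y ≤ V
          y≤V = case attained of λ { (inj₁ eq) → ≤-trans (≤-reflexive eq) z≤n ; (inj₂ (b , _ , eq)) → ≤-trans (≤-reflexive (sym eq)) (rank≤V b) }
          value≤V : y + (σ′ cRank (toℕ v) ∸ y) ≤ V
          value≤V = ≤-trans (≤-reflexive value≡) (⊔-lub y≤V (rank≤V v))
          larger : adj G a v ≡ true → Largest (suc (toℕ v)) (y ⊔ rank v)
          larger av = (λ b lt ab → case v Fin.≟ b of λ
              { (yes refl) → m≤n⊔m y (rank v)
              ; (no v≢b) → ≤-trans (upper b (≤∧≢⇒< (≤-pred lt) (λ eq → v≢b (toℕ-injective (sym eq)))) ab) (m≤m⊔n y (rank v)) }) ,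
            (case ≤-total y (rank v) of λ
              { (inj₁ le) → inj₂ (v , av , sym (m≤n⇒m⊔n≡n le))
              ; (inj₂ ge) → subst (λ z → z ≡ 0 ⊎ Σ[ b ∈ Fin n ] adj G a b ≡ true × rank b ≡ z) (sym (m≥n⇒m⊔n≡m ge)) attained })
        finish : ∀ {σ′} → Max n σ′ → Triple (wr cKey (var cA) (var cAcc)) σ′ _ (Keyed (suc (toℕ a)))
        finish {σ′} (ranked , keyed , eA , (upper , attained)) = t-wr _ _ (ranked ,
          subst (λ i → ∀ x → toℕ x < suc (toℕ a) → KeyFor x (put (σ′ cKey) i (σ′ cAcc 0) (toℕ x))) (sym eA)
            (put-below {KeyFor} (σ′ cKey) a ((λ b → upper b (toℕ<n b)) , attained) keyed))

    Tallied : State K → Set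
    Tallied σ = Keyed n σ × σ cCount 0 ≡ ∑ (λ v → ⟦ not (side v) ⟧)

    tally-triple : ∀ {σ} → Keyed n σ → Triple tallyC σ (tallyWork n) Tallied
    tally-triple {σ} keyed@((((en , _) , _) , _) , _) =
      t-seq (t-wr _ _ (t-map (λ {σ′} → finish {σ′}) (t-forFin en _ Sum (keyed , refl) (λ {v} {σ′} → add-up {v} {σ′}))))
      where
      f : Fin n → ℕ
      f v = ⟦ not (side v) ⟧
      Sum : ℕ → State K → Set
      Sum k σ = Keyed n σ × σ cCount 0 + remaining k f ≡ ∑ f
      1∸ : ∀ b → 1 ∸ ⟦ b ⟧ ≡ ⟦ not b ⟧
      1∸ true  = refl
      1∸ false = refl
      add-up : ∀ {v σ} → Sum (toℕ v) σ → Triple (set cCount (var cCount ⊕ (lit 1 ⊝ rd cSide (var cV)))) (upd σ cV 0 (toℕ v)) _ (Sum (suc (toℕ v)))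
      add-up {v} {σ} (keyed@(((_ , side≡) , _) , _) , sum≡) = t-wr _ (_ , _ , ≤-trans (remaining≤ (suc (toℕ v)) f sum≡′) ∑≤V) (keyed , sum≡′)
        where
        sum≡′ : σ cCount 0 + (1 ∸ σ cSide (toℕ v)) + remaining (suc (toℕ v)) f ≡ ∑ f
        sum≡′ = trans (cong (λ z → σ cCount 0 + z + remaining (suc (toℕ v)) f) (trans (cong (1 ∸_) (side≡ v)) (1∸ (side v)))) (advance f v sum≡)
        ∑≤V : ∑ f ≤ V
        ∑≤V = ≤-trans (≤-trans (∑-mono {n} {g = λ _ → 1} (λ v → ⟦⟧≤1 (not (side v)))) (≤-reflexive (trans (∑-const n 1) (*-identityʳ n))))
          (linear≤V (≤-trans (m≤m+n n (n + 8)) (≤-trans (≤-reflexive (sym (+-assoc n n 8))) (m≤n+m _ (n * n)))))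
      finish : ∀ {σ} → Sum n σ → Tallied σ
      finish (keyed , sum≡) = keyed , trans (sym (+-identityʳ _)) (trans (cong (_ +_) (sym (remaining-end f))) sum≡)

    Powered : ℕ → State K → Set
    Powered k σ = Tallied σ × (∀ i → i ≤ k → σ cPow i ≡ 2 ^ i)

    pow-triple : ∀ {σ} → Tallied σ → Triple powC σ (powWork n) (Powered n)
    pow-triple {σ} tallied@(((((en , _) , _) , _) , _) , _) = t-seq (t-wr _ _ (t-forFin en _ Powered
      (tallied , λ { zero _ → put-same (σ cPow) 0 1 }) (λ {v} {σ′} → double {v} {σ′})))
      where
      double : ∀ {v σ} → Powered (toℕ v) σ → Triple (wr cPow (var cV ⊕ lit 1) (rd cPow (var cV) ⊕ rd cPow (var cV))) (upd σ cV 0 (toℕ v)) _ (Powered (suc (toℕ v)))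
      double {v} {σ} (tallied , pow≡) = t-wr (_ , _ , index≤V) (_ , _ , ≤-trans (≤-reflexive value≡) power≤V) (tallied , powers)
        where
        value≡ : σ cPow (toℕ v) + σ cPow (toℕ v) ≡ 2 ^ suc (toℕ v)
        value≡ = trans (cong (λ z → z + z) (pow≡ (toℕ v) ≤-refl)) (cong (2 ^ toℕ v +_) (sym (+-identityʳ (2 ^ toℕ v))))
        power≤V : 2 ^ suc (toℕ v) ≤ V
        power≤V = ≤-trans (^-monoʳ-≤ 2 (toℕ<n v)) 2^n≤V
        index≤V : toℕ v + 1 ≤ V
        index≤V = ≤-trans (≤-reflexive (+-comm (toℕ v) 1)) (≤-trans (<⇒≤ (n<2^n (suc (toℕ v)))) power≤V)
        powers : ∀ i → i ≤ suc (toℕ v) → put (σ cPow) (toℕ v + 1) (σ cPow (toℕ v) + σ cPow (toℕ v)) i ≡ 2 ^ i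
        powers i i≤ with toℕ v + 1 ≟ i
        ... | yes refl = trans (put-same (σ cPow) (toℕ v + 1) _) (trans value≡ (cong (2 ^_) (+-comm 1 (toℕ v))))
        ... | no neq = trans (put-other (σ cPow) _ neq) (pow≡ i (≤-pred (≤∧≢⇒< i≤ (λ eq → neq (trans (+-comm (toℕ v) 1) (sym eq))))))

  Prepared : State K → Set
  Prepared σ = Σ[ side ∈ (Fin n → Bool) ] (∀ u v → adj G u v ≡ true → side u ≢ side v) × Powered side n σ

  prep-triple : ∀ {σ} → Keep σ → (∀ i → σ cSide i ≡ 0) → Triple prepC σ (prepWork n) Prepared
  prep-triple keep s≡0 = t-seq (t-map (λ { (keep , side , proper , side≡) →
    t-map (λ powered → side , proper , powered)
      (t-seq (t-map (λ ranked → t-seq (t-map (λ keyed → t-seq (t-map (pow-triple side) (tally-triple side keyed)))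
        (key-triple side ranked))) (rank-triple side (keep , side≡)))) }) (split-triple keep s≡0))

-- The exponent

^-cancelˡ-≤ : ∀ {p q} k .{{_ : NonZero k}} → p ^ k ≤ q ^ k → p ≤ q
^-cancelˡ-≤ {p} {q} k le with p ≤? q
... | yes p≤q = p≤q
... | no p≰q  = ⊥-elim (<⇒≱ (^-monoˡ-< k (≰⇒> p≰q)) le)

*-^-comm : ∀ a b k → (a * b) ^ k ≡ a ^ k * b ^ k
*-^-comm a b k = ^-distribʳ-* k a b
  where
  ^-distribʳ-* : ∀ k a b → (a * b) ^ k ≡ a ^ k * b ^ k
  ^-distribʳ-* zero    a b = refl
  ^-distribʳ-* (suc k) a b = trans (cong (a * b *_) (^-distribʳ-* k a b)) (lemma a b (a ^ k) (b ^ k))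
    where
    lemma : ∀ a b x y → a * b * (x * y) ≡ a * x * (b * y)
    lemma = solve-∀

-- Here d is approximated from above by x / y, and a / b lies above the
-- exponent.  With k = m - r and j = m - i, the bound 2 ^ (m - k) is good
-- enough for j ≥ m / 3.55, and 3 ^ (m - k) / 2 ^ (m - j) for smaller j.
module Growth (m r i j κ E x y a b : ℕ) (0<m : 0 < m) (0<x : 0 < x) (y≤x : y ≤ x)
              (average : E * y ≤ x * m) (above : 71 * (m * x * b) ≤ 71 * (a * x) + 20 * (m * b * y))
              (i+j : i + j ≡ m) (κ+r : κ + r ≤ suc m) (few : m * j ≤ κ * E) where

  -- This is κ ≥ j / d, with x / y in place of d.
  jy≤κx : j * y ≤ κ * x
  jy≤κx = *-cancelʳ-≤ (j * y) (κ * x) m {{>-nonZero 0<m}} (begin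
    j * y * m      ≡⟨ l₁ j y m ⟩
    m * j * y      ≤⟨ *-monoˡ-≤ y few ⟩
    κ * E * y      ≡⟨ *-assoc κ E y ⟩
    κ * (E * y)    ≤⟨ *-monoʳ-≤ κ average ⟩
    κ * (x * m)    ≡⟨ sym (*-assoc κ x m) ⟩
    κ * x * m      ∎)
    where
    open ≤-Reasoning
    l₁ : ∀ j y m → j * y * m ≡ m * j * y
    l₁ = solve-∀

  -- Here κ ≥ j y / x ≥ (20/71) m y / x, so r ≤ m + 1 - κ exceeds the target by at most 1, and the
  -- target is at most a / b.
  many : 20 * m ≤ 71 * j → r * b ≤ a + b
  many large = *-cancelˡ-≤ (71 * x) {{>-nonZero (≤-trans 0<x (m≤m+n x _))}} (+-cancelʳ-≤ (20 * (m * b * y)) _ _ (begin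
    71 * x * (r * b) + 20 * (m * b * y)            ≡⟨ l₁ x r b m y ⟩
    71 * x * (r * b) + 20 * m * (b * y)            ≤⟨ +-monoʳ-≤ (71 * x * (r * b)) (*-monoˡ-≤ (b * y) large) ⟩
    71 * x * (r * b) + 71 * j * (b * y)            ≡⟨ l₂ x r b j y ⟩
    71 * x * (r * b) + 71 * b * (j * y)            ≤⟨ +-monoʳ-≤ (71 * x * (r * b)) (*-monoʳ-≤ (71 * b) jy≤κx) ⟩
    71 * x * (r * b) + 71 * b * (κ * x)            ≡⟨ l₃ x r b κ ⟩
    71 * (x * b) * (κ + r)                         ≤⟨ *-monoʳ-≤ (71 * (x * b)) κ+r ⟩
    71 * (x * b) * suc m                           ≡⟨ l₄ x b m ⟩
    71 * (m * x * b) + 71 * (x * b)                ≤⟨ +-monoˡ-≤ (71 * (x * b)) above ⟩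
    71 * (a * x) + 20 * (m * b * y) + 71 * (x * b) ≡⟨ l₅ a x m b y ⟩
    71 * x * (a + b) + 20 * (m * b * y)            ∎))
    where
    open ≤-Reasoning
    l₁ : ∀ x r b m y → 71 * x * (r * b) + 20 * (m * b * y) ≡ 71 * x * (r * b) + 20 * m * (b * y)
    l₁ = solve-∀
    l₂ : ∀ x r b j y → 71 * x * (r * b) + 71 * j * (b * y) ≡ 71 * x * (r * b) + 71 * b * (j * y)
    l₂ = solve-∀
    l₃ : ∀ x r b κ → 71 * x * (r * b) + 71 * b * (κ * x) ≡ 71 * (x * b) * (κ + r)
    l₃ = solve-∀
    l₄ : ∀ x b m → 71 * (x * b) * (1 + m) ≡ 71 * (m * x * b) + 71 * (x * b)
    l₄ = solve-∀
    l₅ : ∀ a x m b y → 71 * (a * x) + 20 * (m * b * y) + 71 * (x * b) ≡ 71 * x * (a + b) + 20 * (m * b * y)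
    l₅ = solve-∀

  -- With d = x / y, division by 355 y gives j d + (20/71) m ≤ (2/5) m d + (8/5) j: the second
  -- estimate, with 8/5 for the logarithm of 3, against the target. The substitution separates the
  -- terms in y, where 100 ≤ 142 and 355 ≤ 568 suffice, from those in δ, where j ≤ (2/5) m is needed
  -- and j ≤ (20/71) m is given.
  convexity : 71 * j ≤ 20 * m → ∀ δ → x ≡ y + δ → 355 * (j * x) + 100 * (m * y) ≤ 142 * (m * x) + 568 * (j * y)
  convexity small δ refl = begin
    355 * (j * (y + δ)) + 100 * (m * y)                           ≡⟨ l₁ j y δ m ⟩
    5 * δ * (71 * j) + 355 * (j * y) + 100 * (m * y)              ≤⟨ +-monoˡ-≤ (100 * (m * y)) (+-monoˡ-≤ (355 * (j * y)) (*-monoʳ-≤ (5 * δ) small)) ⟩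
    5 * δ * (20 * m) + 355 * (j * y) + 100 * (m * y)              ≤⟨ m≤m+n _ (42 * (m * δ) + 42 * (m * y) + 213 * (j * y)) ⟩
    5 * δ * (20 * m) + 355 * (j * y) + 100 * (m * y) + (42 * (m * δ) + 42 * (m * y) + 213 * (j * y))  ≡⟨ l₂ j y δ m ⟩
    142 * (m * (y + δ)) + 568 * (j * y)                           ∎
    where
    open ≤-Reasoning
    l₁ : ∀ j y δ m → 355 * (j * (y + δ)) + 100 * (m * y) ≡ 5 * δ * (71 * j) + 355 * (j * y) + 100 * (m * y)
    l₁ = solve-∀
    l₂ : ∀ j y δ m → 5 * δ * (20 * m) + 355 * (j * y) + 100 * (m * y) + (42 * (m * δ) + 42 * (m * y) + 213 * (j * y)) ≡
         142 * (m * (y + δ)) + 568 * (j * y)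
    l₂ = solve-∀

  -- In other words (8/5) r - i ≤ a / b + 8/5. The left side bounds the binary logarithm of 3^r /
  -- 2^i, and the extra 8/5 pays for the 1 in `suc m`.
  few-left : 71 * j ≤ 20 * m → 8 * (r * b) ≤ 5 * a + 8 * b + 5 * (i * b)
  few-left small = +-cancelʳ-≤ (8 * (κ * b) + 5 * (j * b)) _ _ (begin
    8 * (r * b) + (8 * (κ * b) + 5 * (j * b))     ≡⟨ l₁ r b κ j ⟩
    8 * b * (κ + r) + 5 * (j * b)                 ≤⟨ +-monoˡ-≤ (5 * (j * b)) (*-monoʳ-≤ (8 * b) κ+r) ⟩
    8 * b * suc m + 5 * (j * b)                   ≡⟨ l₂ b m j ⟩
    8 * b + 5 * (m * b) + (3 * (m * b) + 5 * (j * b))   ≤⟨ +-monoʳ-≤ (8 * b + 5 * (m * b)) core ⟩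
    8 * b + 5 * (m * b) + (5 * a + 8 * (κ * b))         ≡⟨ cong (λ k → 8 * b + 5 * (k * b) + (5 * a + 8 * (κ * b))) (sym i+j) ⟩
    8 * b + 5 * ((i + j) * b) + (5 * a + 8 * (κ * b))   ≡⟨ l₃ b i j a κ ⟩
    5 * a + 8 * b + 5 * (i * b) + (8 * (κ * b) + 5 * (j * b))  ∎)
    where
    open ≤-Reasoning
    l₁ : ∀ r b κ j → 8 * (r * b) + (8 * (κ * b) + 5 * (j * b)) ≡ 8 * b * (κ + r) + 5 * (j * b)
    l₁ = solve-∀
    l₂ : ∀ b m j → 8 * b * (1 + m) + 5 * (j * b) ≡ 8 * b + 5 * (m * b) + (3 * (m * b) + 5 * (j * b))
    l₂ = solve-∀
    l₃ : ∀ b i j a κ → 8 * b + 5 * ((i + j) * b) + (5 * a + 8 * (κ * b)) ≡ 5 * a + 8 * b + 5 * (i * b) + (8 * (κ * b) + 5 * (j * b))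
    l₃ = solve-∀
    core : 3 * (m * b) + 5 * (j * b) ≤ 5 * a + 8 * (κ * b)
    -- The added 142 m x b completes 213 m x b to five times the left side of `above`, and 100 m b y
    -- is five times its last term.
    core = *-cancelˡ-≤ (71 * x) {{>-nonZero (≤-trans 0<x (m≤m+n x _))}} (+-cancelʳ-≤ (100 * (m * b * y) + 142 * (m * x * b)) _ _ (begin
      71 * x * (3 * (m * b) + 5 * (j * b)) + (100 * (m * b * y) + 142 * (m * x * b))   ≡⟨ k₁ x m b j y ⟩
      355 * (m * x * b) + b * (355 * (j * x) + 100 * (m * y))                          ≤⟨ +-monoʳ-≤ (355 * (m * x * b)) (*-monoʳ-≤ b (convexity small (x ∸ y) (sym (m+[n∸m]≡n y≤x)))) ⟩
      355 * (m * x * b) + b * (142 * (m * x) + 568 * (j * y))                          ≡⟨ k₂ x m b j y ⟩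
      5 * (71 * (m * x * b)) + 142 * (m * x * b) + 568 * b * (j * y)                   ≤⟨ +-mono-≤ (+-monoˡ-≤ (142 * (m * x * b)) (*-monoʳ-≤ 5 above)) (*-monoʳ-≤ (568 * b) jy≤κx) ⟩
      5 * (71 * (a * x) + 20 * (m * b * y)) + 142 * (m * x * b) + 568 * b * (κ * x)    ≡⟨ k₃ x m b a y κ ⟩
      71 * x * (5 * a + 8 * (κ * b)) + (100 * (m * b * y) + 142 * (m * x * b))         ∎))
      where
      k₁ : ∀ x m b j y → 71 * x * (3 * (m * b) + 5 * (j * b)) + (100 * (m * b * y) + 142 * (m * x * b)) ≡
           355 * (m * x * b) + b * (355 * (j * x) + 100 * (m * y))
      k₁ = solve-∀
      k₂ : ∀ x m b j y → 355 * (m * x * b) + b * (142 * (m * x) + 568 * (j * y)) ≡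
           5 * (71 * (m * x * b)) + 142 * (m * x * b) + 568 * b * (j * y)
      k₂ = solve-∀
      k₃ : ∀ x m b a y κ → 5 * (71 * (a * x) + 20 * (m * b * y)) + 142 * (m * x * b) + 568 * b * (κ * x) ≡
           71 * x * (5 * a + 8 * (κ * b)) + (100 * (m * b * y) + 142 * (m * x * b))
      k₃ = solve-∀

  -- The factor 4 absorbs the loss from `suc m`, which is a factor 2 in the first case and 2^(8/5)
  -- in the second.
  growth : ∀ M → M ≤ 2 ^ r → M * 2 ^ i ≤ 3 ^ r → M ^ b ≤ 4 ^ b * 2 ^ a
  growth M M≤2^r M2^i≤3^r with 20 * m ≤? 71 * j
  ... | yes large = begin
    M ^ b              ≤⟨ ^-monoˡ-≤ b M≤2^r ⟩
    (2 ^ r) ^ b        ≡⟨ ^-*-assoc 2 r b ⟩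
    2 ^ (r * b)        ≤⟨ ^-monoʳ-≤ 2 (many large) ⟩
    2 ^ (a + b)        ≡⟨ trans (^-distribˡ-+-* 2 a b) (*-comm (2 ^ a) (2 ^ b)) ⟩
    2 ^ b * 2 ^ a      ≤⟨ *-monoˡ-≤ (2 ^ a) (^-monoˡ-≤ b (s≤s (s≤s (z≤n {2})))) ⟩
    4 ^ b * 2 ^ a      ∎
    where open ≤-Reasoning
  ... | no small = ^-cancelˡ-≤ 5 (*-cancelʳ-≤ ((M ^ b) ^ 5) ((4 ^ b * 2 ^ a) ^ 5) (2 ^ (5 * (i * b))) {{m^n≢0 2 (5 * (i * b))}} (begin
    (M ^ b) ^ 5 * 2 ^ (5 * (i * b))          ≡⟨ cong ((M ^ b) ^ 5 *_) (power i) ⟩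
    (M ^ b) ^ 5 * ((2 ^ i) ^ b) ^ 5          ≡⟨ sym (trans (cong (_^ 5) (*-^-comm M (2 ^ i) b)) (*-^-comm (M ^ b) ((2 ^ i) ^ b) 5)) ⟩
    ((M * 2 ^ i) ^ b) ^ 5                    ≤⟨ ^-monoˡ-≤ 5 (^-monoˡ-≤ b M2^i≤3^r) ⟩
    ((3 ^ r) ^ b) ^ 5                        ≡⟨ trans (cong (_^ 5) (^-*-assoc 3 r b)) (trans (^-*-assoc 3 (r * b) 5) (trans (cong (3 ^_) (*-comm (r * b) 5)) (sym (^-*-assoc 3 5 (r * b))))) ⟩
    -- The fifth power was taken so that 3^5 ≤ 2^8 can stand for the logarithm of 3 being at most
    -- 8/5.
    243 ^ (r * b)                            ≤⟨ ^-monoˡ-≤ (r * b) (≤ᵇ⇒≤ 243 256 tt) ⟩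
    256 ^ (r * b)                            ≡⟨ ^-*-assoc 2 8 (r * b) ⟩
    2 ^ (8 * (r * b))                        ≤⟨ ^-monoʳ-≤ 2 (≤-trans (few-left (<⇒≤ (≰⇒> small))) (+-monoˡ-≤ (5 * (i * b)) (+-monoʳ-≤ (5 * a) (*-monoˡ-≤ b (≤ᵇ⇒≤ 8 10 tt))))) ⟩
    2 ^ (5 * a + 10 * b + 5 * (i * b))       ≡⟨ ^-distribˡ-+-* 2 (5 * a + 10 * b) (5 * (i * b)) ⟩
    2 ^ (5 * a + 10 * b) * 2 ^ (5 * (i * b)) ≡⟨ cong (_* 2 ^ (5 * (i * b))) total ⟩
    (4 ^ b * 2 ^ a) ^ 5 * 2 ^ (5 * (i * b))  ∎))
    where
    open ≤-Reasoning
    power : ∀ i → 2 ^ (5 * (i * b)) ≡ ((2 ^ i) ^ b) ^ 5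
    power i = sym (trans (cong (_^ 5) (^-*-assoc 2 i b)) (trans (^-*-assoc 2 (i * b) 5) (cong (2 ^_) (*-comm (i * b) 5))))
    total : 2 ^ (5 * a + 10 * b) ≡ (4 ^ b * 2 ^ a) ^ 5
    total = sym (trans (cong (_^ 5) (trans (cong (_* 2 ^ a) (^-*-assoc 2 2 b)) (sym (^-distribˡ-+-* 2 (2 * b) a))))
      (trans (^-*-assoc 2 (2 * b + a) 5) (cong (2 ^_) (lemma a b))))
      where
      lemma : ∀ a b → (2 * b + a) * 5 ≡ 5 * a + 10 * b
      lemma = solve-∀

-- A rational s above the exponent lies above the exponent of some rational
-- w = x / y above d.
module Above (d : ℝ) (1≤d : 1ℚ ≤ᴿ d) (n : ℕ) .{{n≢0 : NonZero n}} where

  open import Data.Integer.Base using (+_; -[1+_])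

  private
    c h : ℚ
    c = + 355 ℚ./ 100
    h = + n ℚ./ 2

    instance
      h>0 : ℚ.Positive h
      h>0 = ℚ.normalize-pos n 2

  record Approximation (s : ℚ) : Set where
    constructor approximation
    field
      w      : ℚ
      d<w    : d ᴿ< w
      1≤w    : 1ℚ ℚ.≤ w
      above  : h ℚ.* (c ℚ.* w) ℚ.< s ℚ.* (c ℚ.* w) ℚ.+ h

  approximate : ∀ s → exponent d 1≤d n ᴿ< s → Approximation s
  -- The cut of the exponent unfolds into its witnesses: `u` above 1 - 1/(c d) with h u < s, then
  -- `v` above c d with (1 - u) v < 1, and `w` above d with c w < v.
  approximate s (u , (v , (w , d<w , cw<v) , lt) , hu<s) = approximation w d<w 1≤w above
    where
    1≤w : 1ℚ ℚ.≤ w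
    1≤w = ℚ.≮⇒≥ λ w<1 → 1≤d (ℝ.U-up d w<1 d<w)
    instance
      w>0 : ℚ.Positive w
      w>0 = ℚ.positive (ℚ.<-≤-trans (ℚ.positive⁻¹ 1ℚ) 1≤w)
      cw>0 : ℚ.Positive (c ℚ.* w)
      cw>0 = ℚ.pos*pos⇒pos c w
    lt′ : (1ℚ ℚ.- u) ℚ.* (c ℚ.* w) ℚ.< 1ℚ
    -- Multiplying `cw<v` by 1 - u preserves the order only if the factor is positive; otherwise the
    -- product is at most 0 and hence below 1.
    lt′ with (1ℚ ℚ.- u) ℚ.≤? 0ℚ
    ... | yes neg = ℚ.≤-<-trans (subst ((1ℚ ℚ.- u) ℚ.* (c ℚ.* w) ℚ.≤_) (ℚ.*-zeroˡ (c ℚ.* w))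
                      (ℚ.*-monoʳ-≤-nonNeg (c ℚ.* w) {{ℚ.pos⇒nonNeg (c ℚ.* w)}} neg)) (ℚ.positive⁻¹ 1ℚ)
    ... | no ¬neg = ℚ.<-trans (ℚ.*-monoʳ-<-pos (1ℚ ℚ.- u) {{ℚ.positive (ℚ.≰⇒> ¬neg)}} cw<v) lt
    above : h ℚ.* (c ℚ.* w) ℚ.< s ℚ.* (c ℚ.* w) ℚ.+ h
    above = ℚ.<-trans
      (subst₂ ℚ._<_ (lemma₁ h u (c ℚ.* w)) (lemma₂ h u (c ℚ.* w)) (ℚ.+-monoʳ-< (h ℚ.* u ℚ.* (c ℚ.* w)) (ℚ.*-monoʳ-<-pos h lt′)))
      (ℚ.+-monoˡ-< h (ℚ.*-monoˡ-<-pos (c ℚ.* w) hu<s))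
      where
      open ℚSolver.+-*-Solver
      lemma₁ : ∀ h u z → h ℚ.* u ℚ.* z ℚ.+ h ℚ.* ((1ℚ ℚ.- u) ℚ.* z) ≡ h ℚ.* z
      lemma₁ = solve 3 (λ h u z → h :* u :* z :+ h :* ((con 1ℚ :- u) :* z) := h :* z) refl
      lemma₂ : ∀ h u z → h ℚ.* u ℚ.* z ℚ.+ h ℚ.* 1ℚ ≡ h ℚ.* u ℚ.* z ℚ.+ h
      lemma₂ = solve 3 (λ h u z → h :* u :* z :+ h :* con 1ℚ := h :* u :* z :+ h) refl

  -- With w = x / y and s = a / b, `above` is (n/2) (1 - 20 y / (71 x)) ≤ a / b multiplied by 142 x
  -- b; here 3.55 = 71/20.
  record Fraction (s : ℚ) (S : ℕ) : Set where
    constructor fraction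
    field
      x y a b-1 : ℕ
      s≡      : ∀ {t p} → t ^ suc b-1 ≤ p ^ suc b-1 * 2 ^ a → t ≤ p ·2^ℚ s
      0<x     : 0 < x
      y≤x     : y ≤ x
      average : S * y ≤ x * n
      above   : 71 * (n * x * suc b-1) ≤ 142 * (a * x) + 20 * (n * suc b-1 * y)

  private
    pos² : ∀ i j k → + i ℤ.* (+ j ℤ.* + k) ≡ + (i * (j * k))
    pos² i j k = trans (cong (+ i ℤ.*_) (sym (ℤ.pos-* j k))) (sym (ℤ.pos-* i (j * k)))

    cross : ∀ {i j k l} → + i ℤ.* + j ℤ.< + k ℤ.* + l → i * j < k * l
    cross {i} {j} {k} {l} lt = ℤ.drop‿+<+ (subst₂ ℤ._<_ (sym (ℤ.pos-* i j)) (sym (ℤ.pos-* k l)) lt)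

    cross≤ : ∀ {i j k l} → + i ℤ.* + j ℤ.≤ + k ℤ.* + l → i * j ≤ k * l
    cross≤ {i} {j} {k} {l} le = ℤ.drop‿+≤+ (subst₂ ℤ._≤_ (sym (ℤ.pos-* i j)) (sym (ℤ.pos-* k l)) le)

    -- As c w ≥ 1, the left side is at least h, so s c w is positive. Thus `s` has a positive
    -- numerator, and the comparison with 2^s takes its form for nonnegative exponents.
    s>0 : ∀ s w → 1ℚ ℚ.≤ w → h ℚ.* (c ℚ.* w) ℚ.< s ℚ.* (c ℚ.* w) ℚ.+ h → 0ℚ ℚ.< s
    s>0 s w 1≤w above = ℚ.*-cancelʳ-<-nonNeg (c ℚ.* w) {{ℚ.pos⇒nonNeg (c ℚ.* w)}}
      (subst (ℚ._< s ℚ.* (c ℚ.* w)) (sym (ℚ.*-zeroˡ (c ℚ.* w)))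
        (subst₂ ℚ._<_ (ℚ.+-inverseʳ h) (lemma h (s ℚ.* (c ℚ.* w)))
          (ℚ.+-monoˡ-< (ℚ.- h) (ℚ.≤-<-trans (subst (ℚ._≤ h ℚ.* (c ℚ.* w)) (ℚ.*-identityʳ h) (ℚ.*-monoˡ-≤-nonNeg h {{ℚ.pos⇒nonNeg h}} 1≤cw)) above))))
      where
      instance
        w>0 : ℚ.Positive w
        w>0 = ℚ.positive (ℚ.<-≤-trans (ℚ.positive⁻¹ 1ℚ) 1≤w)
        cw>0 : ℚ.Positive (c ℚ.* w)
        cw>0 = ℚ.pos*pos⇒pos c w
      1≤c : 1ℚ ℚ.≤ c ℚ.* 1ℚ
      1≤c = ℚ.≤ᵇ⇒≤ tt
      1≤cw : 1ℚ ℚ.≤ c ℚ.* w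
      1≤cw = ℚ.≤-trans 1≤c (ℚ.*-monoˡ-≤-nonNeg c 1≤w)
      lemma : ∀ h z → z ℚ.+ h ℚ.+ ℚ.- h ≡ z
      lemma = solve 2 (λ h z → z :+ h :+ :- h := z) refl
        where open ℚSolver.+-*-Solver

  fractions : ∀ s S → Approximation s → + S ℚ./ n ≤ᴿ d → Fraction s S
  fractions s S (approximation w d<w 1≤w above) S/n≤d =
    go s w (ℚ.positive (s>0 s w 1≤w above)) (ℚ.positive (ℚ.<-≤-trans (ℚ.positive⁻¹ 1ℚ) 1≤w)) above 1≤w
      (ℚ.≮⇒≥ λ w<S/n → S/n≤d (ℝ.U-up d w<S/n d<w))
    where
    go : ∀ s w → ℚ.Positive s → ℚ.Positive w → h ℚ.* (c ℚ.* w) ℚ.< s ℚ.* (c ℚ.* w) ℚ.+ h → 1ℚ ℚ.≤ w → + S ℚ./ n ℚ.≤ w → Fraction s S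
    go (mkℚ (+ 0) _ _) w (record { pos = () }) _ _ _ _
    go (mkℚ -[1+ _ ] _ _) w (record { pos = () }) _ _ _ _
    go (mkℚ (+ suc _) _ _) (mkℚ (+ 0) _ _) _ (record { pos = () }) _ _ _
    go (mkℚ (+ suc _) _ _) (mkℚ -[1+ _ ] _ _) _ (record { pos = () }) _ _ _
    go s@(mkℚ (+ suc a-1) b-1 _) w@(mkℚ (+ suc x-1) y-1 _) _ _ above 1≤w S/n≤w = record
      { x = x ; y = y ; a = a ; b-1 = b-1
      ; s≡ = id
      ; 0<x = s≤s z≤n
      ; y≤x = subst₂ _≤_ (*-identityˡ y) (*-identityʳ x) (cross≤ {1} {y} {x} {1} (ℚ.drop-*≤* 1≤w))
      ; average = average n (ℚᵘ.≤-respˡ-≃ (average≃ n) (ℚ.toℚᵘ-mono-≤ S/n≤w))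
      ; above = <⇒≤ (*-cancelʳ-< (2 * (20 * y)) _ _ (subst₂ _<_ (lemma₁ n x b y) (lemma₂ a x n b y) (cross {n * (71 * x)} {b * (20 * y) * 2} {a * (71 * x) * 2 + n * (b * (20 * y))} {2 * (20 * y)} inequality)))
      }
      where
      x = suc x-1
      y = suc y-1
      a = suc a-1
      b = suc b-1
      average≃ : ∀ n .{{_ : NonZero n}} → ℚ.toℚᵘ (+ S ℚ./ n) ℚᵘ.≃ (+ S ℚᵘ./ n)
      average≃ (suc n-1) = ℚ.toℚᵘ-fromℚᵘ (mkℚᵘ (+ S) n-1)
      average : ∀ n .{{_ : NonZero n}} → (+ S ℚᵘ./ n) ℚᵘ.≤ ℚ.toℚᵘ w → S * y ≤ x * n
      average (suc n-1) (ℚᵘ.*≤* le) = cross≤ {S} {y} {x} {suc n-1} le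
      H C S′ W : ℚᵘ
      H  = mkℚᵘ (+ n) 1
      -- The constant 355/100 in lowest terms; denominators are stored less 1.
      C  = mkℚᵘ (+ 71) 19
      S′ = mkℚᵘ (+ a) b-1
      W  = mkℚᵘ (+ x) y-1
      left : ℚ.toℚᵘ (h ℚ.* (c ℚ.* w)) ℚᵘ.≃ H ℚᵘ.* (C ℚᵘ.* W)
      left = ℚᵘ.≃-trans (ℚ.toℚᵘ-homo-* h (c ℚ.* w)) (ℚᵘ.*-cong (ℚ.toℚᵘ-fromℚᵘ H) (ℚ.toℚᵘ-homo-* c w))
      right : ℚ.toℚᵘ (s ℚ.* (c ℚ.* w) ℚ.+ h) ℚᵘ.≃ S′ ℚᵘ.* (C ℚᵘ.* W) ℚᵘ.+ H
      right = ℚᵘ.≃-trans (ℚ.toℚᵘ-homo-+ (s ℚ.* (c ℚ.* w)) h) (ℚᵘ.+-cong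
        (ℚᵘ.≃-trans (ℚ.toℚᵘ-homo-* s (c ℚ.* w)) (ℚᵘ.*-cong (ℚᵘ.≃-refl {S′}) (ℚ.toℚᵘ-homo-* c w))) (ℚ.toℚᵘ-fromℚᵘ H))
      inequality : + (n * (71 * x)) ℤ.* + (b * (20 * y) * 2) ℤ.< + (a * (71 * x) * 2 + n * (b * (20 * y))) ℤ.* + (2 * (20 * y))
      inequality = subst₂ (λ i j → i ℤ.* + (b * (20 * y) * 2) ℤ.< j ℤ.* + (2 * (20 * y))) (pos² n 71 x)
        (cong₂ ℤ._+_ (trans (cong (ℤ._* + 2) (pos² a 71 x)) (sym (ℤ.pos-* (a * (71 * x)) 2))) (sym (ℤ.pos-* n (b * (20 * y)))))
        (ℚᵘ.drop-*<* (ℚᵘ.<-respˡ-≃ left (ℚᵘ.<-respʳ-≃ right (ℚ.toℚᵘ-mono-< above))))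
      lemma₁ : ∀ n x b y → n * (71 * x) * (b * (20 * y) * 2) ≡ 71 * (n * x * b) * (2 * (20 * y))
      lemma₁ = solve-∀
      lemma₂ : ∀ a x n b y → (a * (71 * x) * 2 + n * (b * (20 * y))) * (2 * (20 * y)) ≡ (142 * (a * x) + 20 * (n * b * y)) * (2 * (20 * y))
      lemma₂ = solve-∀

  abstract
    fraction-above : ∀ s S → exponent d 1≤d n ᴿ< s → + S ℚ./ n ≤ᴿ d → Fraction s S
    fraction-above s S e<s S/n≤d = fractions s S (approximate s e<s) S/n≤d

-- Bounds on the running time

record Polynomial (f : ℕ → ℕ) : Set where
  constructor polynomial
  field
    factor degree′ : ℕ
    bounded        : ∀ n → 0 < n → f n ≤ factor * n ^ degree′

poly-const : ∀ k → Polynomial (λ _ → k)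
poly-const k = polynomial k 0 λ n _ → ≤-reflexive (sym (*-identityʳ k))

poly-id : Polynomial id
poly-id = polynomial 1 1 λ n _ → ≤-reflexive (sym (trans (+-identityʳ _) (*-identityʳ n)))

poly-+ : ∀ {f g} → Polynomial f → Polynomial g → Polynomial (λ n → f n + g n)
poly-+ (polynomial c k b) (polynomial c′ k′ b′) = polynomial (c + c′) (k + k′) λ n 0<n →
  ≤-trans (+-mono-≤ (≤-trans (b n 0<n) (*-monoʳ-≤ c (^-monoʳ-≤ n {{>-nonZero 0<n}} (m≤m+n k k′))))
                    (≤-trans (b′ n 0<n) (*-monoʳ-≤ c′ (^-monoʳ-≤ n {{>-nonZero 0<n}} (m≤n+m k′ k)))))
    (≤-reflexive (sym (*-distribʳ-+ (n ^ (k + k′)) c c′)))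

poly-* : ∀ {f g} → Polynomial f → Polynomial g → Polynomial (λ n → f n * g n)
poly-* (polynomial c k b) (polynomial c′ k′ b′) = polynomial (c * c′) (k + k′) λ n 0<n →
  ≤-trans (*-mono-≤ (b n 0<n) (b′ n 0<n))
    (≤-reflexive (trans (lemma c (n ^ k) c′ (n ^ k′)) (cong (c * c′ *_) (sym (^-distribˡ-+-* n k k′)))))
  where
  lemma : ∀ c x c′ y → c * x * (c′ * y) ≡ c * c′ * (x * y)
  lemma = solve-∀

infixl 6 _:+_
infixl 7 _:*_

-- Polynomials in the number n of vertices that are linear in the largest
-- number M of states in a level.
data Bound : Set where
  con          : ℕ → Bound
  order′       : Bound
  _:+_ _:*_    : Bound → Bound → Bound
  states:*_    : Bound → Bound

eval-bound : Bound → ℕ → ℕ → ℕ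
eval-bound (con k)      n M = k
eval-bound order′       n M = n
eval-bound (e :+ f)     n M = eval-bound e n M + eval-bound f n M
-- The left factor is evaluated for one state, so `M` enters only through the right factor and the
-- product stays linear in `M`.
eval-bound (e :* f)     n M = eval-bound e n 1 * eval-bound f n M
eval-bound (states:* e) n M = M * eval-bound e n 1

bound-polynomial : ∀ e → Polynomial (λ n → eval-bound e n 1)
bound-polynomial (con k)      = poly-const k
bound-polynomial order′       = poly-id
bound-polynomial (e :+ f)     = poly-+ (bound-polynomial e) (bound-polynomial f)
bound-polynomial (e :* f)     = poly-* (bound-polynomial e) (bound-polynomial f)
bound-polynomial (states:* e) = poly-* (poly-const 1) (bound-polynomial e)

bound-linear : ∀ e n {M} → 1 ≤ M → eval-bound e n M ≤ eval-bound e n 1 * M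
bound-linear (con k)      n 1≤M = ≤-trans (≤-reflexive (sym (*-identityʳ k))) (*-monoʳ-≤ k 1≤M)
bound-linear order′       n 1≤M = ≤-trans (≤-reflexive (sym (*-identityʳ n))) (*-monoʳ-≤ n 1≤M)
bound-linear (e :+ f)     n {M} 1≤M = ≤-trans (+-mono-≤ (bound-linear e n 1≤M) (bound-linear f n 1≤M))
  (≤-reflexive (sym (*-distribʳ-+ M (eval-bound e n 1) (eval-bound f n 1))))
bound-linear (e :* f)     n {M} 1≤M = ≤-trans (*-monoʳ-≤ (eval-bound e n 1) (bound-linear f n 1≤M))
  (≤-reflexive (sym (*-assoc (eval-bound e n 1) (eval-bound f n 1) M)))
bound-linear (states:* e) n {M} 1≤M = ≤-reflexive (lemma M (eval-bound e n 1))
  where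
  lemma : ∀ M k → M * k ≡ 1 * k * M
  lemma = solve-∀

forB : Exp K → Bound → Bound → Bound
forB e N w = con (sizeE e) :+ (con 2 :+ N :* (w :+ con 4))

flatB : Cmd K → Bound
flatB c = con (flat c)

flatForB : Cmd K → Bound
flatForB c = forB order order′ (flatB c)

rowB : Cmd K → Cmd K → Bound
rowB c d = forB order order′ (flatB (set cAcc (lit 0)) :+ (flatForB c :+ flatB d))

-- A margin of registers for the compiled commands; that it is wide enough is checked by computation
-- in `height≤`.
scratch : ℕ
scratch = 40

bootB joinB splitB prepB treatB levelB countB totalB : Bound
bootB  = con 4 :+ (con ((3 + scratch) * 2) :+ (con 6 :+ (con 1 :+ (con 1 :+ order′ :* order′) :* con 5)))
joinB  = flatB (set cCu (rd cComp (var cU))) :+ (flatB (set cCv (rd cComp (var cV))) :+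
  (flatB (set cFlip (lit 1 ⊝ (rd cSide (var cU) ⊝ rd cSide (var cV)) ⊝ (rd cSide (var cV) ⊝ rd cSide (var cU)))) :+ flatForB relabelC))
splitB = flatForB (wr cComp (var cU) (var cU)) :+
  forB order order′ (forB order order′ (con (sizeE (edge cU cV)) :+ (joinB :+ con 2)))
prepB  = splitB :+ (rowB (set cAcc (var cAcc ⊕ edge cU cV)) (wr cRank (var cU) (order ⊛ (order ⊝ var cAcc) ⊕ var cU ⊕ lit 1)) :+
  (rowB (when (edge cA cV) (set cAcc (var cAcc ⊕ (rd cRank (var cV) ⊝ var cAcc)))) (wr cKey (var cA) (var cAcc)) :+
  ((flatB (set cCount (lit 0)) :+ flatForB (set cCount (var cCount ⊕ (lit 1 ⊝ rd cSide (var cV))))) :+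
   (flatB (wr cPow (lit 0) (lit 1)) :+ flatForB (wr cPow (var cV ⊕ lit 1) (rd cPow (var cV) ⊕ rd cPow (var cV)))))))
treatB = flatB (set cX (rd cQueue (var cHi ⊝ lit 1 ⊝ var cI))) :+ (flatB (set cT (rd cTable (var cX))) :+ flatForB tryC)
levelB = flatB (set cHi (var cTop)) :+
  ((con (sizeE (var cHi ⊝ var cLo)) :+ (con 2 :+ states:* (treatB :+ con 4))) :+ flatB (set cLo (var cHi)))
countB = flatB startC :+ forB rounds (order′ :* order′ :+ order′ :+ con 1) (forB order order′ (con (sizeE pick) :+ (levelB :+ con 2)))
totalB = bootB :+ (prepB :+ con (sizeE result + 1)) :+ countB

prepB-correct : ∀ n M → eval-bound prepB n M ≡ prepWork n
prepB-correct n M = refl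

countB-correct : ∀ n M → eval-bound countB n M ≡ countWork n M
countB-correct n M = refl

logV : ℕ → ℕ
logV n = exponentV n + (5 + scratch)

instructionCost : ℕ → ℕ
instructionCost n = 9 * suc (6 + logV n)

instructionB : Bound
instructionB = con 9 :* (con 1 :+ (con 6 :+ (order′ :* order′ :+ (order′ :+ order′ :+ con 8) :+ con (5 + scratch))))

work≤ : ∀ n {M} → 1 ≤ M →
        (bootWork scratch n + (prepWork n + (sizeE result + 1)) + countWork n M) * instructionCost n ≤ eval-bound (totalB :* instructionB) n 1 * M
work≤ n {M} 1≤M = begin
  (bootWork scratch n + (prepWork n + (sizeE result + 1)) + countWork n M) * instructionCost n
    ≤⟨ *-monoˡ-≤ (instructionCost n) (+-monoˡ-≤ (countWork n M) (+-monoˡ-≤ (prepWork n + (sizeE result + 1)) boot≤)) ⟩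
  (eval-bound bootB n M + (prepWork n + (sizeE result + 1)) + countWork n M) * instructionCost n
    ≡⟨ cong₂ (λ x y → (eval-bound bootB n M + (x + (sizeE result + 1)) + y) * instructionCost n) {prepWork n} {eval-bound prepB n M} {countWork n M} {eval-bound countB n M} (sym (prepB-correct n M)) (sym (countB-correct n M)) ⟩
  eval-bound totalB n M * instructionCost n
    ≤⟨ *-monoˡ-≤ (instructionCost n) (bound-linear totalB n 1≤M) ⟩
  eval-bound totalB n 1 * M * instructionCost n
    ≡⟨ lemma (eval-bound totalB n 1) M (instructionCost n) ⟩
  eval-bound totalB n 1 * instructionCost n * M ∎
  where
  open ≤-Reasoning
  boot≤ : bootWork scratch n ≤ eval-bound bootB n M
  boot≤ = +-monoʳ-≤ 4 (+-monoʳ-≤ ((3 + scratch) * 2) (+-monoʳ-≤ 6 (+-monoʳ-≤ 1 (*-monoˡ-≤ 5 (m∸n≤m (suc (n * n)) (5 + scratch))))))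
  lemma : ∀ a b c → a * b * c ≡ a * c * b
  lemma = solve-∀

-- The input in memory

load-beyond : ∀ xs i → length xs ≤ i → load xs i ≡ 0
load-beyond []       i       _        = refl
load-beyond (x ∷ xs) (suc i) (s≤s le) = load-beyond xs i le

load-++ˡ : ∀ xs ys i → i < length xs → load (xs ++ ys) i ≡ load xs i
load-++ˡ (x ∷ xs) ys zero    _        = refl
load-++ˡ (x ∷ xs) ys (suc i) (s≤s lt) = load-++ˡ xs ys i lt

load-++ʳ : ∀ xs ys i → load (xs ++ ys) (length xs + i) ≡ load ys i
load-++ʳ []       ys i = refl
load-++ʳ (x ∷ xs) ys i = load-++ʳ xs ys i

load-map : ∀ {A : Set} {n} (f : A → ℕ) (g : Fin n → A) v → load (map f (tabulate g)) (toℕ v) ≡ f (g v)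
load-map f g zero    = refl
load-map f g (suc v) = load-map f (g ∘ suc) v

load≤ : ∀ {k} xs → All (_≤ k) xs → ∀ i → load xs i ≤ k
load≤ []       _        i       = z≤n
load≤ (x ∷ xs) (p ∷ ps) zero    = p
load≤ (x ∷ xs) (p ∷ ps) (suc i) = load≤ xs ps i

module _ {A : Set} {n : ℕ} (row : A → List ℕ) (row-length : ∀ a → length (row a) ≡ n) where

  length-rows : ∀ {m} (g : Fin m → A) → length (concatMap row (tabulate g)) ≡ m * n
  length-rows {zero}  g = refl
  length-rows {suc m} g = trans (length-++ (row (g zero))) (cong₂ _+_ (row-length (g zero)) (length-rows (g ∘ suc)))

  load-rows : ∀ {m} (g : Fin m → A) u i → i < n → load (concatMap row (tabulate g)) (toℕ u * n + i) ≡ load (row (g u)) i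
  load-rows {suc m} g zero i i<n = load-++ˡ (row (g zero)) _ i (<-≤-trans i<n (≤-reflexive (sym (row-length (g zero)))))
  load-rows {suc m} g (suc u) i i<n = trans
    (cong (load (concatMap row (tabulate g))) (trans (+-assoc n (toℕ u * n) i) (cong (_+ (toℕ u * n + i)) (sym (row-length (g zero))))))
    (trans (load-++ʳ (row (g zero)) _ (toℕ u * n + i)) (load-rows (g ∘ suc) u i i<n))

module Input {n : ℕ} (G : Graph n) where

  row : Fin n → List ℕ
  row u = map (λ v → if adj G u v then 1 else 0) (allFin n)

  row-length : ∀ u → length (row u) ≡ n
  row-length u = trans (length-map _ (allFin n)) (length-tabulate id)

  input : Memory
  input = load (encode G)

  input-adj : ∀ u v → input (suc (toℕ u * n + toℕ v)) ≡ ⟦ adj G u v ⟧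
  input-adj u v = trans (load-rows row row-length id u (toℕ v) (toℕ<n v)) (load-map (λ v → ⟦ adj G u v ⟧) id v)

  input-end : ∀ i → n * n < i → input i ≡ 0
  input-end (suc i) (s≤s le) = load-beyond (concatMap row (allFin n)) i (≤-trans (≤-reflexive (length-rows row row-length id)) le)

  input≤ : ∀ i → input i ≤ 1 + n
  input≤ = load≤ (encode G) (m≤n+m n 1 ∷ All.concat⁺ (All.map⁺ (All.universal
    (λ u → All.map⁺ (All.universal (λ v → ≤-trans (⟦⟧≤1 (adj G u v)) (m≤m+n 1 n)) (allFin n))) (allFin n))))

input1 : ∀ {n} .{{_ : NonZero n}} (G : Graph n) → Input.input G 1 ≡ 0
input1 {suc n} G = trans (Input.input-adj G zero zero) (cong ⟦_⟧ (adj-irrefl G zero))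

-- Average degree and the size of the largest level

abstract
  argmax : ∀ (f : ℕ → ℕ) m → Σ[ i ∈ ℕ ] i ≤ m × (∀ j → j ≤ m → f j ≤ f i)
  argmax f zero = 0 , z≤n , λ { zero z≤n → ≤-refl }
  argmax f (suc m) with argmax f m
  ... | i , i≤m , max with f (suc m) ≤? f i
  ...   | yes le = i , m≤n⇒m≤1+n i≤m , λ j j≤ → case m≤n⇒m<n∨m≡n j≤ of λ
          { (inj₁ lt) → max j (≤-pred lt) ; (inj₂ refl) → le }
  ...   | no ¬le = suc m , ≤-refl , λ j j≤ → case m≤n⇒m<n∨m≡n j≤ of λ
          { (inj₁ lt) → ≤-trans (max j (≤-pred lt)) (<⇒≤ (≰⇒> ¬le)) ; (inj₂ refl) → ≤-refl }

module _ {n : ℕ} (G : Graph n) where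

  open Ranks G

  degree≡deg : ∀ v → degree G v ≡ deg v
  degree≡deg v = trans (length≡ (filter (λ u → T? (adj G v u)) (allFin n)))
    (trans (listSum-filter (λ u → T? (adj G v u)) (λ _ → 1) (allFin n)) (listSum-tabulate (λ u → ⟦ adj G v u ⟧) id))
    where
    length≡ : ∀ {A : Set} (xs : List A) → length xs ≡ listSum (λ _ → 1) xs
    length≡ []       = refl
    length≡ (x ∷ xs) = cong suc (length≡ xs)

  degrees : ℕ
  degrees = sum (map (degree G) (allFin n))

  degrees≡ : degrees ≡ ∑ deg
  degrees≡ = trans (lemma (degree G) id) (sum-cong-≗ degree≡deg)
    where
    lemma : ∀ {A : Set} {k} (f : A → ℕ) (g : Fin k → A) → sum (map f (tabulate g)) ≡ ∑ (f ∘ g)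
    lemma {k = zero}  f g = refl
    lemma {k = suc k} f g = cong (f (g zero) +_) (lemma f (g ∘ suc))

  -- Every edge has exactly one end on side true, so the two sides have equal degree sums. With
  -- sides of equal size, the average over one side is the average over the graph.
  degrees-side : ∀ (side : Fin n → Bool) → (∀ u v → adj G u v ≡ true → side u ≢ side v) →
                 degrees ≡ 2 * ∑ (λ v → ⟦ side v ⟧ * deg v)
  degrees-side side proper = begin
    degrees                                                                    ≡⟨ degrees≡ ⟩
    ∑ deg                                                                      ≡⟨ sum-cong-≗ (λ v → split (side v) (deg v)) ⟩
    ∑ (λ v → ⟦ side v ⟧ * deg v + ⟦ not (side v) ⟧ * deg v)                      ≡⟨ ∑-distrib-+ (λ v → ⟦ side v ⟧ * deg v) (λ v → ⟦ not (side v) ⟧ * deg v) ⟩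
    E + ∑ (λ v → ⟦ not (side v) ⟧ * deg v)                                      ≡⟨ cong (E +_) other ⟩
    E + E                                                                      ≡⟨ cong (E +_) (sym (+-identityʳ E)) ⟩
    2 * E                                                                      ∎
    where
    open ≡-Reasoning
    E = ∑ (λ v → ⟦ side v ⟧ * deg v)
    split : ∀ b k → k ≡ ⟦ b ⟧ * k + ⟦ not b ⟧ * k
    split true  k = sym (trans (+-identityʳ (k + 0)) (+-identityʳ k))
    split false k = sym (+-identityʳ k)
    term : ∀ u v → ⟦ not (side u) ⟧ * ⟦ adj G u v ⟧ ≡ ⟦ side v ⟧ * ⟦ adj G v u ⟧
    term u v rewrite adj-sym G v u with adj G u v in uv
    ... | false = trans (*-zeroʳ ⟦ not (side u) ⟧) (sym (*-zeroʳ ⟦ side v ⟧))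
    ... | true  = cong (_* 1) (flip (side u) (side v) (proper u v uv))
      where
      flip : ∀ b c → b ≢ c → ⟦ not b ⟧ ≡ ⟦ c ⟧
      flip true  true  b≢c = ⊥-elim (b≢c refl)
      flip true  false _   = refl
      flip false true  _   = refl
      flip false false b≢c = ⊥-elim (b≢c refl)
    other : ∑ (λ v → ⟦ not (side v) ⟧ * deg v) ≡ E
    other = trans (sum-cong-≗ λ u → *-distribˡ-sum ⟦ not (side u) ⟧ (λ v → ⟦ adj G u v ⟧))
      (trans (∑-comm (λ u v → ⟦ not (side u) ⟧ * ⟦ adj G u v ⟧))
        (sum-cong-≗ λ v → trans (sum-cong-≗ λ u → term u v) (sym (*-distribˡ-sum ⟦ side v ⟧ (λ u → ⟦ adj G v u ⟧)))))

-- The largest level meets both bounds of Threshold for some j.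
module LevelBound {n : ℕ} .{{n≢0 : NonZero n}} (G : Graph n) (side : Fin n → Bool)
                  (proper : ∀ u v → adj G u v ≡ true → side u ≢ side v) (key : Fin n → ℕ)
                  (rank≤key : ∀ a b → adj G a b ≡ true → Ranks.rank G b ≤ key a)
                  (key-attained : ∀ a → key a ≡ 0 ⊎ Σ[ b ∈ Fin n ] adj G a b ≡ true × Ranks.rank G b ≡ key a)
                  (d : ℝ) (1≤d : 1ℚ ≤ᴿ d) (average≤ : averageDegree G ≤ᴿ d) where

  open Threshold G side proper key rank≤key key-attained
  open States G side proper

  p : ℕ
  p = ∑ (λ v → ⟦ not (side v) ⟧)

  Slow : ℕ → Set
  Slow M = 1 ≤ M × (∀ s → exponent d 1≤d n ᴿ< s → M ≤ 4 ·2^ℚ s)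

  InLevels : ℕ → Set
  InLevels M = ∀ done → (∀ a → lookup done a ≡ true → side a ≡ false) →
    (∀ a c → lookup done a ≡ true → lookup done c ≡ false → side c ≡ false → key a ≤ key c) →
    ∀ xs → Unique xs → All (Reachable done) xs → p + p ≡ n → length xs ≤ M

  one-slow : ∀ s → exponent d 1≤d n ᴿ< s → 1 ≤ 4 ·2^ℚ s
  one-slow s e<s = s≡ (≤-trans (≤-reflexive (^-zeroˡ (suc b-1))) (*-mono-≤ (m^n>0 4 (suc b-1)) (m^n>0 2 a)))
    where open Above.Fraction (Above.fraction-above d 1≤d n s (degrees G) e<s average≤)

  private
   bound-for : Dec (p + p ≡ n) → Σ[ M ∈ ℕ ] Slow M × InLevels M
   bound-for = decide
    where
    decide : Dec (p + p ≡ n) → Σ[ M ∈ ℕ ] Slow M × InLevels M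
    decide (no unbalanced) = 1 , (≤-refl , one-slow) , λ _ _ _ _ _ _ bal → ⊥-elim (unbalanced bal)
    -- The maximum with 1 ensures that the constant part of the work is also at most a multiple of
    -- the number of states.
    decide (yes balanced)  = f i ⊔ 1 , (m≤n⊔m (f i) 1 , slow) , within
      where
      m≡p : m ≡ p
      m≡p = +-cancelˡ-≡ p m p (trans (trans (sym (∑-distrib-+ (λ v → ⟦ not (side v) ⟧) (λ v → ⟦ side v ⟧)))
        (trans (sum-cong-≗ λ v → one (side v)) (trans (∑-const n 1) (*-identityʳ n)))) (sym balanced))
        where
        one : ∀ b → ⟦ not b ⟧ + ⟦ b ⟧ ≡ 1
        one true  = refl
        one false = refl
      r : ℕ → ℕ
      r j = proj₁ (threshold j)
      -- Both estimates for a level with `j` vertices left, combined into one number. Its maximum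
      -- over `j` involves only the degrees, so one bound is available before any rational above the
      -- exponent is given.
      f : ℕ → ℕ
      f j = 2 ^ r j ⊓ _/_ (3 ^ r j) (2 ^ (m ∸ j)) {{m^n≢0 2 (m ∸ j)}}
      best = argmax f m
      i = proj₁ best
      i≤m = proj₁ (proj₂ best)
      within : InLevels (f i ⊔ 1)
      within done ⊆ sorted xs u rs _ = ≤-trans (⊓-glb (proj₁ bounds) division) (≤-trans (proj₂ (proj₂ best) j (m∸n≤m m (size done))) (m≤m⊔n (f i) 1))
        where
        j = m ∸ size done
        size≤m : size done ≤ m
        size≤m = ≤-trans (∑-mono {n} {λ v → ⟦ lookup done v ⟧} {λ v → ⟦ not (side v) ⟧} (λ v → inside v (lookup done v) refl)) (≤-reflexive (sym m≡p))
          where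
          inside : ∀ v b → lookup done v ≡ b → ⟦ b ⟧ ≤ ⟦ not (side v) ⟧
          inside v false _  = z≤n
          inside v true  v∈ = ≤-reflexive (cong (λ s → ⟦ not s ⟧) (sym (⊆ v v∈)))
        bounds : length xs ≤ 2 ^ r j × length xs * 2 ^ size done ≤ 3 ^ r j
        bounds = proj₁ (proj₂ (threshold j)) done ⊆ sorted (trans (m+[n∸m]≡n size≤m) m≡p) u rs
        division : length xs ≤ _/_ (3 ^ r j) (2 ^ (m ∸ j)) {{m^n≢0 2 (m ∸ j)}}
        division = ≤-trans (≤-reflexive (sym (m*n/n≡m (length xs) (2 ^ (m ∸ j)) {{m^n≢0 2 (m ∸ j)}})))
          (/-monoˡ-≤ (2 ^ (m ∸ j)) {{m^n≢0 2 (m ∸ j)}}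
            (≤-trans (≤-reflexive (cong (λ k → length xs * 2 ^ k) (m∸[m∸n]≡n size≤m))) (proj₂ bounds)))
      slow : ∀ s → exponent d 1≤d n ᴿ< s → f i ⊔ 1 ≤ 4 ·2^ℚ s
      slow s e<s = either (≤-total (f i) 1)
        where
        open Above.Fraction (Above.fraction-above d 1≤d n s (degrees G) e<s average≤)
        b = suc b-1
        n≡2m : n ≡ 2 * m
        n≡2m = trans (sym balanced) (trans (cong₂ _+_ (sym m≡p) (sym m≡p)) (cong (m +_) (sym (+-identityʳ m))))
        0<m : 0 < m
        0<m = n≢0⇒n>0 λ m≡0 → ≢-nonZero⁻¹ n (trans n≡2m (cong (2 *_) m≡0))
        average′ : E * y ≤ x * m
        average′ = *-cancelˡ-≤ 2 (≤-trans (≤-reflexive (trans (sym (*-assoc 2 E y)) (cong (_* y) (sym (degrees-side G side proper)))))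
          (≤-trans average (≤-reflexive (trans (cong (x *_) n≡2m) (lemma x m)))))
          where
          lemma : ∀ x m → x * (2 * m) ≡ 2 * (x * m)
          lemma = solve-∀
        above′ : 71 * (m * x * b) ≤ 71 * (a * x) + 20 * (m * b * y)
        above′ = *-cancelˡ-≤ 2 (≤-trans (≤-reflexive (trans (lemma₁ m x b) (cong (λ k → 71 * (k * x * b)) (sym n≡2m))))
          (≤-trans above (≤-reflexive (trans (cong (λ k → 142 * (a * x) + 20 * (k * b * y)) n≡2m) (lemma₂ a x m b y)))))
          where
          lemma₁ : ∀ m x b → 2 * (71 * (m * x * b)) ≡ 71 * (2 * m * x * b)
          lemma₁ = solve-∀
          lemma₂ : ∀ a x m b y → 142 * (a * x) + 20 * (2 * m * b * y) ≡ 2 * (71 * (a * x) + 20 * (m * b * y))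
          lemma₂ = solve-∀
        bound : r i ≡ 0 ⊎ Σ[ κ ∈ ℕ ] κ + r i ≤ suc m × m * i ≤ κ * E → f i ^ b ≤ 4 ^ b * 2 ^ a
        bound (inj₁ r≡0) = ≤-trans (^-monoˡ-≤ b (≤-trans (m⊓n≤m (2 ^ r i) _) (≤-reflexive (cong (2 ^_) r≡0))))
          (≤-trans (≤-reflexive (^-zeroˡ b)) (*-mono-≤ (m^n>0 4 b) (m^n>0 2 a)))
        bound (inj₂ (κ , κ+r , few)) = Growth.growth m (r i) (m ∸ i) i κ E x y a b 0<m 0<x y≤x average′ above′
          (m∸n+n≡m i≤m) κ+r few (f i) (m⊓n≤m (2 ^ r i) _)
          (≤-trans (*-monoˡ-≤ (2 ^ (m ∸ i)) (m⊓n≤n (2 ^ r i) _)) (m/n*n≤m (3 ^ r i) (2 ^ (m ∸ i)) {{m^n≢0 2 (m ∸ i)}}))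
        either : f i ≤ 1 ⊎ 1 ≤ f i → f i ⊔ 1 ≤ 4 ·2^ℚ s
        either (inj₁ fi≤1) = subst (_≤ 4 ·2^ℚ s) (sym (m≤n⇒m⊔n≡n fi≤1)) (one-slow s e<s)
        either (inj₂ 1≤fi) = subst (_≤ 4 ·2^ℚ s) (sym (m≥n⇒m⊔n≡m 1≤fi)) (s≡ {f i} {4} (bound (proj₂ (proj₂ (threshold i)))))

  abstract
    level-bound : Σ[ M ∈ ℕ ] Slow M × InLevels M
    level-bound = bound-for (p + p ≟ n)

-- The complete program and its running time

·2^ℚ-scale : ∀ s {t P M q} → t ≤ P * M → M ≤ q ·2^ℚ s → t ≤ q * P ·2^ℚ s
·2^ℚ-scale (mkℚ (ℤ.+ a) b-1 _) {t} {P} {M} {q} t≤ M≤ = begin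
  t ^ b                    ≤⟨ ^-monoˡ-≤ b t≤ ⟩
  (P * M) ^ b              ≡⟨ *-^-comm P M b ⟩
  P ^ b * M ^ b            ≤⟨ *-monoʳ-≤ (P ^ b) M≤ ⟩
  P ^ b * (q ^ b * 2 ^ a)  ≡⟨ lemma (P ^ b) (q ^ b) (2 ^ a) ⟩
  q ^ b * P ^ b * 2 ^ a    ≡⟨ cong (_* 2 ^ a) (sym (*-^-comm q P b)) ⟩
  (q * P) ^ b * 2 ^ a      ∎
  where
  open ≤-Reasoning
  b = suc b-1
  lemma : ∀ x y z → x * (y * z) ≡ y * x * z
  lemma = solve-∀
·2^ℚ-scale (mkℚ ℤ.-[1+ a ] b-1 _) {t} {P} {M} {q} t≤ M≤ = begin
  t ^ b * 2 ^ suc a            ≤⟨ *-monoˡ-≤ (2 ^ suc a) (^-monoˡ-≤ b t≤) ⟩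
  (P * M) ^ b * 2 ^ suc a      ≡⟨ cong (_* 2 ^ suc a) (*-^-comm P M b) ⟩
  P ^ b * M ^ b * 2 ^ suc a    ≡⟨ *-assoc (P ^ b) (M ^ b) (2 ^ suc a) ⟩
  P ^ b * (M ^ b * 2 ^ suc a)  ≤⟨ *-monoʳ-≤ (P ^ b) M≤ ⟩
  P ^ b * q ^ b                ≡⟨ *-comm (P ^ b) (q ^ b) ⟩
  q ^ b * P ^ b                ≡⟨ sym (*-^-comm q P b) ⟩
  (q * P) ^ b                  ∎
  where
  open ≤-Reasoning
  b = suc b-1

program : Program
program = boot K scratch ⨾ compile prepC 2 ⨾ compile countC 2 ⨾ compileE result 2 ⨾ reg 0 ≔ reg 2 ⟨ add ⟩ lit 0

abstract
  running-time : Polynomial (λ n → eval-bound (totalB :* instructionB) n 1)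
  running-time = bound-polynomial (totalB :* instructionB)

bits-2^ : ∀ L {u} → u ≤ 2 ^ L → bits u ≤ suc L
bits-2^ L u≤ = s≤s (≤-trans (⌊log₂⌋-mono-≤ u≤) (≤-reflexive (⌊log₂[2^n]⌋≡n L)))

address-2^ : ∀ L → 2 ^ L * K + K + 2 ^ L ≤ 2 ^ (6 + L)
address-2^ L = begin
  2 ^ L * K + K + 2 ^ L   ≤⟨ +-monoˡ-≤ (2 ^ L) (+-monoʳ-≤ (2 ^ L * K) (*-monoˡ-≤ K (m^n>0 2 L))) ⟩
  2 ^ L * K + 2 ^ L * K + 2 ^ L  ≡⟨ lemma (2 ^ L) ⟩
  51 * 2 ^ L              ≤⟨ *-monoˡ-≤ (2 ^ L) (≤ᵇ⇒≤ 51 64 tt) ⟩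
  64 * 2 ^ L              ≡⟨ sym (^-distribˡ-+-* 2 6 L) ⟩
  2 ^ (6 + L)             ∎
  where
  open ≤-Reasoning
  lemma : ∀ v → v * 25 + v * 25 + v ≡ 51 * v
  lemma = solve-∀

module Main (d : ℝ) (1≤d : 1ℚ ≤ᴿ d) {n : ℕ} .{{n≢0 : NonZero n}} (G : Graph n) (side₀ : Fin n → Bool)
            (proper₀ : ∀ u v → adj G u v ≡ true → side₀ u ≢ side₀ v) (average≤ : averageDegree G ≤ᴿ d) where

  open Input G

  abstract
    V : ℕ
    V = 2 ^ logV n

    V≡ : V ≡ 2 ^ logV n
    V≡ = refl

  V-large : 2 ^ exponentV n ≤ V
  V-large = subst (2 ^ exponentV n ≤_) (sym V≡) (^-monoʳ-≤ 2 (m≤m+n (exponentV n) (5 + scratch)))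

  logV≤V : logV n ≤ V
  logV≤V = subst (logV n ≤_) (sym V≡) (<⇒≤ (n<2^n (logV n)))

  base≤V : n * n + (5 + scratch) ≤ V
  base≤V = ≤-trans (+-monoˡ-≤ (5 + scratch) (m≤m+n (n * n) (n + n + 8))) logV≤V

  1+n≤V : 1 + n ≤ V
  1+n≤V = ≤-trans (≤-trans (≤-reflexive (+-comm 1 n)) (+-mono-≤ (≤-trans (m≤m+n n (n + 8)) (≤-trans (≤-reflexive (sym (+-assoc n n 8))) (m≤n+m (n + n + 8) (n * n)))) (s≤s z≤n))) logV≤V

  module Booting = Boot K scratch n V base≤V (Bounds.8≤V n V V-large) cAdj refl input refl (input1 G)
                     (λ i → ≤-trans (input≤ i) 1+n≤V) input-end

  open Booting using (base; 0<base)
  open Machine K base V 0<base base≤V (Bounds.8≤V n V V-large)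
  open Prep G side₀ proper₀ base V 0<base base≤V V-large

  Good : ℕ → Set
  Good k = Σ[ M ∈ ℕ ] k ≡ countWork n M × 1 ≤ M × (∀ s → exponent d 1≤d n ᴿ< s → M ≤ 4 ·2^ℚ s)

  Answer : State K → Set
  Answer σ = Fine σ result × eval σ result ≡ length (perfectMatchings G)

  -- The bound on the levels is taken for the sides and keys that the preparation has left in the
  -- columns, not for the given colouring; the work `k` therefore depends on the state `σ`.
  count-prepared : ∀ {σ} → Prepared σ → Σ[ k ∈ ℕ ] Good k × Triple countC σ k Answer
  count-prepared {σ} (side , proper , (((((en , ea , eT , eQ , eL , eTop) , side≡) , _) , keyed) , count≡) , pow≡) =
    countWork n M , (M , refl , proj₁ (proj₁ (proj₂ bound)) , proj₂ (proj₁ (proj₂ bound))) , t-map (λ {σ′} → answer {σ′}) counted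
    where
    key : Fin n → ℕ
    key v = σ cKey (toℕ v)
    rank≤key : ∀ a b → adj G a b ≡ true → Ranks.rank G b ≤ key a
    rank≤key a = proj₁ (keyed a (toℕ<n a))
    key-attained : ∀ a → key a ≡ 0 ⊎ Σ[ b ∈ Fin n ] adj G a b ≡ true × Ranks.rank G b ≡ key a
    key-attained a = proj₂ (keyed a (toℕ<n a))
    key≤ : ∀ a → key a ≤ n * n + n
    key≤ a = case key-attained a of λ
      { (inj₁ ≡0) → ≤-trans (≤-reflexive ≡0) z≤n
      ; (inj₂ (b , _ , eq)) → ≤-trans (≤-reflexive (sym eq)) (Ranks.rank≤ G b) }
    p : ℕ
    p = ∑ (λ v → ⟦ not (side v) ⟧)
    bound = LevelBound.level-bound G side proper key rank≤key key-attained d 1≤d average≤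
    M = proj₁ bound
    module C = Counting G side proper key key≤ base V 0<base base≤V V-large
    within : C.Within (C.Balanced p refl) M
    within = proj₂ (proj₂ bound)
    counted : Triple countC σ (countWork n M) (C.Done p refl (C.treated (n * n + n + 1) 0))
    counted = C.count-triple p refl {M} {σ} within (en , ea , side≡ , (λ _ → refl) , pow≡) count≡ eT eQ eL eTop
    answer : ∀ {σ′} → C.Done p refl (C.treated (n * n + n + 1) 0) σ′ → Answer σ′
    answer {σ′} done = _ , trans (C.result-correct p refl {σ′} done) (sym (length-perfectMatchings G))

  B≤ : B ≤ instructionCost n
  B≤ = ≤-trans (≤-reflexive B≡) (*-monoʳ-≤ 9 (bits-2^ (6 + logV n) (≤-trans (≤-reflexive (trans U≡ (cong (λ v → v * K + K + v) V≡))) (address-2^ (logV n)))))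

  prepared : ∀ σ → (∀ i → σ cAdj i ≡ input i) → (∀ a i → toℕ a ≢ 0 → σ a i ≡ 0) →
             Triple prepC σ (prepWork n) (λ σ′ → Σ[ k ∈ ℕ ] Good k × Triple countC σ′ k Answer)
  prepared σ copy zeros = t-map (λ {σ′} → count-prepared {σ′}) (prep-triple {σ} keep (λ i → zeros cSide i λ ()))
    where
    keep : Keep σ
    keep = copy 0 , (λ u v → trans (copy _) (input-adj u v)) , (λ i → zeros cTable i λ ()) ,
           zeros cQueue 0 (λ ()) , zeros cLo 0 (λ ()) , zeros cTop 0 (λ ())

  height≤ : 2 + (height prepC ⊔ (height countC ⊔ heightE result)) ≤ 5 + scratch
  height≤ = ≤ᵇ⇒≤ _ _ tt

  runs : Σ[ k ∈ ℕ ] Good k × Runs program input (bootWork scratch n + (prepWork n + (sizeE result + 1)) + k)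
           (λ μ → μ 0 ≡ length (perfectMatchings G))
  runs = Booting.runs-program prepC countC result {prepWork n} {length (perfectMatchings G)} {Good} height≤ prepared

  open Polynomial running-time

  Conclusion : Set
  Conclusion = Σ[ t ∈ ℕ ] (program On encode G Outputs length (perfectMatchings G) InTime t
                          × t ≤ 4 * factor * n ^ degree′ ·2^ exponent d 1≤d n)

  conclude : ∀ {k} → Good k → Runs program input (bootWork scratch n + (prepWork n + (sizeE result + 1)) + k)
               (λ μ → μ 0 ≡ length (perfectMatchings G)) → Conclusion
  conclude (M , refl , 1≤M , M≤) (ran {μ} {t} run t≤ out) = t , (μ , run , out) , λ s e<s →
    subst (λ q → t ≤ q ·2^ℚ s) (sym (*-assoc 4 factor (n ^ degree′))) (·2^ℚ-scale s {t} {factor * n ^ degree′} {M} {4} t≤′ (M≤ s e<s))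
    where
    t≤′ : t ≤ factor * n ^ degree′ * M
    t≤′ = chain (bootWork scratch n + (prepWork n + (sizeE result + 1)) + countWork n M) t≤ B≤ (work≤ n {M} 1≤M) (bounded n (n≢0⇒n>0 (≢-nonZero⁻¹ n)))
      where
      chain : ∀ w {B I P F} → t ≤ w * B → B ≤ I → w * I ≤ P * M → P ≤ F → t ≤ F * M
      chain w p q r s = ≤-trans p (≤-trans (*-monoʳ-≤ w q) (≤-trans r (*-monoˡ-≤ M s)))

  conclusion : Conclusion
  conclusion = conclude (proj₁ (proj₂ runs)) (proj₂ (proj₂ runs))

theorem1p3 : ∀ (d : ℝ) (1≤d : 1ℚ ≤ᴿ d) →
    Σ[ P ∈ Program ] Σ[ C ∈ ℕ ] Σ[ k ∈ ℕ ]
    (∀ (n : ℕ) .{{_ : NonZero n}} (G : Graph n) →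
    Bipartite G → averageDegree G ≤ᴿ d →
    Σ[ t ∈ ℕ ] (P On encode G Outputs length (perfectMatchings G) InTime t
    × t ≤ C * n ^ k ·2^ exponent d 1≤d n))
theorem1p3 d 1≤d = program , 4 * Polynomial.factor running-time , Polynomial.degree′ running-time ,
  λ n G (side , proper) average≤ → Main.conclusion d 1≤d G side (λ u v uv → proper u v (subst T (sym uv) tt)) average≤
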